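{- Let $G$ be a one-based group. Then for any positive integer $m$: $$\mathrm{dp}(G^m)=\mathrm{vc}^{\mathrm{Th}(G)}(m).$$ Furthermore, if both are finite, then they agree with the breadth of the semilattice of commensurability classes of the $\mathrm{acl}^{\mathrm{eq}}(\emptyset)$-definable subgroups of $G^m$.
   Context: Work in a complete theory with infinite models, inside a sufficiently saturated model. A group $G$ (possibly with additional structure) is one-based if for every $m$ any definable subset of $G^m$ is a finite boolean combination of cosets of $\mathrm{acl}^{\mathrm{eq}}(\emptyset)$-definable subgroups of $G^m$. The theory of a one-based group is stable. dp-rank. An inp-pattern of depth $\kappa$ for a partial type $\pi(x)$ is a sequence of formulas $(\varphi^\alpha(x,y^\alpha))_{\alpha<\kappa}$ together with natural numbers $(k^\alpha)_{\alpha<\kappa}$ such that there is an array of tuples $(b_i^\alpha)_{\alpha<\kappa,i<\omega}$ for which each row $\{\varphi^\alpha(x,b_i^\alpha)\}_{i<\omega}$ is $k^\alpha$-inconsistent, while for every $\eta:\kappa\to\omega$ the path $\pi(x)\cup\{\varphi^\alpha(x,b^\alpha_{\eta(\alpha)})\}_{\alpha<\kappa}$ is consistent. In a stable theory the dp-rank of $\pi$ is the supremum of the cardinals $\kappa$ for which there is an inp-pattern of depth $\kappa$ for $\pi$. $\mathrm{dp}(G^m)$ is the dp-rank of $\{x=x\}$ with $x$ an $m$-tuple of variables. vc-density. For a class $\mathcal S$ of subsets of a set $X$, the shatter function is $\pi_{\mathcal S}(n)=\max\{|\{C\cap A:C\in\mathcal S\}|: A\subseteq X,|A|=n\}$, and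 $\mathrm{vc}(\mathcal S)$ is the infimum of the reals $r\ge0$ with $\pi_{\mathcal S}(n)=O(n^r)$ ($\infty$ if there is none). For a formula $\varphi(x;y)$ with object variables $x$ and parameter variables $y$, $\mathcal S_\varphi=\{\varphi(\mathbb M;b):b\in\mathbb M^{|y|}\}$ for $\mathbb M$ a sufficiently saturated model of $T$. The vc-density of $T$ is the function $\mathrm{vc}^T:\mathbb N\to\mathbb R^{\ge0}\cup\{\infty\}$, $\mathrm{vc}^T(n)=\sup\{\mathrm{vc}(\mathcal S_\varphi):\varphi(x;y)\text{ a formula of }T\text{ with }|y|=n\}$. The equality of dp-rank and vc-density means that either both are infinite or both are finite and equal. Commensurability and breadth. Two subgroups $H,N$ of a group are commensurable if $H\cap N$ has finite index in both $H$ and $N$. Commensurability classes of $\mathrm{acl}^{\mathrm{eq}}(\emptyset)$-definable subgroups form a semilattice, the meet of the classes of $H$ and $N$ being the class of $H\cap N$. The breadth of a semilattice $L$ is the smallest integer $d$, if it exists, such that for all $x_1,\dots,x_n\in L$ with $n>d$ there are $1\le i_1<\dots<i_d\le n$ with $x_1\wedge\dots\wedge x_n=x_{i_1}\wedge\dots\wedge x_{i_d}$ (the empty intersection of subgroups being the whole group). -}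

module Defs where

open import Algebra.Bundles using (Group)
import Algebra.Construct.Pointwise as Pointwise
open import Data.Fin.Base as Fin using (Fin)
open import Data.Fin.Subset using (Subset) renaming (_∈_ to _∈ₛ_)
open import Data.Integer.Base using (+_)
open import Data.List.Base using (List; length)
open import Data.List.Membership.Propositional using () renaming (_∈_ to _∈ₗ_)
import Data.List.Membership.Setoid as SetoidMembership
open import Data.List.Relation.Unary.All using (All)
open import Data.List.Relation.Unary.Any using (Any)
open import Data.List.Relation.Unary.Unique.Propositional using (Unique)
open import Data.Maybe.Base using (Maybe; just; nothing; maybe)
open import Data.Nat.Base as ℕ using (ℕ; NonZero)
open import Data.Product.Base using (Σ-syntax; ∃; ∃-syntax; _×_; _,_; proj₁; proj₂)
open import Data.Rational.Base as ℚ using (ℚ; 0ℚ)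
import Data.Rational.Properties as ℚ
open import Data.Sum.Base using (_⊎_; inj₁; inj₂; [_,_])
open import Data.Unit.Polymorphic.Base using (⊤; tt)
open import Function.Base using (_∘_; const)
open import Function.Bundles using (_⇔_; _↣_)
open import Function.Definitions using (Injective)
open import Level using (Level; 0ℓ; suc; _⊔_)
open import Relation.Binary.Bundles using (Setoid)
open import Relation.Binary.Core using () renaming (Rel to BinRel)
open import Relation.Binary.PropositionalEquality.Core using (_≡_; refl)
open import Relation.Binary.Structures using (IsEquivalence)
open import Relation.Nullary.Negation.Core using (¬_)
open import Relation.Unary using (Pred; _∈_; _∩_; ∁; ∅)

private
  variable
    a b p r : Level

-- Groups are one-sorted, but Mᵉᵠ is not, so the syntax is many-sorted.
-- A context is a type X of variables together with a sort for each of
-- them; free variables x : A and y : B are combined as A ⊎ B, and a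
-- binder extends X to Maybe X.

record Language ℓ : Set (suc ℓ) where
  field
    Sort     : Set ℓ
    Fun      : Set ℓ
    funArity : Fun → ℕ
    dom      : (f : Fun) → Fin (funArity f) → Sort
    cod      : Fun → Sort
    Rel      : Set ℓ
    relArity : Rel → ℕ
    relDom   : (R : Rel) → Fin (relArity R) → Sort

module Syntax {ℓ} (L : Language ℓ) where
  open Language L

  data Term {X : Set} (Γ : X → Sort) : Sort → Set ℓ where
    var : (x : X) → Term Γ (Γ x)
    fun : (f : Fun) → ((i : Fin (funArity f)) → Term Γ (dom f i)) →
          Term Γ (cod f)

  infix  8 _≐_
  infixr 7 _∧′_

  data Formula {X : Set} (Γ : X → Sort) : Set ℓ where
    _≐_  : ∀ {s} → Term Γ s → Term Γ s → Formula Γ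
    rel  : (R : Rel) → ((i : Fin (relArity R)) → Term Γ (relDom R i)) →
           Formula Γ
    ¬′_  : Formula Γ → Formula Γ
    _∧′_ : Formula Γ → Formula Γ → Formula Γ
    ∃′   : (s : Sort) → Formula (maybe Γ s) → Formula Γ

open Syntax public using (Term; var; fun; Formula; _≐_; rel; ¬′_; _∧′_; ∃′)

-- Equality on each sort is a setoid equality, so that the sorts of Mᵉᵠ
-- can be presented as quotients.

record Structure {ℓ} (L : Language ℓ) : Set (suc ℓ) where
  open Language L
  field
    carrier : Sort → Setoid ℓ ℓ

  ∣_∣ : Sort → Set ℓ
  ∣ s ∣ = Setoid.Carrier (carrier s)

  Valuation : {X : Set} → (X → Sort) → Set ℓ
  Valuation Γ = ∀ x → ∣ Γ x ∣

  infix 4 _≋_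
  _≋_ : {X : Set} {Γ : X → Sort} → Valuation Γ → Valuation Γ → Set ℓ
  _≋_ {Γ = Γ} v w = ∀ x → Setoid._≈_ (carrier (Γ x)) (v x) (w x)

  field
    ⟦_⟧ᶠ    : (f : Fun) → Valuation (dom f) → ∣ cod f ∣
    ⟦⟧ᶠ-cong : ∀ f {v w} → v ≋ w →
               Setoid._≈_ (carrier (cod f)) (⟦ f ⟧ᶠ v) (⟦ f ⟧ᶠ w)
    ⟦_⟧ᴿ    : (R : Rel) → Valuation (relDom R) → Set ℓ
    ⟦⟧ᴿ-resp : ∀ R {v w} → v ≋ w → ⟦ R ⟧ᴿ v → ⟦ R ⟧ᴿ w

module Semantics {ℓ} {L : Language ℓ} (M : Structure L) where
  open Language L
  open Structure M

  module _ {X : Set} {Γ : X → Sort} where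

    infixl 5 _▸_
    _▸_ : ∀ {s} → Valuation Γ → ∣ s ∣ → Valuation (maybe Γ s)
    (v ▸ c) nothing  = c
    (v ▸ c) (just x) = v x

    eval : ∀ {s} → Term L Γ s → Valuation Γ → ∣ s ∣
    eval (var x)    v = v x
    eval (fun f ts) v = ⟦ f ⟧ᶠ λ i → eval (ts i) v

  infix 4 _⊨_
  _⊨_ : ∀ {X} {Γ : X → Sort} → Valuation Γ → Formula L Γ → Set ℓ
  v ⊨ _≐_ {s} t u = Setoid._≈_ (carrier s) (eval t v) (eval u v)
  v ⊨ rel R ts    = ⟦ R ⟧ᴿ λ i → eval (ts i) v
  v ⊨ ¬′ φ        = ¬ (v ⊨ φ)
  v ⊨ φ ∧′ ψ      = (v ⊨ φ) × (v ⊨ ψ)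
  v ⊨ ∃′ s φ      = Σ[ c ∈ ∣ s ∣ ] (v ▸ c ⊨ φ)

  ≋-sym : ∀ {X} {Γ : X → Sort} {v w : Valuation Γ} → v ≋ w → w ≋ v
  ≋-sym {Γ = Γ} e x = Setoid.sym (carrier (Γ x)) (e x)

  eval-cong : ∀ {X} {Γ : X → Sort} {s} (t : Term L Γ s) {v w : Valuation Γ} →
              v ≋ w → Setoid._≈_ (carrier s) (eval t v) (eval t w)
  eval-cong (var x)    e = e x
  eval-cong (fun f ts) e = ⟦⟧ᶠ-cong f λ i → eval-cong (ts i) e

  ⊨-resp-≋ : ∀ {X} {Γ : X → Sort} (φ : Formula L Γ) {v w : Valuation Γ} →
             v ≋ w → v ⊨ φ → w ⊨ φ
  ⊨-resp-≋ (_≐_ {s} t u) e h =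
    trans (sym (eval-cong t e)) (trans h (eval-cong u e))
    where open Setoid (carrier s)
  ⊨-resp-≋ (rel R ts) e h       = ⟦⟧ᴿ-resp R (λ i → eval-cong (ts i) e) h
  ⊨-resp-≋ (¬′ φ)     e h h′    = h (⊨-resp-≋ φ (≋-sym e) h′)
  ⊨-resp-≋ (φ ∧′ ψ)   e (h , k) = ⊨-resp-≋ φ e h , ⊨-resp-≋ ψ e k
  ⊨-resp-≋ (∃′ s φ)   e (c , h) = c , ⊨-resp-≋ φ e▸ h
    where
    e▸ : _ ≋ _
    e▸ nothing  = Setoid.refl (carrier s)
    e▸ (just x) = e x

FinitelyMany : (S : Setoid a b) → Pred (Setoid.Carrier S) p → Set (a ⊔ b ⊔ p)
FinitelyMany S P = ∃[ xs ] (∀ x → P x → x ∈ₘ xs)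
  where open SetoidMembership S renaming (_∈_ to _∈ₘ_)

module Imaginaries {ℓ} {L : Language ℓ} (M : Structure L) where
  open Language L
  open Structure M
  open Semantics M using (_⊨_; ⊨-resp-≋)

  record DefinableEquivalence : Set ℓ where
    field
      arity         : ℕ
      sorts         : Fin arity → Sort
      formula       : Formula L {Fin arity ⊎ Fin arity} [ sorts , sorts ]

    Tuple : Set ℓ
    Tuple = Valuation sorts

    _∼_ : Tuple → Tuple → Set ℓ
    v ∼ w = [ v , w ] ⊨ formula

    field
      isEquivalence : IsEquivalence _∼_

    setoid : Setoid ℓ ℓ
    setoid = record { isEquivalence = isEquivalence }

    ≋⇒∼ : ∀ {v w} → v ≋ w → v ∼ w
    ≋⇒∼ {v} {w} e = ⊨-resp-≋ formula e′ (IsEquivalence.refl isEquivalence)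
      where
      e′ : [ v , v ] ≋ [ v , w ]
      e′ (inj₁ i) = Setoid.refl (carrier (sorts i))
      e′ (inj₂ i) = e i

  data Sortᵉᵠ : Set ℓ where
    home : Sort → Sortᵉᵠ
    quot : DefinableEquivalence → Sortᵉᵠ

  data Funᵉᵠ : Set ℓ where
    old  : Fun → Funᵉᵠ
    proj : DefinableEquivalence → Funᵉᵠ

  languageᵉᵠ : Language ℓ
  languageᵉᵠ = record
    { Sort     = Sortᵉᵠ
    ; Fun      = Funᵉᵠ
    ; funArity = arityᵉᵠ
    ; dom      = domᵉᵠ
    ; cod      = λ { (old f) → home (cod f) ; (proj E) → quot E }
    ; Rel      = Rel
    ; relArity = relArity
    ; relDom   = λ R i → home (relDom R i)
    }
    where
    arityᵉᵠ : Funᵉᵠ → ℕ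
    arityᵉᵠ (old f)  = funArity f
    arityᵉᵠ (proj E) = DefinableEquivalence.arity E

    domᵉᵠ : (f : Funᵉᵠ) → Fin (arityᵉᵠ f) → Sortᵉᵠ
    domᵉᵠ (old f)  i = home (dom f i)
    domᵉᵠ (proj E) i = home (DefinableEquivalence.sorts E i)

  structureᵉᵠ : Structure languageᵉᵠ
  structureᵉᵠ = record
    { carrier  = λ { (home s) → carrier s
                   ; (quot E) → DefinableEquivalence.setoid E }
    ; ⟦_⟧ᶠ     = λ { (old f) → ⟦ f ⟧ᶠ ; (proj E) v → v }
    ; ⟦⟧ᶠ-cong = λ { (old f) → ⟦⟧ᶠ-cong f
                   ; (proj E) → DefinableEquivalence.≋⇒∼ E }
    ; ⟦_⟧ᴿ     = ⟦_⟧ᴿ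
    ; ⟦⟧ᴿ-resp = ⟦⟧ᴿ-resp
    }

  open Structure structureᵉᵠ public using ()
    renaming (carrier to carrierᵉᵠ; ∣_∣ to ∣_∣ᵉᵠ; Valuation to Valuationᵉᵠ)
  open Semantics structureᵉᵠ public using () renaming (_⊨_ to _⊨ᵉᵠ_)

  InAclᵉᵠ∅ : (s : Sortᵉᵠ) → ∣ s ∣ᵉᵠ → Set ℓ
  InAclᵉᵠ∅ s e = Σ[ φ ∈ Formula languageᵉᵠ {⊤} (const s) ]
    (const e ⊨ᵉᵠ φ) ×
    FinitelyMany (carrierᵉᵠ s) (λ e′ → const e′ ⊨ᵉᵠ φ)

  record IsAclᵉᵠ∅Definable {n} {sorts : Fin n → Sort}
                           (D : Pred (Valuation sorts) ℓ) : Set ℓ where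
    field
      arity      : ℕ
      paramSorts : Fin arity → Sortᵉᵠ
      params     : Valuationᵉᵠ paramSorts
      algebraic  : ∀ j → InAclᵉᵠ∅ (paramSorts j) (params j)
      formula    : Formula languageᵉᵠ {Fin n ⊎ Fin arity}
                           [ home ∘ sorts , paramSorts ]
      defines    : ∀ v → D v ⇔ ([ v , params ] ⊨ᵉᵠ formula)

data GroupOp : Set where
  mul inv unit : GroupOp

-- Fun and Rel are the symbols beyond those of groups.

record ExpandedGroup ℓ : Set (suc ℓ) where
  field
    group    : Group ℓ ℓ
  open Group group public
  field
    Fun      : Set ℓ
    funArity : Fun → ℕ
    Rel      : Set ℓ
    relArity : Rel → ℕ
    ⟦_⟧ᶠ     : (f : Fun) → (Fin (funArity f) → Carrier) → Carrier
    ⟦⟧ᶠ-cong : ∀ f {v w} → (∀ i → v i ≈ w i) → ⟦ f ⟧ᶠ v ≈ ⟦ f ⟧ᶠ w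
    ⟦_⟧ᴿ     : (R : Rel) → (Fin (relArity R) → Carrier) → Set ℓ
    ⟦⟧ᴿ-resp : ∀ R {v w} → (∀ i → v i ≈ w i) → ⟦ R ⟧ᴿ v → ⟦ R ⟧ᴿ w

  language : Language ℓ
  language = record
    { Sort     = ⊤
    ; Fun      = GroupOp ⊎ Fun
    ; funArity = [ groupArity , funArity ]
    ; Rel      = Rel
    ; relArity = relArity
    }
    where
    groupArity : GroupOp → ℕ
    groupArity mul  = 2
    groupArity inv  = 1
    groupArity unit = 0

  structure : Structure language
  structure = record
    { carrier  = λ _ → setoid
    ; ⟦_⟧ᶠ     = λ { (inj₁ mul) v → v Fin.zero ∙ v (Fin.suc Fin.zero)
                   ; (inj₁ inv) v → v Fin.zero ⁻¹
                   ; (inj₁ unit) v → ε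
                   ; (inj₂ f) v → ⟦ f ⟧ᶠ v }
    ; ⟦⟧ᶠ-cong = λ { (inj₁ mul) e → ∙-cong (e Fin.zero) (e (Fin.suc Fin.zero))
                   ; (inj₁ inv) e → ⁻¹-cong (e Fin.zero)
                   ; (inj₁ unit) e → Group.refl group
                   ; (inj₂ f) e → ⟦⟧ᶠ-cong f e }
    ; ⟦_⟧ᴿ     = ⟦_⟧ᴿ
    ; ⟦⟧ᴿ-resp = ⟦⟧ᴿ-resp
    }

  power : ℕ → Group ℓ ℓ
  power m = Pointwise.group (Fin m) group

module Subgroups {c ℓ} (G : Group c ℓ) where
  open Group G

  record IsSubgroup (H : Pred Carrier p) : Set (c ⊔ ℓ ⊔ p) where
    field
      resp-≈    : ∀ {x y} → x ≈ y → x ∈ H → y ∈ H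
      ε-closed  : ε ∈ H
      ∙-closed  : ∀ {x y} → x ∈ H → y ∈ H → x ∙ y ∈ H
      ⁻¹-closed : ∀ {x} → x ∈ H → x ⁻¹ ∈ H

  leftCoset : Carrier → Pred Carrier p → Pred Carrier p
  leftCoset g H x = g ⁻¹ ∙ x ∈ H

  HasFiniteIndexIn : Pred Carrier p → Pred Carrier p → Set (c ⊔ p)
  HasFiniteIndexIn K H =
    ∃[ gs ] All H gs × (∀ x → x ∈ H → Any (λ g → x ∈ leftCoset g K) gs)

  Commensurable : Pred Carrier p → Pred Carrier p → Set (c ⊔ p)
  Commensurable H N = HasFiniteIndexIn (H ∩ N) H × HasFiniteIndexIn (H ∩ N) N

-- Elements of the semilattice are represented by A, and ⋀ takes a finite
-- family (possibly empty) to a representative of its meet, two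
-- representatives being identified by _≈_.

module Breadth {A : Set a} {B : Set b}
               (⋀ : ∀ {n} → (Fin n → A) → B) (_≈_ : BinRel B r) where

  BreadthAtMost : ℕ → Set (a ⊔ r)
  BreadthAtMost d = ∀ {n} → d ℕ.< n → (x : Fin n → A) →
    Σ[ i ∈ (Fin d → Fin n) ]
      (∀ {j k} → j Fin.< k → i j Fin.< i k) × (⋀ x ≈ ⋀ (x ∘ i))

  IsBreadth : ℕ → Set (a ⊔ r)
  IsBreadth d = BreadthAtMost d × (∀ e → BreadthAtMost e → d ℕ.≤ e)

data BooleanCombination (A : Set a) : Set a where
  atom : A → BooleanCombination A
  _∩′_ : BooleanCombination A → BooleanCombination A → BooleanCombination A
  ∁′_  : BooleanCombination A → BooleanCombination A

⟦_⟧ᴮ : {A : Set a} {X : Set b} →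
       BooleanCombination A → (A → Pred X p) → Pred X p
⟦ atom c ⟧ᴮ  D = D c
⟦ B ∩′ C ⟧ᴮ  D = ⟦ B ⟧ᴮ D ∩ ⟦ C ⟧ᴮ D
⟦ ∁′ B ⟧ᴮ    D = ∁ (⟦ B ⟧ᴮ D)

-- The extended nonnegative reals: x ∈ [0,∞] is given by the set { q ∈ ℚ ∣ x < q }: classically these are the
-- Dedekind cuts, with ∞ as the empty one.

record ℝ∞ : Set₁ where
  field
    _<_     : Pred ℚ 0ℓ
    nonneg  : ∀ {q} → _<_ q → 0ℚ ℚ.< q
    upward  : ∀ {q q′} → q ℚ.≤ q′ → _<_ q → _<_ q′
    rounded : ∀ {q} → _<_ q → ∃[ q′ ] (q′ ℚ.< q) × _<_ q′

module _ where
  open ℝ∞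

  infix 4 _≤ᴿ_ _≈ᴿ_
  _≤ᴿ_ _≈ᴿ_ : ℝ∞ → ℝ∞ → Set
  x ≤ᴿ y = ∀ q → (y < q) → (x < q)
  x ≈ᴿ y = (x ≤ᴿ y) × (y ≤ᴿ x)

  IsFinite : ℝ∞ → Set
  IsFinite x = ∃[ q ] (x < q)

  ∞ᴿ : ℝ∞
  ∞ᴿ = record { _<_ = ∅ ; nonneg = λ () ; upward = λ _ () ; rounded = λ () }

  -- A bound k ≤ C nʳ, for n ≥ 1 and r finite. Since n ≥ 1, nʳ is the
  -- infimum of n^(s/t) over the rationals s/t > r, and k ≤ C n^(s/t) is
  -- cleared of roots.
  infix 4 _≤_·_^ᴿ_
  _≤_·_^ᴿ_ : ℕ → ℕ → ℕ → ℝ∞ → Set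
  k ≤ C · n ^ᴿ r = ∀ s t .{{_ : NonZero t}} →
    (r < (+ s ℚ./ t)) → k ℕ.^ t ℕ.≤ (C ℕ.^ t) ℕ.* (n ℕ.^ s)

fromℕᴿ : ℕ → ℝ∞
fromℕᴿ d = record
  { _<_     = λ q → d′ ℚ.< q
  ; nonneg  = ℚ.≤-<-trans (ℚ.nonNegative⁻¹ d′ {{ℚ.normalize-nonNeg d 1}})
  ; upward  = λ q≤q′ d<q → ℚ.<-≤-trans d<q q≤q′
  ; rounded = λ d<q → let q′ , d<q′ , q′<q = ℚ.<-dense d<q in q′ , q′<q , d<q′
  }
  where d′ = + d ℚ./ 1

IsInf IsSup : Pred ℝ∞ p → ℝ∞ → Set (suc 0ℓ ⊔ p)
IsInf P v = (∀ x → P x → v ≤ᴿ x) × (∀ w → (∀ x → P x → w ≤ᴿ x) → w ≤ᴿ v)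
IsSup P v = (∀ x → P x → x ≤ᴿ v) × (∀ w → (∀ x → P x → x ≤ᴿ w) → v ≤ᴿ w)

HasCardinality : ∀ {n} → Pred (Subset n) p → ℕ → Set p
HasCardinality P k =
  ∃[ Ts ] Unique Ts × (∀ T → (T ∈ₗ Ts) ⇔ P T) × length Ts ≡ k

-- The set system is { 𝒮 c ∣ c : B }.

module VC (X : Setoid a b) {B : Set p} (𝒮 : B → Pred (Setoid.Carrier X) r) where
  open Setoid X using (_≈_) renaming (Carrier to ∣X∣)

  -- { C ∩ A ∣ C ∈ 𝒮 } for A = { A 0 , … , A (n - 1) }, as sets of indices
  Traces : ∀ {n} → (Fin n → ∣X∣) → Pred (Subset n) (p ⊔ r)
  Traces A T = ∃[ c ] (∀ i → (i ∈ₛ T) ⇔ (A i ∈ 𝒮 c))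

  ShatterAtMost : ℕ → ℕ → Set (a ⊔ b ⊔ p ⊔ r)
  ShatterAtMost n k = (A : Fin n → ∣X∣) → Injective _≡_ _≈_ A →
    ∀ j → HasCardinality (Traces A) j → j ℕ.≤ k

  -- π_𝒮(n) = k; the maximum is taken in ℕ, so it is 0 if X has fewer than
  -- n elements.
  Shatter : ℕ → ℕ → Set (a ⊔ b ⊔ p ⊔ r)
  Shatter n k = ShatterAtMost n k × (∀ j → ShatterAtMost n j → k ℕ.≤ j)

  GrowthAtMost : Pred ℝ∞ (a ⊔ b ⊔ p ⊔ r)
  GrowthAtMost s = ∃[ C ] ∃[ N ] (∀ n → N ℕ.≤ n →
    ∀ k → Shatter n k → k ≤ C · n ^ᴿ s)

  IsVCDensity : ℝ∞ → Set (suc 0ℓ ⊔ a ⊔ b ⊔ p ⊔ r)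
  IsVCDensity = IsInf (λ s → IsFinite s × GrowthAtMost s)

module ModelTheory {ℓ} (G : ExpandedGroup ℓ) where
  open ExpandedGroup G
  open Semantics structure public using (_⊨_)
  open Imaginaries structure public using (IsAclᵉᵠ∅Definable)

  Tuple : ℕ → Set ℓ
  Tuple m = Fin m → Carrier

  L-Formula : Set → Set ℓ
  L-Formula X = Formula language {X} (const tt)

  record ParamFormula (n : ℕ) : Set ℓ where
    constructor _⟨_⟩
    field
      {arity} : ℕ
      formula : L-Formula (Fin n ⊎ Fin arity)
      params  : Tuple arity

  ⟦_⟧ : ∀ {n} → ParamFormula n → Pred (Tuple n) ℓ
  ⟦ φ ⟨ b ⟩ ⟧ x = [ x , b ] ⊨ φ

  PartialType : ℕ → Set (suc ℓ)
  PartialType n = Pred (ParamFormula n) ℓ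

  Realises : ∀ {n} → Tuple n → PartialType n → Set ℓ
  Realises x π = ∀ ψ → π ψ → x ∈ ⟦ ψ ⟧

  -- Consistent with the elementary diagram of G.
  Consistent : ∀ {n} → PartialType n → Set ℓ
  Consistent π = ∀ ψs → All π ψs → ∃[ x ] All (λ ψ → x ∈ ⟦ ψ ⟧) ψs

  -- |L|⁺-saturation, where |L| ≥ ℵ₀ is the number of formulas.
  Saturated : Set (suc ℓ)
  Saturated = (c : ℕ ⊎ (Fun ⊎ Rel) → Carrier) →
    ∀ {n} (π : PartialType n) →
    (∀ ψ → π ψ → ∀ j → ∃[ i ] ParamFormula.params ψ j ≡ c i) →
    Consistent π → ∃[ x ] Realises x π

  Infinite : Set ℓ
  Infinite = ¬ FinitelyMany setoid (λ _ → ⊤ {ℓ})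

  record AclᵉᵠSubgroup (m : ℕ) : Set (suc ℓ) where
    field
      subset      : Pred (Tuple m) ℓ
      isSubgroup  : Subgroups.IsSubgroup (power m) subset
      isDefinable : IsAclᵉᵠ∅Definable subset
  open AclᵉᵠSubgroup public using (subset)

  OneBased : Set (suc ℓ)
  OneBased = ∀ m (ψ : ParamFormula m) →
    Σ[ B ∈ BooleanCombination (Tuple m × AclᵉᵠSubgroup m) ]
      (∀ x → (x ∈ ⟦ ψ ⟧) ⇔
             (x ∈ ⟦ B ⟧ᴮ λ { (g , H) → Subgroups.leftCoset (power m) g (subset H) }))

  ⋂ : ∀ {m n} → (Fin n → AclᵉᵠSubgroup m) → Pred (Tuple m) ℓ
  ⋂ H x = ∀ i → x ∈ subset (H i)

  IsCommensurabilityBreadth : ℕ → ℕ → Set (suc ℓ)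
  IsCommensurabilityBreadth m =
    Breadth.IsBreadth (⋂ {m}) (Subgroups.Commensurable (power m))

  -- Rows are indexed families, so k-inconsistency concerns k formulas with
  -- distinct indices.
  record InpPattern {n} (π : PartialType n) (κ : Set) : Set ℓ where
    field
      arity   : κ → ℕ
      φ       : (α : κ) → L-Formula (Fin n ⊎ Fin (arity α))
      k       : κ → ℕ
      array   : (α : κ) → ℕ → Tuple (arity α)
      rows    : ∀ α (s : Fin (k α) → ℕ) → Injective _≡_ _≡_ s →
                ¬ (∃[ x ] ∀ j → x ∈ ⟦ φ α ⟨ array α (s j) ⟩ ⟧)
      paths   : (η : κ → ℕ) →
                Consistent λ ψ → π ψ ⊎ (∃[ α ] ψ ≡ φ α ⟨ array α (η α) ⟩)

  DpAtMost : ∀ {n} → PartialType n → Set → Set (suc 0ℓ ⊔ ℓ)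
  DpAtMost π μ = ∀ κ → InpPattern π κ → κ ↣ μ

  -- The cardinal of μ is the supremum of the depths of inp-patterns.
  IsDpRank : ∀ {n} → PartialType n → Set → Set (suc 0ℓ ⊔ ℓ)
  IsDpRank π μ = DpAtMost π μ × (∀ ν → DpAtMost π ν → μ ↣ ν)

  DpInfinite : ∀ {n} → PartialType n → Set (suc 0ℓ ⊔ ℓ)
  DpInfinite π = ∀ d → ¬ IsDpRank π (Fin d)

  -- For an m-tuple x, the formula x = x is the conjunction of these.
  x=x : ∀ m → PartialType m
  x=x m ψ = ∃[ i ] ψ ≡ _⟨_⟩ {arity = 0} (var (inj₁ i) ≐ var (inj₁ i)) (λ ())

  𝒮 : ∀ {p n} → L-Formula (Fin p ⊎ Fin n) → Tuple n → Pred (Tuple p) ℓ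
  𝒮 φ b x = [ x , b ] ⊨ φ

  -- n counts the parameter variables; the object variables are arbitrary.
  IsVCT : ℕ → ℝ∞ → Set (suc 0ℓ ⊔ ℓ)
  IsVCT n = IsSup λ v → ∃[ p ] Σ[ φ ∈ L-Formula (Fin p ⊎ Fin n) ]
    VC.IsVCDensity (Group.setoid (power p)) (𝒮 φ) v

{-# OPTIONS --safe #-}

-- Call subgroups H₁ , … , H_d independent if ⋂_{j ≠ i} H_j ∩ H_i has
-- infinite index in ⋂_{j ≠ i} H_j for every i. The breadth is the largest
-- size of an independent family, and it is compared with both ranks.
--
-- Upper bounds. By compactness the fibres of a formula are, uniformly,
-- determined by one coset of each of finitely many subgroups L_j. The
-- cosets in which a point lies are known, up to boundedly many
-- possibilities, from at most d of them, d being the breadth, so n fibres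
-- cut G^m into O(n^d) pieces. This bounds the vc-density by d. A pattern
-- of depth e with n entries per row has n^e paths of which boundedly many
-- are realised in one piece, so that e ≤ d.
--
-- Lower bounds. All conjugates of H_i are determined by cosets of the same
-- finitely many subgroups, so by Neumann's lemma they fall into finitely
-- many commensurability classes. Hence ⋂_{j ≠ i} H_j meets infinitely many
-- double cosets H_i g H_i, say those of g_{i,0} , g_{i,1} , …. The product
-- g_{1,η(1)} ⋯ g_{d,η(d)} lies in H_i g_{i,η(i)} H_i for all i. So these
-- double cosets are the rows of a pattern of depth d, and their unions
-- have vc-density at least d. Double cosets take the place of cosets here
-- because the groups need not be commutative.

module Submission where

open import Defs
open import Algebra.Bundles using (Group)
import Algebra.Properties.Group as GroupProperties
open import Axiom.ExcludedMiddle using (ExcludedMiddle)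
open import Data.Bool.Base using (Bool; true; false)
open import Data.Empty using (⊥; ⊥-elim)
import Data.Empty.Polymorphic as Polymorphic
open import Data.Fin.Base as Fin using (Fin; zero; suc; combine; funToFin; finToFun)
import Data.Fin.Properties as Fin
open import Data.Fin.Subset using (Subset) renaming (_∈_ to _∈ₛ_)
open import Data.Fin.Subset.Properties using (⊆-antisym)
open import Data.Integer.Base as ℤ using (+_; -[1+_])
import Data.Integer.Properties as ℤ
open import Data.List.Base
  using (List; []; _∷_; _++_; length; map; concatMap; tabulate; lookup; filter; allFin)
open import Data.List.Membership.Propositional using () renaming (_∈_ to _∈ₗ_)
open import Data.List.Membership.Propositional.Properties
  using (∈-lookup; ∈-filter⁺; ∈-filter⁻; ∈-map⁺; ∈-map⁻; ∈-++⁺ˡ; ∈-++⁺ʳ; ∈-allFin; ∈-tabulate⁺)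
open import Data.List.Properties using (length-tabulate)
open import Data.List.Relation.Unary.All as All using (All; []; _∷_)
import Data.List.Relation.Unary.All.Properties as All
open import Data.List.Relation.Unary.AllPairs using ([]; _∷_)
open import Data.List.Relation.Unary.Any as Any using (Any; here; there)
import Data.List.Relation.Unary.Any.Properties as Any
open import Data.List.Relation.Unary.Unique.Propositional using (Unique)
import Data.List.Relation.Unary.Unique.Propositional.Properties as Unique
open import Data.Maybe.Base using (Maybe; just; nothing; maybe)
open import Data.Nat.Base as ℕ using (ℕ; zero; suc; _≤_)
open import Data.Nat.Induction using (<-rec)
import Data.Nat.Properties as ℕ
open import Data.Product.Base using (Σ-syntax; ∃; ∃-syntax; _×_; _,_; proj₁; proj₂)
open import Data.Rational.Base as ℚ using (mkℚ; fromℚᵘ)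
import Data.Rational.Properties as ℚ
open import Data.Rational.Unnormalised.Base as ℚᵘ using (mkℚᵘ)
import Data.Rational.Unnormalised.Properties as ℚᵘ
open import Data.Sum.Base as Sum using (_⊎_; inj₁; inj₂; [_,_])
open import Data.Unit.Polymorphic.Base using (⊤; tt)
import Data.Vec.Base as Vec
import Data.Vec.Properties as Vec
open import Function.Base using (_∘_; id; const; case_of_)
open import Function.Bundles using (_⇔_; mk⇔; Equivalence; _↣_; mk↣; Injection)
open import Function.Definitions using (Injective)
open import Level using (Level; _⊔_)
open import Relation.Binary.Bundles using (Setoid)
open import Relation.Binary.Definitions using (tri<; tri≈; tri>)
open import Relation.Binary.PropositionalEquality as ≡ using (_≡_; _≢_; cong; subst)
open import Relation.Nullary.Decidable using (Dec; yes; no; does; dec-true; decidable-stable)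
open import Relation.Nullary.Negation using (¬_; contradiction)
open import Relation.Unary using (Pred; _∈_; _∩_; _⊆_)

open Equivalence using (to; from)

-- The obstacle to compactness is that the subgroups provided by one-basedness vary with the fibre
-- and are defined over algebraic imaginaries, while saturation speaks of formulas of G itself.
-- Imaginary parameters are therefore replaced by real representatives, and a subgroup by a formula
-- whose parameters range over all solutions of its algebraic formulas for which it still defines a
-- subgroup. Only finitely many subgroups arise in this way, so quantifying over these parameters
-- keeps the family finite, and being determined by one coset for each of finitely many such
-- formulas becomes first-order without parameters. Finite index is handled as a finite cover by
-- cosets, `≲`, and a cover is read as a labelling by some `Fin k`. All bounds thereby become
-- comparisons of the sizes of finite types.

private
  variable
    a b c ℓ p q r : Level

-- Cosets and subgroups of finite index

module Classical (em : ∀ {a} → ExcludedMiddle a) where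

  byContradiction : {P : Set a} → ¬ ¬ P → P
  byContradiction = decidable-stable em

  -- An excluded middle for all types makes the least witness, or any
  -- other, available as data, so it also provides choice.

  ¬∀⇒∃¬ : {A : Set a} {P : A → Set b} → ¬ (∀ x → P x) → ∃[ x ] ¬ P x
  ¬∀⇒∃¬ ¬∀ = byContradiction λ ¬∃ → ¬∀ λ x → byContradiction λ ¬P → ¬∃ (x , ¬P)

  orElse : {A : Set a} → Pred A b → A → A
  orElse P d with em {P = ∃ P}
  ... | yes (x , _) = x
  ... | no _        = d

  orElse-∈ : {A : Set a} {P : Pred A b} {d : A} → ∃ P → P (orElse P d)
  orElse-∈ {P = P} ∃P with em {P = ∃ P}
  ... | yes (_ , Px) = Px
  ... | no ∄P        = contradiction ∃P ∄P

  indicator : {A : Set a} → Pred A b → A → Fin 2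
  indicator P x with em {P = P x}
  ... | yes _ = suc zero
  ... | no  _ = zero

  indicator-∈ : {A : Set a} {P : Pred A b} {x : A} → P x → indicator P x ≡ suc zero
  indicator-∈ {P = P} {x} Px with em {P = P x}
  ... | yes _  = ≡.refl
  ... | no ¬Px = contradiction Px ¬Px

  indicator⁻¹ : {A : Set a} {P : Pred A b} {x : A} → indicator P x ≡ suc zero → P x
  indicator⁻¹ {P = P} {x} eq with em {P = P x}
  ... | yes Px = Px

  -- Excluded middle collapses every type to a truth value of any level.
  resize : ∀ b → Set a → Set b
  resize b P with em {P = P}
  ... | yes _ = ⊤
  ... | no  _ = Polymorphic.⊥

  resize⁺ : {P : Set a} → P → resize b P
  resize⁺ {P = P} x with em {P = P}
  ... | yes _  = _
  ... | no  ¬P = contradiction x ¬P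

  resize⁻ : {P : Set a} → resize b P → P
  resize⁻ {P = P} x with em {P = P}
  resize⁻ x  | yes p = p
  resize⁻ () | no _

bounded : ∀ {n} (f : Fin n → ℕ) → ∃[ b ] ∀ i → f i ℕ.≤ b
bounded {zero}  f = 0 , λ ()
bounded {suc n} f = let b , f≤b = bounded (f ∘ suc) in
  f zero ℕ.⊔ b , λ { zero → ℕ.m≤m⊔n _ _ ; (suc i) → ℕ.m≤n⇒m≤o⊔n _ (f≤b i) }

module Cosets (em : ∀ {a} → ExcludedMiddle a) (G : Group c ℓ) where
  open Classical em
  open Group G
  open GroupProperties G
  open Subgroups G
  open IsSubgroup
  open import Relation.Binary.Reasoning.Setoid setoid

  private
    variable
      H K P Q : Pred Carrier p

  [ab]⁻¹[ac]≈b⁻¹c : ∀ a b c → (a ∙ b) ⁻¹ ∙ (a ∙ c) ≈ b ⁻¹ ∙ c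
  [ab]⁻¹[ac]≈b⁻¹c a b c = begin
    (a ∙ b) ⁻¹ ∙ (a ∙ c)       ≈⟨ ∙-congʳ (⁻¹-anti-homo-∙ a b) ⟩
    (b ⁻¹ ∙ a ⁻¹) ∙ (a ∙ c)    ≈⟨ assoc (b ⁻¹) (a ⁻¹) (a ∙ c) ⟩
    b ⁻¹ ∙ (a ⁻¹ ∙ (a ∙ c))    ≈⟨ ∙-congˡ (\\-leftDividesʳ a c) ⟩
    b ⁻¹ ∙ c                   ∎

  a⁻¹b∙b⁻¹c≈a⁻¹c : ∀ a b c → (a ⁻¹ ∙ b) ∙ (b ⁻¹ ∙ c) ≈ a ⁻¹ ∙ c
  a⁻¹b∙b⁻¹c≈a⁻¹c a b c = begin
    (a ⁻¹ ∙ b) ∙ (b ⁻¹ ∙ c)    ≈⟨ assoc (a ⁻¹) b (b ⁻¹ ∙ c) ⟩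
    a ⁻¹ ∙ (b ∙ (b ⁻¹ ∙ c))    ≈⟨ ∙-congˡ (\\-leftDividesˡ b c) ⟩
    a ⁻¹ ∙ c                   ∎

  module _ {p : Level} {H : Pred Carrier p} (H≤G : IsSubgroup H) where

    coset-sym : ∀ {x y} → y ∈ leftCoset x H → x ∈ leftCoset y H
    coset-sym {x} {y} y∈xH =
      resp-≈ H≤G (⁻¹-anti-homo-\\ x y) (⁻¹-closed H≤G y∈xH)

    coset-trans : ∀ {x y z} → y ∈ leftCoset x H → z ∈ leftCoset y H → z ∈ leftCoset x H
    coset-trans {x} {y} {z} y∈xH z∈yH =
      resp-≈ H≤G (a⁻¹b∙b⁻¹c≈a⁻¹c x y z) (∙-closed H≤G y∈xH z∈yH)

    coset-join : ∀ {g x y} → x ∈ leftCoset g H → y ∈ leftCoset g H → y ∈ leftCoset x H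
    coset-join x∈gH y∈gH = coset-trans (coset-sym x∈gH) y∈gH

    coset-translate : ∀ {x y} t → y ∈ leftCoset x H → t ∙ y ∈ leftCoset (t ∙ x) H
    coset-translate {x} {y} t = resp-≈ H≤G (sym ([ab]⁻¹[ac]≈b⁻¹c t x y))

    coset-resp : ∀ {g x y} → x ≈ y → x ∈ leftCoset g H → y ∈ leftCoset g H
    coset-resp x≈y = resp-≈ H≤G (∙-congˡ x≈y)

    coset-∙ : ∀ {x h} → h ∈ H → x ∙ h ∈ leftCoset x H
    coset-∙ {x} {h} = resp-≈ H≤G (sym (\\-leftDividesʳ x h))

    ∈-coset-ε : ∀ {x} → x ∈ H → x ∈ leftCoset ε H
    ∈-coset-ε {x} = resp-≈ H≤G (sym (trans (∙-congʳ ε⁻¹≈ε) (identityˡ x)))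

  -- P is covered by finitely many left cosets of H. For subgroups this
  -- says that P ∩ H has finite index in P, and it is a preorder.
  infix 4 _≲_
  record _≲_ (P : Pred Carrier p) (H : Pred Carrier q) : Set (c ⊔ p ⊔ q) where
    constructor _,_
    field
      reps  : List Carrier
      cover : ∀ {x} → x ∈ P → Any (λ g → x ∈ leftCoset g H) reps

  ⊆⇒≲ : IsSubgroup H → P ⊆ H → P ≲ H
  ⊆⇒≲ H≤G P⊆H = ε ∷ [] , λ x∈P → here (∈-coset-ε H≤G (P⊆H x∈P))

  ≲-respˡ : P ⊆ Q → Q ≲ H → P ≲ H
  ≲-respˡ P⊆Q (gs , cover) = gs , λ x∈P → cover (P⊆Q x∈P)

  ≲-trans : IsSubgroup K → P ≲ H → H ≲ K → P ≲ K
  ≲-trans {K = K} K≤G (gs , P⊆) (hs , H⊆) =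
    concatMap (λ g → map (g ∙_) hs) gs ,
    λ x∈P → Any.concatMap⁺ _ (Any.map
      (λ {g} x∈gH → Any.map⁺ (Any.map
        (λ {h} → translate g h) (H⊆ x∈gH))) (P⊆ x∈P))
    where
    translate : ∀ g h {x} → g ⁻¹ ∙ x ∈ leftCoset h K → x ∈ leftCoset (g ∙ h) K
    translate g h {x} e =
      coset-resp K≤G (\\-leftDividesˡ g x) (coset-translate K≤G g e)

  -- The label is the position of the covering coset that the membership proof yields, so it may
  -- depend on that proof.
  label : P ≲ H → ∃[ k ] Σ[ f ∈ (∀ x → x ∈ P → Fin k) ]
          (IsSubgroup H → ∀ {x y} x∈P y∈P → f x x∈P ≡ f y y∈P → y ∈ leftCoset x H)
  label {H = H} (gs , cover) = length gs , (λ x x∈P → Any.index (cover x∈P)) ,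
    λ H≤G x∈P y∈P eq → coset-join H≤G (Any.lookup-index (cover x∈P))
      (subst (λ i → _ ∈ leftCoset (lookup gs i) H) (≡.sym eq) (Any.lookup-index (cover y∈P)))

  -- The cosets of a cover may have representatives outside P, whereas `HasFiniteIndexIn` wants them
  -- inside. One element of P is chosen for each label that occurs, and ε for the others.
  index-labels : (H : Pred Carrier q) → ε ∈ P → ∀ {k} (f : ∀ x → x ∈ P → Fin k) →
    (∀ {x y} x∈P y∈P → f x x∈P ≡ f y y∈P → y ∈ leftCoset x H) →
    ∃[ gs ] All P gs × (∀ x → x ∈ P → Any (λ g → x ∈ leftCoset g H) gs)
  index-labels {P = P} H ε∈P {k} f same =
    tabulate rep , All.tabulate⁺ rep-∈ ,
    λ x x∈P → Any.tabulate⁺ (f x x∈P) (rep-same x∈P)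
    where
    Labelled : Fin k → Pred Carrier _
    Labelled i x = Σ[ x∈P ∈ x ∈ P ] f x x∈P ≡ i
    rep : Fin k → Carrier
    rep i = orElse (Labelled i) ε
    rep-∈ : ∀ i → rep i ∈ P
    rep-∈ i with em {P = ∃ (Labelled i)}
    ... | yes (_ , x∈P , _) = x∈P
    ... | no _              = ε∈P
    rep-same : ∀ {x} (x∈P : x ∈ P) → x ∈ leftCoset (rep (f x x∈P)) H
    rep-same {x} x∈P = let r∈P , eq = orElse-∈ {P = Labelled (f x x∈P)} {ε} (x , x∈P , ≡.refl)
                       in same r∈P x∈P eq

  labels⇒≲ : (H : Pred Carrier q) → ε ∈ P → ∀ {k} (f : ∀ x → x ∈ P → Fin k) →
    (∀ {x y} x∈P y∈P → f x x∈P ≡ f y y∈P → y ∈ leftCoset x H) → P ≲ H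
  labels⇒≲ H ε∈P f same = let gs , _ , cover = index-labels H ε∈P f same in gs , cover _

  index⇒≲ : {H P : Pred Carrier p} → HasFiniteIndexIn H P → P ≲ H
  index⇒≲ (gs , _ , cover) = gs , cover _

  ≲⇒index : {H P : Pred Carrier p} → IsSubgroup H → ε ∈ P → P ≲ H → HasFiniteIndexIn H P
  ≲⇒index {H = H} {P = P} H≤G ε∈P P≲H with k , f , same ← label P≲H =
    index-labels H ε∈P f (same H≤G)

  ∩-isSubgroup : IsSubgroup H → IsSubgroup K → IsSubgroup (H ∩ K)
  ∩-isSubgroup H≤G K≤G = record
    { resp-≈    = λ { eq (h , k) → resp-≈ H≤G eq h , resp-≈ K≤G eq k }
    ; ε-closed  = ε-closed H≤G , ε-closed K≤G
    ; ∙-closed  = λ { (h , k) (h′ , k′) → ∙-closed H≤G h h′ , ∙-closed K≤G k k′ }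
    ; ⁻¹-closed = λ { (h , k) → ⁻¹-closed H≤G h , ⁻¹-closed K≤G k }
    }

  ⋂-isSubgroup : {I : Set a} {Hs : I → Pred Carrier p} →
                 (∀ i → IsSubgroup (Hs i)) → IsSubgroup (λ x → ∀ i → x ∈ Hs i)
  ⋂-isSubgroup Hs≤G = record
    { resp-≈    = λ eq x∈ i → resp-≈ (Hs≤G i) eq (x∈ i)
    ; ε-closed  = λ i → ε-closed (Hs≤G i)
    ; ∙-closed  = λ x∈ y∈ i → ∙-closed (Hs≤G i) (x∈ i) (y∈ i)
    ; ⁻¹-closed = λ x∈ i → ⁻¹-closed (Hs≤G i) (x∈ i)
    }

  ≲-∩ : {P H K : Pred Carrier p} → ε ∈ P → IsSubgroup H → IsSubgroup K →
        P ≲ H → P ≲ K → P ≲ H ∩ K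
  ≲-∩ {P = P} {H} {K} ε∈P H≤G K≤G P≲H P≲K
    with k , f , f-same ← label P≲H | l , g , g-same ← label P≲K =
    labels⇒≲ (H ∩ K) ε∈P (λ x x∈P → combine (f x x∈P) (g x x∈P)) λ {x} {y} x∈P y∈P eq →
      let eqf , eqg = Fin.combine-injective (f x x∈P) _ (f y y∈P) _ eq in
      f-same H≤G x∈P y∈P eqf , g-same K≤G x∈P y∈P eqg

  ≲-⋂ : {P : Pred Carrier p} → ε ∈ P → ∀ {n} {Hs : Fin n → Pred Carrier p} → (∀ i → IsSubgroup (Hs i)) →
        (∀ i → P ≲ Hs i) → P ≲ (λ x → ∀ i → x ∈ Hs i)
  ≲-⋂ ε∈P {zero} _ _ = ε ∷ [] , λ _ → here λ ()
  ≲-⋂ {P = P} ε∈P {suc n} {Hs} Hs≤G P≲ =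
    let gs , cover = ≲-∩ {H = Hs zero} {K = λ x → ∀ i → x ∈ Hs (suc i)} ε∈P
                       (Hs≤G zero) (⋂-isSubgroup (Hs≤G ∘ suc)) (P≲ zero) (≲-⋂ ε∈P (Hs≤G ∘ suc) (P≲ ∘ suc))
    in gs , λ x∈P → Any.map (λ { (h , k) zero → h ; (h , k) (suc i) → k i }) (cover x∈P)

  ≲-⋃ : ∀ {n} {Ps : Fin n → Pred Carrier p} → (∀ i → Ps i ≲ H) → (λ x → ∃[ i ] x ∈ Ps i) ≲ H
  ≲-⋃ {n = zero}  Ps≲ = [] , λ ()
  ≲-⋃ {n = suc n} Ps≲ with gs , cover ← Ps≲ zero | hs , cover′ ← ≲-⋃ (Ps≲ ∘ suc) =
    gs ++ hs , λ { (zero , x∈) → Any.++⁺ˡ (cover x∈)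
                 ; (suc i , x∈) → Any.++⁺ʳ gs (cover′ (i , x∈)) }

  ≲-translate : IsSubgroup H → ∀ t → P ≲ H → leftCoset t P ≲ H
  ≲-translate H≤G t (gs , cover) = map (t ∙_) gs ,
    λ {x} x∈tP → Any.map⁺ (Any.map (λ e → coset-resp H≤G (\\-leftDividesˡ t x)
      (coset-translate H≤G t e)) (cover x∈tP))

  -- B. H. Neumann: in a finite cover of a group by cosets, those of
  -- infinite index are redundant. Some coset g P₀ occurs in no member of
  -- the cover, so it is covered by cosets of the other subgroups, and so
  -- are all its translates.
  neumann : IsSubgroup Q → ∀ {r} (S : Fin r → Set a) {Ps : Fin r → Pred Carrier p} →
    (∀ j → IsSubgroup (Ps j)) → (gs : Fin r → List Carrier) →
    (∀ {x} → x ∈ Q → ∃[ j ] S j × Any (λ g → x ∈ leftCoset g (Ps j)) (gs j)) →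
    ∃[ j ] S j × Q ≲ Ps j
  neumann Q≤G {zero} _ _ gs cover with () , _ ← cover (ε-closed Q≤G)
  neumann {Q = Q} Q≤G {suc r} S {Ps} Ps≤G gs cover
    with em {P = S zero × Q ≲ Ps zero} | em {P = S zero}
  ... | yes (s , Q≲P₀) | _ = zero , s , Q≲P₀
  ... | no  _ | no ¬s =
    let j , Q≲ = neumann Q≤G (S ∘ suc) (Ps≤G ∘ suc) (gs ∘ suc) λ x∈Q → case₀ (cover x∈Q)
    in suc j , Q≲
    where
    case₀ : ∀ {x} → ∃[ j ] S j × Any (λ g → x ∈ leftCoset g (Ps j)) (gs j) →
            ∃[ j ] S (suc j) × Any (λ g → x ∈ leftCoset g (Ps (suc j))) (gs (suc j))
    case₀ (zero  , s , _) = contradiction s ¬s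
    case₀ (suc j , h)     = j , h
  ... | no  ¬sQ≲P₀ | yes s
    with g , g∉ ← ¬∀⇒∃¬ {P = λ x → x ∈ Q → Any (λ g → x ∈ leftCoset g (Ps zero)) (gs zero)}
                  (λ all → ¬sQ≲P₀ (s , gs zero , all _))
    = let j , Q≲ = neumann Q≤G (S ∘ suc) (Ps≤G ∘ suc) gs′ cover′ in suc j , Q≲
    where
    g∈Q : g ∈ Q
    g∈Q = byContradiction λ g∉Q → g∉ λ g∈ → contradiction g∈ g∉Q
    g∉F : ¬ Any (λ b → g ∈ leftCoset b (Ps zero)) (gs zero)
    g∉F g∈F = g∉ λ _ → g∈F
    -- The cover is available inside Q only, so g P₀ has to be moved onto b P₀ by an element of Q.
    -- `meet b ∙ g ⁻¹` is one as soon as b P₀ meets Q; otherwise there is nothing to cover and ε is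
    -- a filler.
    meet : Carrier → Carrier
    meet b = orElse (λ x → x ∈ Q × x ∈ leftCoset b (Ps zero)) ε
    gs′ : Fin r → List Carrier
    gs′ j = gs (suc j) ++ concatMap (λ b → map (meet b ∙ g ⁻¹ ∙_) (gs (suc j))) (gs zero)
    move : ∀ b {x} → x ∈ Q → x ∈ leftCoset b (Ps zero) →
           ∃[ j ] S (suc j) × Any (λ u → x ∈ leftCoset (meet b ∙ g ⁻¹ ∙ u) (Ps (suc j))) (gs (suc j))
    move b {x} x∈Q x∈b
      with b′∈Q , b′∈b ← orElse-∈ {P = λ x → x ∈ Q × x ∈ leftCoset b (Ps zero)} {ε} (x , x∈Q , x∈b)
      -- This point of Q lies in g P₀, which is disjoint from the cosets of P₀ in the cover, so a
      -- coset of another subgroup contains it.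
      with cover (∙-closed Q≤G g∈Q (∙-closed Q≤G (⁻¹-closed Q≤G b′∈Q) x∈Q))
    ... | zero  , _ , y∈F = ⊥-elim (g∉F (Any.map
            (λ y∈h → coset-trans (Ps≤G zero) y∈h (coset-sym (Ps≤G zero) y∈g)) y∈F))
      where
      y∈g : g ∙ (meet b ⁻¹ ∙ x) ∈ leftCoset g (Ps zero)
      y∈g = coset-∙ (Ps≤G zero) (coset-join (Ps≤G zero) b′∈b x∈b)
    ... | suc j , t , y∈F = j , t , Any.map (λ {u} y∈u → coset-resp (Ps≤G (suc j)) back
            (coset-translate (Ps≤G (suc j)) (meet b ∙ g ⁻¹) y∈u)) y∈F
      where
      back : (meet b ∙ g ⁻¹) ∙ (g ∙ (meet b ⁻¹ ∙ x)) ≈ x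
      back = begin
        (meet b ∙ g ⁻¹) ∙ (g ∙ (meet b ⁻¹ ∙ x)) ≈⟨ assoc _ _ _ ⟩
        meet b ∙ (g ⁻¹ ∙ (g ∙ (meet b ⁻¹ ∙ x))) ≈⟨ ∙-congˡ (\\-leftDividesʳ g _) ⟩
        meet b ∙ (meet b ⁻¹ ∙ x)                ≈⟨ \\-leftDividesˡ (meet b) x ⟩
        x                                       ∎
    cover′ : ∀ {x} → x ∈ Q →
             ∃[ j ] S (suc j) × Any (λ g → x ∈ leftCoset g (Ps (suc j))) (gs′ j)
    cover′ {x} x∈Q with cover x∈Q
    ... | suc j , t , x∈ = j , t , Any.++⁺ˡ x∈
    ... | zero  , _ , x∈ =
      let j , t , k = go x∈ in j , t , Any.++⁺ʳ (gs (suc j)) (Any.concatMap⁺ _ k)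
      where
      go : ∀ {bs} → Any (λ b → x ∈ leftCoset b (Ps zero)) bs →
           ∃[ j ] S (suc j) × Any (λ b → Any (λ u → x ∈ leftCoset u (Ps (suc j)))
                                  (map (meet b ∙ g ⁻¹ ∙_) (gs (suc j)))) bs
      go (here {b} x∈b) = let j , t , k = move b x∈Q x∈b in j , t , here (Any.map⁺ k)
      go (there x∈bs)   = let j , t , k = go x∈bs in j , t , there k

  -- Sets determined by finitely many cosets

  Agree : ∀ {r} → (Fin r → Pred Carrier p) → (Fin r → Carrier) → Carrier → Carrier → Set _
  Agree Ls c x y = ∀ j → (x ∈ leftCoset (c j) (Ls j)) ⇔ (y ∈ leftCoset (c j) (Ls j))

  DeterminedBy : ∀ {r} → (Fin r → Pred Carrier p) → (Fin r → Carrier) → Pred Carrier q → Set _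
  DeterminedBy Ls c P = ∀ {x y} → Agree Ls c x y → x ∈ P → y ∈ P

  -- Subfamilies are coded by numbers below 2 ^ r, the digit `suc zero` meaning membership, so that
  -- they can serve as labels.
  ⋂[_] : ∀ {r} → Fin (2 ℕ.^ r) → (Fin r → Pred Carrier p) → Pred Carrier p
  ⋂[ σ ] Ls x = ∀ j → finToFun σ j ≡ suc zero → x ∈ Ls j

  ⋂[]-isSubgroup : ∀ {r} (σ : Fin (2 ℕ.^ r)) {Ls : Fin r → Pred Carrier p} →
                   (∀ j → IsSubgroup (Ls j)) → IsSubgroup (⋂[ σ ] Ls)
  ⋂[]-isSubgroup σ Ls≤G = ⋂-isSubgroup λ j → ⋂-isSubgroup λ _ → Ls≤G j

  -- The subfamily consists of the L j in which Q has finite index; by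
  -- Neumann's lemma the cosets of the others can be avoided.
  determined-subgroup : {Q : Pred Carrier p} → IsSubgroup Q →
    ∀ {r} {Ls : Fin r → Pred Carrier p} → (∀ j → IsSubgroup (Ls j)) → ∀ c → DeterminedBy Ls c Q →
    ∃[ σ ] Q ≲ ⋂[ σ ] Ls × ⋂[ σ ] Ls ≲ Q
  determined-subgroup {p = p} {Q = Q} Q≤G {r} {Ls} Ls≤G c det =
    σ , Q≲⋂ , byContradiction ⋂≲Q
    where
    σ : Fin (2 ℕ.^ r)
    σ = funToFin (indicator λ j → Q ≲ Ls j)

    ∈σ⇒ : ∀ {j} → finToFun σ j ≡ suc zero → Q ≲ Ls j
    ∈σ⇒ {j} eq = indicator⁻¹ {P = λ j → Q ≲ Ls j}
      (≡.trans (≡.sym (Fin.finToFun-funToFin (indicator λ j → Q ≲ Ls j) j)) eq)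

    ⇒∈σ : ∀ {j} → Q ≲ Ls j → finToFun σ j ≡ suc zero
    ⇒∈σ {j} Q≲ = ≡.trans (Fin.finToFun-funToFin (indicator λ j → Q ≲ Ls j) j)
      (indicator-∈ {P = λ j → Q ≲ Ls j} Q≲)

    Lσ = ⋂[ σ ] Ls

    Q≲⋂ : Q ≲ Lσ
    Q≲⋂ = ≲-⋂ (ε-closed Q≤G) (λ j → ⋂-isSubgroup λ _ → Ls≤G j) λ j → within j
      where
      within : ∀ j → Q ≲ (λ x → finToFun σ j ≡ suc zero → x ∈ Ls j)
      within j with em {P = finToFun σ j ≡ suc zero}
      ... | yes j∈σ with gs , cover ← ∈σ⇒ j∈σ = gs , λ x∈Q → Any.map (λ h _ → h) (cover x∈Q)
      ... | no  j∉σ = ε ∷ [] , λ _ → here λ j∈σ → contradiction j∈σ j∉σ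

    j∉σ⇒ : ∀ {j} → finToFun σ j ≢ suc zero → ¬ (Lσ ≲ Ls j)
    j∉σ⇒ {j} j∉σ Lσ≲ = j∉σ (⇒∈σ (≲-trans (Ls≤G j) Q≲⋂ Lσ≲))

    Avoids : Carrier → Set _
    Avoids x = ∀ j → x ∈ leftCoset (c j) (Ls j) → finToFun σ j ≡ suc zero

    ¬Avoids⇒ : ∀ {x} → ¬ Avoids x → ∃[ j ] finToFun σ j ≢ suc zero × x ∈ leftCoset (c j) (Ls j)
    ¬Avoids⇒ {x} ¬av = let j , ¬im = ¬∀⇒∃¬ ¬av in
      j , (λ j∈σ → ¬im λ _ → j∈σ) ,
      byContradiction λ x∉ → ¬im λ x∈ → contradiction x∈ x∉

    avoid : ∃[ x ] x ∈ Q × Avoids x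
    avoid = byContradiction λ none →
      -- If no point of Q avoids them, the cosets of the L j with j outside σ cover Q, and then Q ≲
      -- L j for one such j, which puts j into σ. The predicate on indices selects these j without
      -- reindexing.
      let j , j∉σ , Q≲ = neumann Q≤G (λ j → finToFun σ j ≢ suc zero) Ls≤G (λ j → c j ∷ [])
            λ {x} x∈Q → let j , j∉σ , x∈ = ¬Avoids⇒ λ av → none (x , x∈Q , av)
                        in j , j∉σ , here x∈
      in j∉σ (⇒∈σ Q≲)

    ⋂≲Q : ¬ ¬ (Lσ ≲ Q)
    ⋂≲Q Lσ≴Q with q , q∈Q , q-avoids ← avoid =
      let i , i∈S , Lσ≲ = neumann (⋂[]-isSubgroup σ Ls≤G) S Ps≤G gs cover in impossible i i∈S Lσ≲
      where
      -- Q joins the L j as one more subgroup. It contains every x in the intersection for which q x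
      -- avoids the cosets outside σ, as q and q x then agree on all cosets; any other x lies in
      -- some q⁻¹ c j L j with j outside σ.
      S : Fin (suc r) → Set
      S zero    = ⊤
      S (suc j) = finToFun σ j ≢ suc zero
      Ps : Fin (suc r) → Pred Carrier p
      Ps zero    = Q
      Ps (suc j) = Ls j
      Ps≤G : ∀ i → IsSubgroup (Ps i)
      Ps≤G zero    = Q≤G
      Ps≤G (suc j) = Ls≤G j
      gs : Fin (suc r) → List Carrier
      gs zero    = ε ∷ []
      gs (suc j) = q ⁻¹ ∙ c j ∷ []
      impossible : ∀ i → S i → ¬ (Lσ ≲ Ps i)
      impossible zero    _   = Lσ≴Q
      impossible (suc j) j∉σ = j∉σ⇒ j∉σ
      agree : ∀ {x} → x ∈ Lσ → Avoids (q ∙ x) → Agree Ls c q (q ∙ x)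
      agree {x} x∈ qx-avoids j = mk⇔
        (λ q∈c → coset-trans (Ls≤G j) q∈c (coset-∙ (Ls≤G j) (x∈ j (q-avoids j q∈c))))
        (λ qx∈c → coset-trans (Ls≤G j) qx∈c
          (coset-sym (Ls≤G j) (coset-∙ (Ls≤G j) (x∈ j (qx-avoids j qx∈c)))))
      cover : ∀ {x} → x ∈ Lσ → ∃[ i ] S i × Any (λ g → x ∈ leftCoset g (Ps i)) (gs i)
      cover {x} x∈ with em {P = Avoids (q ∙ x)}
      ... | yes qx-avoids = zero , tt , here (∈-coset-ε Q≤G (resp-≈ Q≤G (\\-leftDividesʳ q x)
              (∙-closed Q≤G (⁻¹-closed Q≤G q∈Q) (det (agree x∈ qx-avoids) q∈Q))))
      ... | no ¬qx-avoids = let j , j∉σ , qx∈c = ¬Avoids⇒ ¬qx-avoids in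
              suc j , j∉σ , here (coset-resp (Ls≤G j) (\\-leftDividesʳ q x)
                (coset-translate (Ls≤G j) (q ⁻¹) qx∈c))

  -- Products, double cosets and conjugates

  ∏ : ∀ {n} → (Fin n → Carrier) → Carrier
  ∏ {zero}  g = ε
  ∏ {suc n} g = g zero ∙ ∏ (g ∘ suc)

  ∏-closed : IsSubgroup H → ∀ {n} {g : Fin n → Carrier} → (∀ i → g i ∈ H) → ∏ g ∈ H
  ∏-closed H≤G {zero}  g∈H = ε-closed H≤G
  ∏-closed H≤G {suc n} g∈H = ∙-closed H≤G (g∈H zero) (∏-closed H≤G (g∈H ∘ suc))

  doubleCoset : Pred Carrier p → Carrier → Pred Carrier _
  doubleCoset H g x = ∃[ h ] ∃[ h′ ] h ∈ H × h′ ∈ H × x ≈ h ∙ (g ∙ h′)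

  doubleCoset-refl : IsSubgroup H → ∀ {x} → x ∈ doubleCoset H x
  doubleCoset-refl H≤G {x} = ε , ε , ε-closed H≤G , ε-closed H≤G ,
    sym (trans (identityˡ _) (identityʳ x))

  doubleCoset-join : IsSubgroup H → ∀ {a b x} →
    x ∈ doubleCoset H a → x ∈ doubleCoset H b → b ∈ doubleCoset H a
  doubleCoset-join H≤G {a} {b} {x} (h , h′ , h∈ , h′∈ , x≈) (k , k′ , k∈ , k′∈ , x≈′) =
    k ⁻¹ ∙ h , h′ ∙ k′ ⁻¹ ,
    ∙-closed H≤G (⁻¹-closed H≤G k∈) h∈ , ∙-closed H≤G h′∈ (⁻¹-closed H≤G k′∈) , (begin
      b                                     ≈⟨ //-rightDividesʳ k′ b ⟨
      (b ∙ k′) ∙ k′ ⁻¹                      ≈⟨ ∙-congʳ (\\-leftDividesʳ k (b ∙ k′)) ⟨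
      (k ⁻¹ ∙ (k ∙ (b ∙ k′))) ∙ k′ ⁻¹       ≈⟨ ∙-congʳ (∙-congˡ (trans (sym x≈′) x≈)) ⟩
      (k ⁻¹ ∙ (h ∙ (a ∙ h′))) ∙ k′ ⁻¹       ≈⟨ ∙-congʳ (assoc _ _ _) ⟨
      ((k ⁻¹ ∙ h) ∙ (a ∙ h′)) ∙ k′ ⁻¹       ≈⟨ assoc _ _ _ ⟩
      (k ⁻¹ ∙ h) ∙ ((a ∙ h′) ∙ k′ ⁻¹)       ≈⟨ ∙-congˡ (assoc _ _ _) ⟩
      (k ⁻¹ ∙ h) ∙ (a ∙ (h′ ∙ k′ ⁻¹))       ∎)

  doubleCoset-sym : IsSubgroup H → ∀ {a x} → x ∈ doubleCoset H a → a ∈ doubleCoset H x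
  doubleCoset-sym H≤G = doubleCoset-join H≤G (doubleCoset-refl H≤G)

  doubleCoset-same : IsSubgroup H → ∀ {a x y} →
    x ∈ doubleCoset H a → y ∈ doubleCoset H a → y ∈ doubleCoset H x
  doubleCoset-same H≤G x∈a y∈a =
    doubleCoset-join H≤G (doubleCoset-sym H≤G x∈a) (doubleCoset-sym H≤G y∈a)

  -- The factors to the left of the i-th multiply to h, those to its right to h′.
  ∏-∈-doubleCoset : IsSubgroup H → ∀ {n} {g : Fin n → Carrier} i →
    (∀ j → j ≢ i → g j ∈ H) → ∏ g ∈ doubleCoset H (g i)
  ∏-∈-doubleCoset H≤G {g = g} zero g∈H =
    ε , ∏ (g ∘ suc) , ε-closed H≤G , ∏-closed H≤G (λ j → g∈H (suc j) λ ()) , sym (identityˡ _)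
  ∏-∈-doubleCoset H≤G {g = g} (suc i) g∈H =
    let h , h′ , h∈ , h′∈ , eq = ∏-∈-doubleCoset H≤G {g = g ∘ suc} i
          λ j j≢i → g∈H (suc j) (j≢i ∘ Fin.suc-injective)
    in g zero ∙ h , h′ , ∙-closed H≤G (g∈H zero λ ()) h∈ , h′∈ ,
       trans (∙-congˡ eq) (sym (assoc _ _ _))

  -- This is g H g⁻¹.
  conjugate : Carrier → Pred Carrier p → Pred Carrier p
  conjugate g H x = g ⁻¹ ∙ (x ∙ g) ∈ H

  conjugate-isSubgroup : ∀ g → IsSubgroup H → IsSubgroup (conjugate g H)
  conjugate-isSubgroup g H≤G = record
    { resp-≈    = λ x≈y → resp-≈ H≤G (∙-congˡ (∙-congʳ x≈y))
    ; ε-closed  = resp-≈ H≤G (sym (trans (∙-congˡ (identityˡ g)) (inverseˡ g))) (ε-closed H≤G)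
    ; ∙-closed  = λ {x} {y} x∈ y∈ → resp-≈ H≤G (begin
        (g ⁻¹ ∙ (x ∙ g)) ∙ (g ⁻¹ ∙ (y ∙ g))  ≈⟨ assoc _ _ _ ⟩
        g ⁻¹ ∙ ((x ∙ g) ∙ (g ⁻¹ ∙ (y ∙ g)))  ≈⟨ ∙-congˡ (assoc _ _ _) ⟩
        g ⁻¹ ∙ (x ∙ (g ∙ (g ⁻¹ ∙ (y ∙ g))))  ≈⟨ ∙-congˡ (∙-congˡ (\\-leftDividesˡ g _)) ⟩
        g ⁻¹ ∙ (x ∙ (y ∙ g))                 ≈⟨ ∙-congˡ (assoc _ _ _) ⟨
        g ⁻¹ ∙ ((x ∙ y) ∙ g)                 ∎) (∙-closed H≤G x∈ y∈)
    ; ⁻¹-closed = λ {x} x∈ → resp-≈ H≤G (begin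
        (g ⁻¹ ∙ (x ∙ g)) ⁻¹                  ≈⟨ ⁻¹-anti-homo-\\ g (x ∙ g) ⟩
        (x ∙ g) ⁻¹ ∙ g                       ≈⟨ ∙-congʳ (⁻¹-anti-homo-∙ x g) ⟩
        (g ⁻¹ ∙ x ⁻¹) ∙ g                    ≈⟨ assoc _ _ _ ⟩
        g ⁻¹ ∙ (x ⁻¹ ∙ g)                    ∎) (⁻¹-closed H≤G x∈)
    }

  -- H g⁻¹ g′ H equals g⁻¹ (g H g⁻¹) g′ H, and a coset u (g′ H g′⁻¹) from the cover of g H g⁻¹
  -- contributes just g⁻¹ u g′ H.
  doubleCoset-≲ : IsSubgroup H → ∀ {g g′} → conjugate g H ≲ conjugate g′ H →
                  doubleCoset H (g ⁻¹ ∙ g′) ≲ H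
  doubleCoset-≲ {H = H} H≤G {g} {g′} (us , cover) = map (λ u → g ⁻¹ ∙ (u ∙ g′)) us ,
    λ { {x} (h , h′ , h∈ , h′∈ , x≈) → Any.map⁺ (Any.map (λ {u} → move {u} h∈ h′∈ x≈)
      (cover (resp-≈ H≤G (sym (ghg⁻¹ h)) h∈))) }
    where
    ghg⁻¹ : ∀ h → g ⁻¹ ∙ ((g ∙ (h ∙ g ⁻¹)) ∙ g) ≈ h
    ghg⁻¹ h = begin
      g ⁻¹ ∙ ((g ∙ (h ∙ g ⁻¹)) ∙ g)  ≈⟨ ∙-congˡ (assoc _ _ _) ⟩
      g ⁻¹ ∙ (g ∙ ((h ∙ g ⁻¹) ∙ g))  ≈⟨ \\-leftDividesʳ g _ ⟩
      (h ∙ g ⁻¹) ∙ g                 ≈⟨ //-rightDividesˡ g h ⟩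
      h                              ∎
    move : ∀ {u x h h′} → h ∈ H → h′ ∈ H → x ≈ h ∙ ((g ⁻¹ ∙ g′) ∙ h′) →
      g ∙ (h ∙ g ⁻¹) ∈ leftCoset u (conjugate g′ H) → x ∈ leftCoset (g ⁻¹ ∙ (u ∙ g′)) H
    move {u} {x} {h} {h′} h∈ h′∈ x≈ z∈ =
      coset-resp H≤G ug′zh′≈x (coset-∙ H≤G (∙-closed H≤G z∈ h′∈))
      where
      y = g ∙ (h ∙ g ⁻¹)
      z = g′ ⁻¹ ∙ ((u ⁻¹ ∙ y) ∙ g′)
      ug′zh′≈x : (g ⁻¹ ∙ (u ∙ g′)) ∙ (z ∙ h′) ≈ x
      ug′zh′≈x = begin
        (g ⁻¹ ∙ (u ∙ g′)) ∙ (z ∙ h′)             ≈⟨ assoc _ _ _ ⟨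
        ((g ⁻¹ ∙ (u ∙ g′)) ∙ z) ∙ h′             ≈⟨ ∙-congʳ (assoc _ _ _) ⟩
        (g ⁻¹ ∙ ((u ∙ g′) ∙ z)) ∙ h′             ≈⟨ ∙-congʳ (∙-congˡ (assoc _ _ _)) ⟩
        (g ⁻¹ ∙ (u ∙ (g′ ∙ z))) ∙ h′             ≈⟨ ∙-congʳ (∙-congˡ (∙-congˡ (\\-leftDividesˡ g′ _))) ⟩
        (g ⁻¹ ∙ (u ∙ ((u ⁻¹ ∙ y) ∙ g′))) ∙ h′    ≈⟨ ∙-congʳ (∙-congˡ (assoc _ _ _)) ⟨
        (g ⁻¹ ∙ ((u ∙ (u ⁻¹ ∙ y)) ∙ g′)) ∙ h′    ≈⟨ ∙-congʳ (∙-congˡ (∙-congʳ (\\-leftDividesˡ u y))) ⟩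
        (g ⁻¹ ∙ (y ∙ g′)) ∙ h′                   ≈⟨ ∙-congʳ (∙-congˡ (assoc _ _ _)) ⟩
        (g ⁻¹ ∙ (g ∙ ((h ∙ g ⁻¹) ∙ g′))) ∙ h′    ≈⟨ ∙-congʳ (\\-leftDividesʳ g _) ⟩
        ((h ∙ g ⁻¹) ∙ g′) ∙ h′                   ≈⟨ ∙-congʳ (assoc _ _ _) ⟩
        (h ∙ (g ⁻¹ ∙ g′)) ∙ h′                   ≈⟨ assoc _ _ _ ⟩
        h ∙ ((g ⁻¹ ∙ g′) ∙ h′)                   ≈⟨ x≈ ⟨
        x                                        ∎

  -- Let x σ ∈ K be an element with label σ. If k ∈ K has label σ, then
  -- (x σ)⁻¹ k lies in one of the given double cosets, which is a finite
  -- union of left cosets by doubleCoset-≲.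
  doubleCosets-≲ : IsSubgroup H → IsSubgroup K →
    ∀ {k} (lab : Carrier → Fin k) → (∀ g g′ → lab g ≡ lab g′ → conjugate g H ≲ conjugate g′ H) →
    ∀ gs → (∀ x → x ∈ K → Any (λ g → x ∈ doubleCoset H g) gs) → K ≲ H
  doubleCosets-≲ {H = H} {K = K} H≤G K≤G {k} lab same gs cover =
    ≲-respˡ (λ {x} → piece {x}) (≲-⋃ λ σ → ≲-⋃ λ l → Piece≲ σ l)
    where
    Rep : Fin k → Pred Carrier _
    Rep σ x = x ∈ K × lab x ≡ σ
    rep : Fin k → Carrier
    rep σ = orElse (Rep σ) ε
    Piece : Fin k → Fin (length gs) → Pred Carrier _
    Piece σ l x = x ∈ K × lab x ≡ σ × rep σ ⁻¹ ∙ x ∈ doubleCoset H (lookup gs l)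
    piece : K ⊆ (λ x → ∃[ σ ] ∃[ l ] x ∈ Piece σ l)
    piece {x} x∈K =
      let r∈K , _ = orElse-∈ {P = Rep (lab x)} {ε} (x , x∈K , ≡.refl)
          any     = cover _ (∙-closed K≤G (⁻¹-closed K≤G r∈K) x∈K)
      in lab x , Any.index any , x∈K , ≡.refl , Any.lookup-index any
    Piece≲ : ∀ σ l → Piece σ l ≲ H
    Piece≲ σ l with em {P = ∃ (Piece σ l)}
    ... | no ∄  = [] , λ {x} x∈ → contradiction (x , x∈) ∄
    -- The given representative of the double coset need not be a quotient of elements with equal
    -- labels. Replacing it by (rep σ)⁻¹ k₀ brings it into the form that `doubleCoset-≲` handles.
    ... | yes (k₀ , k₀∈K , eq , k₀∈) =
      let r∈K , eq′ = orElse-∈ {P = Rep σ} {ε} (k₀ , k₀∈K , eq) in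
      ≲-respˡ (λ { {x} (_ , _ , x∈) → doubleCoset-same H≤G k₀∈ x∈ })
        (≲-translate H≤G (rep σ) (doubleCoset-≲ H≤G (same (rep σ) k₀ (≡.trans eq′ (≡.sym eq)))))

  -- A point x is labelled by the set σ of those j for which it lies in one
  -- of the given cosets of L j, by such cosets for the L (ι k), and by its
  -- coset modulo ⋂[ σ ] L in the intersection of the latter.
  opaque
    label-cosets : ∀ {d r} {L : Fin r → Pred Carrier p} → (∀ j → IsSubgroup (L j)) →
      (∀ σ → ∃[ e ] e ℕ.≤ d × Σ[ ι ∈ (Fin e → Fin r) ] (∀ k → finToFun σ (ι k) ≡ suc zero) ×
             (λ x → ∀ k → x ∈ L (ι k)) ≲ ⋂[ σ ] L) →
      ∃[ K ] ∀ n .{{_ : ℕ.NonZero n}} (c : Fin n → Fin r → Carrier) →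
        Σ[ lab ∈ (Carrier → Fin (K ℕ.* n ℕ.^ d)) ]
          (∀ {x y} → lab x ≡ lab y → ∀ i → Agree L (c i) x y)
    label-cosets {p = p} {d = d} {r} {L} L≤G basis = 2 ℕ.^ r ℕ.* width , λ n c → labelling n c
      where
      module _ (σ : Fin (2 ℕ.^ r)) where
        e : ℕ
        e = proj₁ (basis σ)
        e≤d : e ℕ.≤ d
        e≤d = proj₁ (proj₂ (basis σ))
        ι : Fin e → Fin r
        ι = proj₁ (proj₂ (proj₂ (basis σ)))
        ι∈σ : ∀ k → finToFun σ (ι k) ≡ suc zero
        ι∈σ = proj₁ (proj₂ (proj₂ (proj₂ (basis σ))))
        open _≲_ (proj₂ (proj₂ (proj₂ (proj₂ (basis σ))))) public
      width : ℕ
      width = proj₁ (bounded (length ∘ reps))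

      labelling : ∀ n .{{_ : ℕ.NonZero n}} (c : Fin n → Fin r → Carrier) →
        Σ[ lab ∈ (Carrier → Fin (2 ℕ.^ r ℕ.* width ℕ.* n ℕ.^ d)) ]
          (∀ {x y} → lab x ≡ lab y → ∀ i → Agree L (c i) x y)
      labelling n c = (λ x → label₃ (σ-of x) x (σ-of-spec x)) ,
        λ {x} {y} eq → label₃-agree (σ-of-spec x) (σ-of-spec y) eq
        where
        Hit : Carrier → Fin r → Set p
        Hit x j = ∃[ i ] x ∈ leftCoset (c i j) (L j)

        Spec : Fin (2 ℕ.^ r) → Carrier → Set p
        Spec σ x = ∀ j → finToFun σ j ≡ suc zero ⇔ Hit x j

        σ-of : Carrier → Fin (2 ℕ.^ r)
        σ-of x = funToFin (indicator (Hit x))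

        σ-of-spec : ∀ x → Spec (σ-of x) x
        σ-of-spec x j = mk⇔
          (λ eq → indicator⁻¹ {P = Hit x} (≡.trans (≡.sym (Fin.finToFun-funToFin (indicator (Hit x)) j)) eq))
          (λ hit → ≡.trans (Fin.finToFun-funToFin (indicator (Hit x)) j) (indicator-∈ {P = Hit x} hit))

        module _ (σ : Fin (2 ℕ.^ r)) where
          Box : Fin (n ℕ.^ e σ) → Pred Carrier p
          Box τ x = ∀ k → x ∈ leftCoset (c (finToFun τ k) (ι σ k)) (L (ι σ k))

          -- A common point of the chosen cosets, if there is one. Dividing by it moves their
          -- intersection into that of the L (ι k), which `reps σ` covers.
          base : Fin (n ℕ.^ e σ) → Carrier
          base τ = orElse (Box τ) ε

          module _ {x : Carrier} (spec : Spec σ x) where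
            hit : ∀ k → Hit x (ι σ k)
            hit k = to (spec (ι σ k)) (ι∈σ σ k)

            τ-of : Fin (n ℕ.^ e σ)
            τ-of = funToFin (proj₁ ∘ hit)

            ∈-Box : x ∈ Box τ-of
            ∈-Box k = subst (λ i → x ∈ leftCoset (c i (ι σ k)) (L (ι σ k)))
              (≡.sym (Fin.finToFun-funToFin (proj₁ ∘ hit) k)) (proj₂ (hit k))

            covered : Any (λ g → base τ-of ⁻¹ ∙ x ∈ leftCoset g (⋂[ σ ] L)) (reps σ)
            covered = cover σ λ k →
              coset-join (L≤G (ι σ k)) (orElse-∈ {P = Box τ-of} {ε} (x , ∈-Box) k) (∈-Box k)

          label₂ : ∀ x → Spec σ x → Fin (width ℕ.* n ℕ.^ d)
          label₂ x spec = combine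
            (Fin.inject≤ (Any.index (covered spec)) (proj₂ (bounded (length ∘ reps)) σ))
            -- The basis of σ may have fewer than d members; n ^ e ≤ n ^ d because n is nonzero.
            (Fin.inject≤ (τ-of spec) (ℕ.^-monoʳ-≤ n (e≤d σ)))

          label₂-coset : ∀ {x y} (s : Spec σ x) (t : Spec σ y) →
                         label₂ x s ≡ label₂ y t → y ∈ leftCoset x (⋂[ σ ] L)
          label₂-coset {x} {y} s t eq =
            resp-≈ ⋂σ≤G ([ab]⁻¹[ac]≈b⁻¹c (base (τ-of s) ⁻¹) x y)
              (coset-join ⋂σ≤G (Any.lookup-index (covered s))
                (subst (λ l → _ ∈ leftCoset (lookup (reps σ) l) (⋂[ σ ] L)) (≡.sym eq₁)
                  (subst (λ τ → base τ ⁻¹ ∙ y ∈ leftCoset (lookup (reps σ) (Any.index (covered t))) (⋂[ σ ] L))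
                    (≡.sym eq₂) (Any.lookup-index (covered t)))))
            where
            ⋂σ≤G = ⋂[]-isSubgroup σ L≤G
            eqs = Fin.combine-injective {width} {n ℕ.^ d} (Fin.inject≤ (Any.index (covered s)) _) _
                    (Fin.inject≤ (Any.index (covered t)) _) _ eq
            eq₁ : Any.index (covered s) ≡ Any.index (covered t)
            eq₁ = Fin.inject≤-injective _ _ _ _ (proj₁ eqs)
            eq₂ : τ-of s ≡ τ-of t
            eq₂ = Fin.inject≤-injective _ _ _ _ (proj₂ eqs)

          label₂-agree : ∀ {x y} (s : Spec σ x) (t : Spec σ y) →
                         label₂ x s ≡ label₂ y t → ∀ i → Agree L (c i) x y
          label₂-agree {x} {y} s t eq i j = mk⇔
            -- A coset c i L j that contains x puts j into the common σ, and equal labels give y in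
            -- x L j for all j in σ.
            (λ x∈ → coset-trans (L≤G j) x∈ (y∈xL (from (s j) (i , x∈))))
            (λ y∈ → coset-trans (L≤G j) y∈ (coset-sym (L≤G j) (y∈xL (from (t j) (i , y∈)))))
            where
            y∈xL : finToFun σ j ≡ suc zero → y ∈ leftCoset x (L j)
            y∈xL = label₂-coset s t eq j

        -- Here σ is an argument instead of `σ-of x`, so that an equality of labels can identify the
        -- two values of σ by matching.
        label₃ : ∀ σ x → Spec σ x → Fin (2 ℕ.^ r ℕ.* width ℕ.* n ℕ.^ d)
        label₃ σ x spec = subst Fin (≡.sym (ℕ.*-assoc (2 ℕ.^ r) width (n ℕ.^ d)))
          (combine σ (label₂ σ x spec))

        label₃-agree : ∀ {σ σ′ x y} (s : Spec σ x) (t : Spec σ′ y) →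
                       label₃ σ x s ≡ label₃ σ′ y t → ∀ i → Agree L (c i) x y
        label₃-agree {σ} {σ′} {x} {y} s t eq = split s t
          (≡.subst-injective (≡.sym (ℕ.*-assoc (2 ℕ.^ r) width (n ℕ.^ d))) eq)
          where
          split : ∀ {σ σ′ x y} (s : Spec σ x) (t : Spec σ′ y) →
            combine σ (label₂ σ x s) ≡ combine σ′ (label₂ σ′ y t) → ∀ i → Agree L (c i) x y
          split {σ} {σ′} s t eq
            with ≡.refl ← Fin.combine-injectiveˡ σ (label₂ σ _ s) σ′ (label₂ σ′ _ t) eq =
            label₂-agree σ s t (Fin.combine-injectiveʳ σ (label₂ σ _ s) σ (label₂ σ _ t) eq)

-- Independent families and breadth

module Independence (em : ∀ {a} → ExcludedMiddle a) (G : Group c ℓ) {A : Set a}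
                    (⟨_⟩ : A → Pred (Group.Carrier G) p)
                    (⟨_⟩-isSubgroup : ∀ x → Subgroups.IsSubgroup G ⟨ x ⟩) where
  open Classical em
  open Cosets em G
  open Group G using (Carrier; ε)
  open Subgroups G
  open IsSubgroup

  ⋂ : ∀ {n} → (Fin n → A) → Pred Carrier p
  ⋂ x g = ∀ i → g ∈ ⟨ x i ⟩

  ⋂≤G : ∀ {n} (x : Fin n → A) → IsSubgroup (⋂ x)
  ⋂≤G x = ⋂-isSubgroup λ i → ⟨ x i ⟩-isSubgroup

  ⋂-others : ∀ {n} → (Fin n → A) → Fin n → Pred Carrier p
  ⋂-others x i g = ∀ j → j ≢ i → g ∈ ⟨ x j ⟩

  Independent : ∀ {n} → (Fin n → A) → Set _
  Independent x = ∀ i → ¬ (⋂-others x i ≲ ⟨ x i ⟩)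

  StrictlyMonotone : ∀ {d n} → (Fin d → Fin n) → Set
  StrictlyMonotone i = ∀ {j k} → j Fin.< k → i j Fin.< i k

  module _ {d : ℕ} (dependent : (x : Fin (suc d) → A) → ¬ Independent x) where

    remove-one : (x : Fin (suc d) → A) → ∃[ i ] ⋂ (x ∘ Fin.punchIn i) ≲ ⋂ x
    remove-one x with i , ¬¬≲ ← ¬∀⇒∃¬ (dependent x) =
      i , ≲-⋂ (ε-closed (⋂≤G (x ∘ Fin.punchIn i))) (λ j → ⟨ x j ⟩-isSubgroup) each
      where
      others : ⋂ (x ∘ Fin.punchIn i) ⊆ ⋂-others x i
      others {g} g∈ j j≢i = subst (λ j → g ∈ ⟨ x j ⟩) (Fin.punchIn-punchOut (j≢i ∘ ≡.sym)) (g∈ _)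
      each : ∀ j → ⋂ (x ∘ Fin.punchIn i) ≲ ⟨ x j ⟩
      each j with j Fin.≟ i
      ... | yes ≡.refl = ≲-respˡ (λ {g} → others {g}) (byContradiction ¬¬≲)
      ... | no  j≢i    = ⊆⇒≲ ⟨ x j ⟩-isSubgroup λ {g} g∈ → others {g} g∈ j j≢i

    cons : ∀ {k} → (Fin d → Fin k) → Fin (suc d) → Fin (suc k)
    cons i zero    = zero
    cons i (suc l) = suc (i l)

    cons-mono : ∀ {k} (i : Fin d → Fin k) → StrictlyMonotone i → StrictlyMonotone (cons i)
    cons-mono i i-mono {zero}  {suc l} _         = ℕ.z<s
    cons-mono i i-mono {suc j} {suc l} (ℕ.s≤s j<l) = ℕ.s<s (i-mono j<l)

    punchIn-mono : (j : Fin (suc d)) → StrictlyMonotone (Fin.punchIn j)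
    punchIn-mono j {k} {l} k<l = Fin.≤∧≢⇒< (Fin.punchIn-mono-≤ j k l (ℕ.<⇒≤ k<l))
      (Fin.<⇒≢ k<l ∘ Fin.punchIn-injective j k l)

    cons-≲ : ∀ {n} (x : Fin (suc n) → A) (i : Fin d → Fin n) →
             ⋂ (x ∘ suc ∘ i) ≲ ⋂ (x ∘ suc) → ⋂ (x ∘ cons i) ≲ ⋂ x
    cons-≲ x i ⋂i≲ = ≲-⋂ {P = ⋂ (x ∘ cons i)}
      (ε-closed (⋂≤G (x ∘ cons i))) {Hs = λ l → ⟨ x l ⟩} (λ l → ⟨ x l ⟩-isSubgroup) each
      where
      each : ∀ l → ⋂ (x ∘ cons i) ≲ ⟨ x l ⟩
      each zero    = ⊆⇒≲ ⟨ x zero ⟩-isSubgroup λ g∈ → g∈ zero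
      each (suc l) = ≲-respˡ {Q = ⋂ (x ∘ suc ∘ i)} (λ g∈ l → g∈ (suc l))
        (≲-trans {K = ⟨ x (suc l) ⟩} {H = ⋂ (x ∘ suc)} ⟨ x (suc l) ⟩-isSubgroup ⋂i≲
          (⊆⇒≲ ⟨ x (suc l) ⟩-isSubgroup λ g∈ → g∈ l))

    -- The size is written k + d so that the induction starts from d members. The tail is cut down
    -- to d members, the head makes d + 1, and `remove-one` drops one again.
    subfamily : ∀ k (x : Fin (k ℕ.+ d) → A) →
                Σ[ i ∈ (Fin d → Fin (k ℕ.+ d)) ] StrictlyMonotone i × ⋂ (x ∘ i) ≲ ⋂ x
    subfamily zero    x = id , id , ⊆⇒≲ (⋂≤G x) id
    subfamily (suc k) x =
      let i , i-mono , ⋂i≲ = subfamily k (x ∘ suc)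
          j , ⋂j≲          = remove-one (x ∘ cons i)
      in cons i ∘ Fin.punchIn j ,
         (λ k<l → cons-mono i i-mono (punchIn-mono j k<l)) ,
         ≲-trans {P = ⋂ (x ∘ cons i ∘ Fin.punchIn j)} {H = ⋂ (x ∘ cons i)} (⋂≤G x) ⋂j≲ (cons-≲ x i ⋂i≲)

    difference : ∀ {k n} → k ℕ.≤ n → ∃[ o ] o ℕ.+ k ≡ n
    difference k≤n = _ , ℕ.m∸n+n≡m k≤n

    few : ∀ {n} (x : Fin n → A) →
      ∃[ e ] e ℕ.≤ d × Σ[ i ∈ (Fin e → Fin n) ] ⋂ (x ∘ i) ≲ ⋂ x
    few {n} x with d ℕ.≤? n
    ... | no  d≰n = n , ℕ.<⇒≤ (ℕ.≰⇒> d≰n) , id , ⊆⇒≲ (⋂≤G x) id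
    ... | yes d≤n with k , ≡.refl ← difference d≤n =
      let i , _ , ⋂i≲ = subfamily k x in d , ℕ.≤-refl , i , ⋂i≲

    opaque
      -- This is the hypothesis of `label-cosets`. Applying `few` to the list of members of σ
      -- ensures that the selected indices belong to σ.
      basis : ∀ {r} (L : Fin r → A) (σ : Fin (2 ℕ.^ r)) →
        ∃[ e ] e ℕ.≤ d × Σ[ ι ∈ (Fin e → Fin r) ] (∀ k → finToFun σ (ι k) ≡ suc zero) ×
        (λ x → ∀ k → x ∈ ⟨ L (ι k) ⟩) ≲ ⋂[ σ ] (⟨_⟩ ∘ L)
      basis {r} L σ = let e , e≤d , i , ⋂i≲ = few (L ∘ lookup members) in
        e , e≤d , lookup members ∘ i ,
        (λ k → All.lookup (All.all-filter ∈σ? (allFin r)) (∈-lookup (i k))) ,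
        ≲-trans ⋂σ≤G ⋂i≲ (⊆⇒≲ ⋂σ≤G λ {g} g∈ j j∈σ →
          let j∈ = ∈-filter⁺ ∈σ? (∈-allFin j) j∈σ in
          subst (λ j → g ∈ ⟨ L j ⟩) (≡.sym (Any.lookup-index j∈)) (g∈ (Any.index j∈)))
        where
        ∈σ? : ∀ j → Dec (finToFun {2} {r} σ j ≡ suc zero)
        ∈σ? = λ j → finToFun σ j Fin.≟ suc zero
        members : List (Fin r)
        members = filter ∈σ? (allFin r)
        ⋂σ≤G : IsSubgroup (⋂[ σ ] (⟨_⟩ ∘ L))
        ⋂σ≤G = ⋂[]-isSubgroup σ λ j → ⟨ L j ⟩-isSubgroup

    breadth≤ : Breadth.BreadthAtMost ⋂ Commensurable d
    breadth≤ d<n x with k , ≡.refl ← difference (ℕ.<⇒≤ d<n) =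
      let i , i-mono , ⋂i≲ = subfamily k x in
      i , i-mono ,
      ≲⇒index (∩-isSubgroup (⋂≤G x) (⋂≤G (x ∘ i))) (ε-closed (⋂≤G x))
        (⊆⇒≲ (∩-isSubgroup (⋂≤G x) (⋂≤G (x ∘ i))) λ g∈ → g∈ , g∈ ∘ i) ,
      ≲⇒index (∩-isSubgroup (⋂≤G x) (⋂≤G (x ∘ i))) (ε-closed (⋂≤G (x ∘ i)))
        (≲-∩ (ε-closed (⋂≤G (x ∘ i))) (⋂≤G x) (⋂≤G (x ∘ i)) ⋂i≲ (⊆⇒≲ (⋂≤G (x ∘ i)) id))

  -- Fewer than d members miss some index j. Their intersection contains `⋂-others x j` and would be
  -- covered by finitely many cosets of the j-th subgroup, against independence.
  ≤breadth : ∀ {d} {x : Fin d → A} → Independent x →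
             ∀ e → Breadth.BreadthAtMost ⋂ Commensurable e → d ℕ.≤ e
  ≤breadth {d} {x} indep e breadth≤e = ℕ.≮⇒≥ λ e<d →
    let i , _ , _ , index = breadth≤e e<d x
        j , j∉i = missed e<d i
    in indep j (≲-trans ⟨ x j ⟩-isSubgroup
         (≲-respˡ (λ g∈ k → g∈ (i k) (j∉i k)) (index⇒≲ {H = ⋂ x ∩ ⋂ (x ∘ i)} {P = ⋂ (x ∘ i)} index))
         (⊆⇒≲ ⟨ x j ⟩-isSubgroup λ g∈ → proj₁ g∈ j))
    where
    missed : ∀ {e} → e ℕ.< d → (i : Fin e → Fin d) → ∃[ j ] ∀ k → i k ≢ j
    missed e<d i = byContradiction λ none →
      let preimage : ∀ j → ∃[ k ] i k ≡ j
          preimage j = byContradiction λ ¬hit → none (j , λ k eq → ¬hit (k , eq))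
      in contradiction e<d (ℕ.≤⇒≯ (Fin.injective⇒≤ {f = proj₁ ∘ preimage} λ {j} {j′} eq →
           ≡.trans (≡.sym (proj₂ (preimage j))) (≡.trans (cong i eq) (proj₂ (preimage j′)))))

-- Shatter functions and vc-density

lookup-injective : {A : Set a} {xs : List A} → Unique xs → Injective _≡_ _≡_ (lookup xs)
lookup-injective (x∉ ∷ u) {zero}  {zero}  eq = ≡.refl
lookup-injective (x∉ ∷ u) {zero}  {suc j} eq = contradiction eq (All.lookup x∉ (∈-lookup j))
lookup-injective (x∉ ∷ u) {suc i} {zero}  eq = contradiction (≡.sym eq) (All.lookup x∉ (∈-lookup i))
lookup-injective (x∉ ∷ u) {suc i} {suc j} eq = cong suc (lookup-injective u eq)

allSubsets : ∀ n → List (Subset n)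
allSubsets zero    = Vec.[] ∷ []
allSubsets (suc n) = map (true Vec.∷_) (allSubsets n) ++ map (false Vec.∷_) (allSubsets n)

∈-allSubsets : ∀ {n} (T : Subset n) → T ∈ₗ allSubsets n
∈-allSubsets Vec.[]          = here ≡.refl
∈-allSubsets (true Vec.∷ T)  = ∈-++⁺ˡ (∈-map⁺ (true Vec.∷_) (∈-allSubsets T))
∈-allSubsets (false Vec.∷ T) = ∈-++⁺ʳ (map (true Vec.∷_) (allSubsets _)) (∈-map⁺ (false Vec.∷_) (∈-allSubsets T))

allSubsets-unique : ∀ n → Unique (allSubsets n)
allSubsets-unique zero    = [] ∷ []
allSubsets-unique (suc n) = Unique.++⁺
  (Unique.map⁺ Vec.∷-injectiveʳ (allSubsets-unique n))
  (Unique.map⁺ Vec.∷-injectiveʳ (allSubsets-unique n))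
  λ { (T∈ , T∈′) → disjoint (∈-map⁻ (true Vec.∷_) T∈) (∈-map⁻ (false Vec.∷_) T∈′) }
  where
  disjoint : ∀ {T} → (∃[ S ] S ∈ₗ allSubsets n × T ≡ true Vec.∷ S) →
             ¬ (∃[ S ] S ∈ₗ allSubsets n × T ≡ false Vec.∷ S)
  disjoint (_ , _ , ≡.refl) (_ , _ , ())

cardinality≤ : ∀ {n j k} {P : Pred (Subset n) p} → HasCardinality P j →
  (f : ∀ T → P T → Fin k) → (∀ {T T′} PT PT′ → f T PT ≡ f T′ PT′ → T ≡ T′) → j ℕ.≤ k
cardinality≤ {P = P} (Ts , unique , Ts⇔P , ≡.refl) f f-inj =
  Fin.injective⇒≤ {f = λ i → f (lookup Ts i) (P-lookup i)} (lookup-injective unique ∘ f-inj _ _)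
  where
  P-lookup : ∀ i → P (lookup Ts i)
  P-lookup i = to (Ts⇔P _) (∈-lookup i)

≤cardinality : ∀ {n j k} {P : Pred (Subset n) p} → HasCardinality P j →
  (g : Fin k → Subset n) → (∀ i → P (g i)) → Injective _≡_ _≡_ g → k ℕ.≤ j
≤cardinality {P = P} (Ts , unique , Ts⇔P , ≡.refl) g P-g g-inj =
  Fin.injective⇒≤ {f = Any.index ∘ g∈} λ {i} {j} eq → g-inj (≡.trans (Any.lookup-index (g∈ i))
    (≡.trans (cong (lookup Ts) eq) (≡.sym (Any.lookup-index (g∈ j)))))
  where
  g∈ : ∀ i → g i ∈ₗ Ts
  g∈ i = from (Ts⇔P _) (P-g i)

-- If a < e, some n above both N and C would satisfy n · n ^ a ≤ C · n ^ a, hence n ≤ C.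
power-growth : ∀ C N {e a} → (∀ n → N ℕ.≤ n → n ℕ.^ e ℕ.≤ C ℕ.* n ℕ.^ a) → e ℕ.≤ a
power-growth C N {e} {a} bound = ℕ.≮⇒≥ λ a<e →
  ℕ.<⇒≱ (ℕ.m≤n⊔m N (suc C)) (ℕ.*-cancelʳ-≤ n C (n ℕ.^ a) {{ℕ.m^n≢0 n a {{n≢0}}}}
    (ℕ.≤-trans (ℕ.^-monoʳ-≤ n {{n≢0}} a<e) (bound n (ℕ.m≤m⊔n N (suc C)))))
  where
  n = N ℕ.⊔ suc C
  n≢0 : ℕ.NonZero n
  n≢0 = ℕ.>-nonZero (ℕ.<-≤-trans ℕ.z<s (ℕ.m≤n⊔m N (suc C)))

^-distribʳ-* : ∀ m n o → (m ℕ.* n) ℕ.^ o ≡ m ℕ.^ o ℕ.* n ℕ.^ o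
^-distribʳ-* m n zero    = ≡.refl
^-distribʳ-* m n (suc o) = ≡.trans (cong (m ℕ.* n ℕ.*_) (^-distribʳ-* m n o))
  (ℕ.[m*n]*[o*p]≡[m*o]*[n*p] m n (m ℕ.^ o) (n ℕ.^ o))

fromℚᵘ-mono-≤ : ∀ {x y} → x ℚᵘ.≤ y → fromℚᵘ x ℚ.≤ fromℚᵘ y
fromℚᵘ-mono-≤ {x} {y} x≤y = ℚ.toℚᵘ-cancel-≤
  (ℚᵘ.≤-respˡ-≃ (ℚᵘ.≃-sym (ℚ.toℚᵘ-fromℚᵘ x)) (ℚᵘ.≤-respʳ-≃ (ℚᵘ.≃-sym (ℚ.toℚᵘ-fromℚᵘ y)) x≤y))

fromℚᵘ-mono-< : ∀ {x y} → x ℚᵘ.< y → fromℚᵘ x ℚ.< fromℚᵘ y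
fromℚᵘ-mono-< {x} {y} x<y = ℚ.toℚᵘ-cancel-<
  (ℚᵘ.<-respˡ-≃ (ℚᵘ.≃-sym (ℚ.toℚᵘ-fromℚᵘ x)) (ℚᵘ.<-respʳ-≃ (ℚᵘ.≃-sym (ℚ.toℚᵘ-fromℚᵘ y)) x<y))

fromℚᵘ-cancel-< : ∀ {x y} → fromℚᵘ x ℚ.< fromℚᵘ y → x ℚᵘ.< y
fromℚᵘ-cancel-< {x} {y} x<y =
  ℚᵘ.<-respˡ-≃ (ℚ.toℚᵘ-fromℚᵘ x) (ℚᵘ.<-respʳ-≃ (ℚ.toℚᵘ-fromℚᵘ y) (ℚ.toℚᵘ-mono-< x<y))

integer≤fraction : ∀ d s t .{{_ : ℕ.NonZero t}} → d ℕ.* t ℕ.≤ s → + d ℚ./ 1 ℚ.≤ + s ℚ./ t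
integer≤fraction d s (suc t) dt≤s = fromℚᵘ-mono-≤ {mkℚᵘ (+ d) 0} {mkℚᵘ (+ s) t}
  (ℚᵘ.*≤* (≡.subst₂ ℤ._≤_ (ℤ.pos-* d (suc t))
    (≡.trans (cong +_ (≡.sym (ℕ.*-identityʳ s))) (ℤ.pos-* s 1)) (ℤ.+≤+ dt≤s)))

integer<fraction⁻¹ : ∀ d s t .{{_ : ℕ.NonZero t}} → + d ℚ./ 1 ℚ.< + s ℚ./ t → d ℕ.* t ℕ.< s
integer<fraction⁻¹ d s (suc t) d<s/t with ℚᵘ.*<* dt<s ← fromℚᵘ-cancel-< {mkℚᵘ (+ d) 0} {mkℚᵘ (+ s) t} d<s/t =
  ℤ.drop‿+<+ (≡.subst₂ ℤ._<_ (≡.sym (ℤ.pos-* d (suc t)))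
    (≡.trans (≡.sym (ℤ.pos-* s 1)) (cong +_ (ℕ.*-identityʳ s))) dt<s)

∃ℕ≥ : ∀ q → ∃[ d ] q ℚ.≤ + d ℚ./ 1
∃ℕ≥ q@(mkℚ n b-1 _) = ℤ.∣ n ∣ , subst (ℚ._≤ + ℤ.∣ n ∣ ℚ./ 1) (ℚ.fromℚᵘ-toℚᵘ q)
  (fromℚᵘ-mono-≤ {mkℚᵘ n b-1} {mkℚᵘ (+ ℤ.∣ n ∣) 0} (ℚᵘ.*≤* (n≤ n)))
  where
  n≤ : ∀ n → n ℤ.* + 1 ℤ.≤ + ℤ.∣ n ∣ ℤ.* + suc b-1
  n≤ (+ n)    = ≡.subst₂ ℤ._≤_ (ℤ.pos-* n 1) (ℤ.pos-* n (suc b-1)) (ℤ.+≤+ (ℕ.*-monoʳ-≤ n (ℕ.s≤s ℕ.z≤n)))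
  n≤ -[1+ n ] = ℤ.-≤+

fraction : ∀ q → ℚ.0ℚ ℚ.< q → ∃[ s ] ∃[ t-1 ] q ≡ + s ℚ./ suc t-1
fraction q@(mkℚ (+ n) d-1 _) _ = n , d-1 , ≡.sym (ℚ.fromℚᵘ-toℚᵘ q)
fraction (mkℚ -[1+ n ] d-1 _) 0<q with () ← ℚ.drop-*<* 0<q

module Densities (em : ∀ {a} → ExcludedMiddle a) where
  open Classical em
  open ℝ∞

  least : (P : Pred ℕ p) → ∃ P → ∃[ k ] P k × (∀ j → P j → k ℕ.≤ j)
  least P (n , Pn) = <-rec (λ n → P n → ∃[ k ] P k × (∀ j → P j → k ℕ.≤ j)) step n Pn
    where
    step : ∀ n → (∀ {i} → i ℕ.< n → P i → ∃[ k ] P k × (∀ j → P j → k ℕ.≤ j)) →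
           P n → ∃[ k ] P k × (∀ j → P j → k ℕ.≤ j)
    step n rec Pn with em {P = ∃[ i ] i ℕ.< n × P i}
    ... | yes (i , i<n , Pi) = rec i<n Pi
    ... | no  none           = n , Pn , λ j Pj → ℕ.≮⇒≥ λ j<n → none (j , j<n , Pj)

  cardinality : ∀ {n} (P : Pred (Subset n) p) → ∃[ j ] HasCardinality P j
  cardinality {n = n} P = _ , filter em? (allSubsets n) ,
    Unique.filter⁺ em? (allSubsets-unique n) ,
    (λ T → mk⇔ (proj₂ ∘ ∈-filter⁻ em? {xs = allSubsets n}) (∈-filter⁺ em? (∈-allSubsets T))) , ≡.refl
    where
    em? : ∀ T → Dec (P T)
    em? T = em

  -- A number is given by the rationals above it, so an infimum is a union of cuts, empty for the
  -- empty set. `resize` brings this union down to the level of cuts.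
  inf : (P : Pred ℝ∞ p) → ∃[ v ] IsInf P v
  inf P = v , (λ x Px q x<q → resize⁺ (x , Px , x<q)) ,
          λ w w≤P q v<q → let x , Px , x<q = resize⁻ v<q in w≤P x Px q x<q
    where
    v : ℝ∞
    v = record
      { _<_     = λ q → resize _ (∃[ x ] P x × (x < q))
      ; nonneg  = λ h → let x , _ , x<q = resize⁻ h in nonneg x x<q
      ; upward  = λ q≤q′ h → let x , Px , x<q = resize⁻ h in resize⁺ (x , Px , upward x q≤q′ x<q)
      ; rounded = λ h → let x , Px , x<q = resize⁻ h
                            q′ , q′<q , x<q′ = rounded x x<q
                        in q′ , q′<q , resize⁺ (x , Px , x<q′)
      }

  module _ (X : Setoid a b) {B : Set p} (𝒮 : B → Pred (Setoid.Carrier X) r) where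
    open VC X 𝒮
    open Setoid X using (_≈_) renaming (Carrier to ∣X∣)

    trace : ∀ {n} (A : Fin n → ∣X∣) (b : B) → ∃[ T ] (∀ i → (i ∈ₛ T) ⇔ (A i ∈ 𝒮 b))
    trace A b = Vec.tabulate side , λ i → mk⇔
      (λ i∈ → side⁻ (≡.trans (≡.sym (Vec.lookup∘tabulate side i)) (Vec.[]=⇒lookup i∈)))
      (λ Ai∈ → Vec.lookup⇒[]= i _ (≡.trans (Vec.lookup∘tabulate side i) (side⁺ Ai∈)))
      where
      side : Fin _ → Bool
      side i = does (em {P = A i ∈ 𝒮 b})
      side⁻ : ∀ {i} → side i ≡ true → A i ∈ 𝒮 b
      side⁻ {i} eq with yes Ai∈ ← em {P = A i ∈ 𝒮 b} = Ai∈
      side⁺ : ∀ {i} → A i ∈ 𝒮 b → side i ≡ true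
      side⁺ {i} Ai∈ = dec-true em Ai∈

    shatter-exists : ∀ n → ∃[ k ] Shatter n k
    shatter-exists n = least (ShatterAtMost n) (length (allSubsets n) , λ A _ j card →
      cardinality≤ card (λ T _ → Any.index (∈-allSubsets T)) λ {T} {T′} _ _ eq →
        ≡.trans (Any.lookup-index (∈-allSubsets T)) (≡.trans (cong (lookup (allSubsets n)) eq)
          (≡.sym (Any.lookup-index (∈-allSubsets T′)))))

    density≤ : ∀ d K →
      (∀ n .{{_ : ℕ.NonZero n}} (A : Fin n → ∣X∣) → Σ[ lab ∈ (B → Fin (K ℕ.* n ℕ.^ d)) ]
        (∀ {b b′} → lab b ≡ lab b′ → ∀ i → A i ∈ 𝒮 b → A i ∈ 𝒮 b′)) →
      ∀ v → IsVCDensity v → v ≤ᴿ fromℕᴿ d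
    -- The rational d + 1 witnesses that d is finite. The threshold is 1 since labels are given for
    -- nonzero n.
    density≤ d K labels v (v≤ , _) = v≤ (fromℕᴿ d) ((+ suc d ℚ./ 1 , d<1+d) , K , 1 , growth)
      where
      d<1+d : + d ℚ./ 1 ℚ.< + suc d ℚ./ 1
      d<1+d = fromℚᵘ-mono-< {mkℚᵘ (+ d) 0} {mkℚᵘ (+ suc d) 0}
        (ℚᵘ.*<* (≡.subst₂ ℤ._<_ (ℤ.pos-* d 1) (ℤ.pos-* (suc d) 1) (ℤ.+<+ (ℕ.*-monoˡ-< 1 (ℕ.n<1+n d)))))
      shatter≤ : ∀ n .{{_ : ℕ.NonZero n}} → ShatterAtMost n (K ℕ.* n ℕ.^ d)
      shatter≤ n A _ j card with lab , lab-same ← labels n A =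
        cardinality≤ card (λ { _ (b , _) → lab b }) λ { (b , T⇔) (b′ , T′⇔) eq → ⊆-antisym
          (λ {i} i∈T → from (T′⇔ i) (lab-same eq i (to (T⇔ i) i∈T)))
          (λ {i} i∈T′ → from (T⇔ i) (lab-same (≡.sym eq) i (to (T′⇔ i) i∈T′))) }
      growth : ∀ n → 1 ℕ.≤ n → ∀ k → Shatter n k → k ≤ K · n ^ᴿ fromℕᴿ d
      growth n 1≤n k (_ , k≤) s t d<s/t = begin
        k ℕ.^ t                          ≤⟨ ℕ.^-monoˡ-≤ t (k≤ _ (shatter≤ n)) ⟩
        (K ℕ.* n ℕ.^ d) ℕ.^ t            ≡⟨ ^-distribʳ-* K (n ℕ.^ d) t ⟩
        K ℕ.^ t ℕ.* (n ℕ.^ d) ℕ.^ t      ≡⟨ cong (K ℕ.^ t ℕ.*_) (ℕ.^-*-assoc n d t) ⟩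
        K ℕ.^ t ℕ.* n ℕ.^ (d ℕ.* t)      ≤⟨ ℕ.*-monoʳ-≤ (K ℕ.^ t) (ℕ.^-monoʳ-≤ n dt≤s) ⟩
        K ℕ.^ t ℕ.* n ℕ.^ s              ∎
        where
        open ℕ.≤-Reasoning
        instance
          n≢0 : ℕ.NonZero n
          n≢0 = ℕ.>-nonZero 1≤n
        dt≤s : d ℕ.* t ℕ.≤ s
        dt≤s = ℕ.<⇒≤ (integer<fraction⁻¹ d s t d<s/t)

    -- With d · n points and n ^ d traces, a growth bound with exponent s gives n ^ d ≤ C (d n) ^ s,
    -- in which d ^ s is a constant.
    ≤density : ∀ d →
      (∀ n → Σ[ A ∈ (Fin (d ℕ.* n) → ∣X∣) ] Injective _≡_ _≈_ A ×
        Σ[ b ∈ (Fin (n ℕ.^ d) → B) ]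
          (∀ {η η′} → (∀ i → A i ∈ 𝒮 (b η) ⇔ A i ∈ 𝒮 (b η′)) → η ≡ η′)) →
      ∀ v → IsVCDensity v → fromℕᴿ d ≤ᴿ v
    -- There are no points for d = 0, so the growth bound cannot be reached; the claim is
    -- nonnegativity.
    ≤density zero    _        v _        q v<q = nonneg v v<q
    ≤density d@(suc _) patterns v (_ , ≤v) = ≤v (fromℕᴿ d) λ s growth q s<q → d≤ s growth q s<q
      where
      shattered : ∀ n {k} → Shatter (d ℕ.* n) k → n ℕ.^ d ℕ.≤ k
      shattered n {k} (at-most , _) with A , A-inj , b , distinct ← patterns n
        with j , card ← cardinality (Traces A) =
        ℕ.≤-trans (≤cardinality card (λ η → proj₁ (trace A (b η))) (λ η → b η , proj₂ (trace A (b η)))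
          λ {η} {η′} eq → distinct λ i → mk⇔
            (λ h → to (proj₂ (trace A (b η′)) i) (subst (i ∈ₛ_) eq (from (proj₂ (trace A (b η)) i) h)))
            (λ h → to (proj₂ (trace A (b η)) i) (subst (i ∈ₛ_) (≡.sym eq) (from (proj₂ (trace A (b η′)) i) h))))
          (at-most A A-inj j card)
      d≤ : ∀ s → IsFinite s × GrowthAtMost s → fromℕᴿ d ≤ᴿ s
      d≤ s (_ , C , N , growth) q s<q
        -- Comparing growth only yields d ≤ q′, so the strict d < q needs room between q′ and q.
        with q′ , q′<q , s<q′ ← rounded s s<q
        with a , b-1 , ≡.refl ← fraction q′ (nonneg s s<q′) =
        ℚ.≤-<-trans (integer≤fraction d a (suc b-1) (power-growth (C ℕ.^ suc b-1 ℕ.* d ℕ.^ a) N bound)) q′<q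
        where
        bound : ∀ n → N ℕ.≤ n → n ℕ.^ (d ℕ.* suc b-1) ℕ.≤ C ℕ.^ suc b-1 ℕ.* d ℕ.^ a ℕ.* n ℕ.^ a
        bound n N≤n with k , shatter ← shatter-exists (d ℕ.* n) = begin
          n ℕ.^ (d ℕ.* suc b-1)                        ≡⟨ ℕ.^-*-assoc n d (suc b-1) ⟨
          (n ℕ.^ d) ℕ.^ suc b-1                        ≤⟨ ℕ.^-monoˡ-≤ (suc b-1) (shattered n shatter) ⟩
          k ℕ.^ suc b-1                                ≤⟨ growth (d ℕ.* n) N≤dn k shatter a (suc b-1) s<q′ ⟩
          C ℕ.^ suc b-1 ℕ.* (d ℕ.* n) ℕ.^ a            ≡⟨ cong (C ℕ.^ suc b-1 ℕ.*_) (^-distribʳ-* d n a) ⟩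
          C ℕ.^ suc b-1 ℕ.* (d ℕ.^ a ℕ.* n ℕ.^ a)      ≡⟨ ℕ.*-assoc (C ℕ.^ suc b-1) (d ℕ.^ a) (n ℕ.^ a) ⟨
          C ℕ.^ suc b-1 ℕ.* d ℕ.^ a ℕ.* n ℕ.^ a        ∎
          where
          open ℕ.≤-Reasoning
          N≤dn = ℕ.≤-trans N≤n (ℕ.m≤n*m n d)

-- Definable sets and imaginaries

module Definability (em : ∀ {a} → ExcludedMiddle a) (G : ExpandedGroup ℓ) where
  open Classical em
  open ExpandedGroup G
  open ModelTheory G
  open Semantics structure using (eval; _▸_; ⊨-resp-≋)
  open Imaginaries structure hiding (IsAclᵉᵠ∅Definable)

  L-Term : Set → Set ℓ
  L-Term X = Term language {X} (const tt) tt

  private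
    variable
      X Y : Set
      n : ℕ
      P Q : Pred (X → Carrier) p

  substTerm : (X → L-Term Y) → L-Term X → L-Term Y
  substTerm σ (var x)    = σ x
  substTerm σ (fun f ts) = fun f λ i → substTerm σ (ts i)

  liftSubst : (X → L-Term Y) → Maybe X → L-Term (Maybe Y)
  liftSubst σ nothing  = var nothing
  liftSubst σ (just x) = substTerm (λ y → var (just y)) (σ x)

  substFormula : (X → L-Term Y) → L-Formula X → L-Formula Y
  substFormula σ (t ≐ u)    = substTerm σ t ≐ substTerm σ u
  substFormula σ (rel R ts) = rel R λ i → substTerm σ (ts i)
  substFormula σ (¬′ φ)     = ¬′ substFormula σ φ
  substFormula σ (φ ∧′ ψ)   = substFormula σ φ ∧′ substFormula σ ψ
  substFormula σ (∃′ s φ)   = ∃′ s (substFormula (liftSubst σ) φ)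

  eval-subst : (σ : X → L-Term Y) (t : L-Term X) {v : Y → Carrier} →
               eval (substTerm σ t) v ≈ eval t (λ x → eval (σ x) v)
  eval-subst σ (var x)    = refl
  eval-subst σ (fun f ts) = Structure.⟦⟧ᶠ-cong structure f λ i → eval-subst σ (ts i)

  ⊨-subst : (σ : X → L-Term Y) (φ : L-Formula X) {v : Y → Carrier} →
            (v ⊨ substFormula σ φ) ⇔ ((λ x → eval (σ x) v) ⊨ φ)
  ⊨-subst σ (t ≐ u) = mk⇔
    (λ e → trans (sym (eval-subst σ t)) (trans e (eval-subst σ u)))
    (λ e → trans (eval-subst σ t) (trans e (sym (eval-subst σ u))))
  ⊨-subst σ (rel R ts) = mk⇔
    (⟦⟧ᴿ-resp R λ i → eval-subst σ (ts i)) (⟦⟧ᴿ-resp R λ i → sym (eval-subst σ (ts i)))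
  ⊨-subst σ (¬′ φ) = mk⇔ (_∘ from (⊨-subst σ φ)) (_∘ to (⊨-subst σ φ))
  ⊨-subst σ (φ ∧′ ψ) = mk⇔
    (λ { (h , k) → to (⊨-subst σ φ) h , to (⊨-subst σ ψ) k })
    (λ { (h , k) → from (⊨-subst σ φ) h , from (⊨-subst σ ψ) k })
  ⊨-subst σ (∃′ s φ) {v} = mk⇔
    (λ { (c , h) → c , ⊨-resp-≋ φ (lifted c) (to (⊨-subst (liftSubst σ) φ) h) })
    (λ { (c , h) → c , from (⊨-subst (liftSubst σ) φ) (⊨-resp-≋ φ (sym ∘ lifted c) h) })
    where
    lifted : ∀ c x → eval (liftSubst σ x) (v ▸ c) ≈ ((λ x → eval (σ x) v) ▸ c) x
    lifted c nothing  = refl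
    lifted c (just x) = eval-subst (λ y → var (just y)) (σ x)

  record Definable (P : Pred (X → Carrier) p) : Set (ℓ ⊔ p) where
    constructor _,_
    field
      formula : L-Formula X
      defines : ∀ v → P v ⇔ (v ⊨ formula)
  open Definable public

  definable-resp : Definable P → ∀ {v w} → (∀ x → v x ≈ w x) → P v → P w
  definable-resp (φ , P⇔φ) {v} {w} v≈w = from (P⇔φ w) ∘ ⊨-resp-≋ φ v≈w ∘ to (P⇔φ v)

  definable-⇔ : (∀ v → P v ⇔ Q v) → Definable P → Definable Q
  definable-⇔ P⇔Q (φ , P⇔φ) =
    φ , λ v → mk⇔ (to (P⇔φ v) ∘ from (P⇔Q v)) (to (P⇔Q v) ∘ from (P⇔φ v))

  definable-formula : (φ : L-Formula X) → Definable (_⊨ φ)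
  definable-formula φ = φ , λ v → mk⇔ id id

  definable-¬ : Definable P → Definable (λ v → ¬ P v)
  definable-¬ (φ , P⇔φ) = ¬′ φ , λ v → mk⇔ (_∘ from (P⇔φ v)) (_∘ to (P⇔φ v))

  definable-× : Definable P → Definable Q → Definable (λ v → P v × Q v)
  definable-× (φ , P⇔φ) (ψ , Q⇔ψ) = φ ∧′ ψ , λ v → mk⇔
    (λ { (h , k) → to (P⇔φ v) h , to (Q⇔ψ v) k })
    (λ { (h , k) → from (P⇔φ v) h , from (Q⇔ψ v) k })

  definable-→ : Definable P → Definable Q → Definable (λ v → P v → Q v)
  definable-→ dP dQ = definable-⇔
    (λ v → mk⇔ (λ h k → byContradiction λ ¬q → h (k , ¬q)) (λ { h (p , ¬q) → ¬q (h p) }))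
    (definable-¬ (definable-× dP (definable-¬ dQ)))

  definable-iff : Definable P → Definable Q → Definable (λ v → P v ⇔ Q v)
  definable-iff dP dQ = definable-⇔
    (λ v → mk⇔ (λ { (h , k) → mk⇔ h k }) (λ h → to h , from h))
    (definable-× (definable-→ dP dQ) (definable-→ dQ dP))

  definable-⊤ : Definable {X} (λ _ → ⊤ {ℓ})
  definable-⊤ = ∃′ tt (var nothing ≐ var nothing) , λ v → mk⇔ (λ _ → ε , refl) _

  definable-∀fin : {P : Fin n → Pred (X → Carrier) p} → (∀ i → Definable (P i)) →
                   Definable (λ v → ∀ i → P i v)
  definable-∀fin {n = zero}  dP = definable-⇔ (λ _ → mk⇔ (λ _ ()) _) definable-⊤
  definable-∀fin {n = suc n} dP = definable-⇔
    (λ _ → mk⇔ (λ { (h , k) zero → h ; (h , k) (suc i) → k i }) (λ h → h zero , h ∘ suc))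
    (definable-× (dP zero) (definable-∀fin (dP ∘ suc)))

  definable-∃fin : {P : Fin n → Pred (X → Carrier) p} → (∀ i → Definable (P i)) →
                   Definable (λ v → ∃[ i ] P i v)
  definable-∃fin dP = definable-⇔
    (λ v → mk⇔ (λ h → byContradiction λ ¬∃ → h λ i Pi → ¬∃ (i , Pi)) (λ { (i , Pi) h → h i Pi }))
    (definable-¬ (definable-∀fin (definable-¬ ∘ dP)))

  record IsTerm (f : (X → Carrier) → Carrier) : Set ℓ where
    constructor _,_
    field
      term  : L-Term X
      value : ∀ v → eval term v ≈ f v
  open IsTerm

  isTerm-var : (x : X) → IsTerm (λ v → v x)
  isTerm-var x = var x , λ v → refl

  isTerm-ε : IsTerm {X} (λ v → ε)
  isTerm-ε = fun (inj₁ unit) (λ ()) , λ v → refl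

  isTerm-∙ : {f g : (X → Carrier) → Carrier} → IsTerm f → IsTerm g → IsTerm (λ v → f v ∙ g v)
  isTerm-∙ (t , t≈) (u , u≈) = fun (inj₁ mul) (λ { zero → t ; (suc zero) → u }) ,
    λ v → ∙-cong (t≈ v) (u≈ v)

  isTerm-⁻¹ : {f : (X → Carrier) → Carrier} → IsTerm f → IsTerm (λ v → f v ⁻¹)
  isTerm-⁻¹ (t , t≈) = fun (inj₁ inv) (λ { zero → t }) , λ v → ⁻¹-cong (t≈ v)

  definable-≈ : {f g : (X → Carrier) → Carrier} → IsTerm f → IsTerm g → Definable (λ v → f v ≈ g v)
  definable-≈ (t , t≈) (u , u≈) = t ≐ u , λ v → mk⇔
    (λ e → trans (t≈ v) (trans e (sym (u≈ v)))) (λ e → trans (sym (t≈ v)) (trans e (u≈ v)))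

  definable-∘ : {P : Pred (X → Carrier) p} → Definable P →
    {f : (Y → Carrier) → X → Carrier} → (∀ x → IsTerm (λ v → f v x)) → Definable (P ∘ f)
  definable-∘ {P = P} dP@(φ , P⇔φ) f-term = substFormula σ φ , λ v → mk⇔
    (λ h → from (⊨-subst σ φ) (to (P⇔φ _) (definable-resp dP (λ x → sym (value (f-term x) v)) h)))
    (λ h → definable-resp dP (λ x → value (f-term x) v) (from (P⇔φ _) (to (⊨-subst σ φ) h)))
    where
    σ = λ x → term (f-term x)

  rename : {P : Pred (X → Carrier) p} → Definable P → (ρ : X → Y) → Definable (λ v → P (v ∘ ρ))
  rename dP ρ = definable-∘ dP (isTerm-var ∘ ρ)

  definable-∃ : {P : Pred (Maybe X → Carrier) p} → Definable P →
                Definable (λ v → ∃[ c ] P (v ▸ c))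
  definable-∃ (φ , P⇔φ) = ∃′ tt φ , λ v → mk⇔
    (λ { (c , h) → c , to (P⇔φ _) h }) (λ { (c , h) → c , from (P⇔φ _) h })

  definable-∃ⁿ : {P : Pred (X ⊎ Fin n → Carrier) p} → Definable P →
                 Definable (λ v → ∃[ w ] P [ v , w ])
  definable-∃ⁿ {n = zero} {P = P} dP = definable-⇔
    (λ v → mk⇔ (λ h → (λ ()) , definable-resp dP (λ { (inj₁ x) → refl }) h)
               (λ { (w , h) → definable-resp dP (λ { (inj₁ x) → refl }) h }))
    (rename {Y = _} dP (λ { (inj₁ x) → x }))
  definable-∃ⁿ {X = X} {n = suc n} {P = P} dP = definable-⇔
    (λ v → mk⇔ (λ { (c , w , h) → cons c w , definable-resp dP (pointwise v c w) h })
               (λ { (w , h) → w zero , w ∘ suc , definable-resp dP (pointwise′ v w) h }))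
    (definable-∃ (definable-∃ⁿ (rename dP ρ)))
    where
    ρ : X ⊎ Fin (suc n) → Maybe X ⊎ Fin n
    ρ (inj₁ x)       = inj₁ (just x)
    ρ (inj₂ zero)    = inj₁ nothing
    ρ (inj₂ (suc i)) = inj₂ i
    cons : Carrier → (Fin n → Carrier) → Fin (suc n) → Carrier
    cons c w zero    = c
    cons c w (suc i) = w i
    pointwise : ∀ v c w x → [ v ▸ c , w ] (ρ x) ≈ [ v , cons c w ] x
    pointwise v c w (inj₁ x)       = refl
    pointwise v c w (inj₂ zero)    = refl
    pointwise v c w (inj₂ (suc i)) = refl
    pointwise′ : ∀ v (w : Fin (suc n) → Carrier) x → [ v , w ] x ≈ [ v ▸ w zero , w ∘ suc ] (ρ x)
    pointwise′ v w (inj₁ x)       = refl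
    pointwise′ v w (inj₂ zero)    = refl
    pointwise′ v w (inj₂ (suc i)) = refl

  definable-∀ⁿ : {P : Pred (X ⊎ Fin n → Carrier) p} → Definable P →
                 Definable (λ v → ∀ w → P [ v , w ])
  definable-∀ⁿ dP = definable-⇔
    (λ v → mk⇔ (λ h w → byContradiction λ ¬P → h (w , ¬P)) (λ { h (w , ¬P) → ¬P (h w) }))
    (definable-¬ (definable-∃ⁿ (definable-¬ dP)))

  -- Parameter tuples are indexed by `Fin`, while translated formulas have structured types of
  -- variables. Variables are renamed along `code` and tuples are filled in along `decode`.
  record Finite (Y : Set) : Set where
    field
      size     : ℕ
      code     : Y → Fin size
      decode   : Fin size → Y
      decode-code : ∀ y → decode (code y) ≡ y
  open Finite public

  finite-Fin : ∀ n → Finite (Fin n)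
  finite-Fin n = record { size = n ; code = id ; decode = id ; decode-code = λ _ → ≡.refl }

  finite-⊎ : Finite X → Finite Y → Finite (X ⊎ Y)
  finite-⊎ FX FY = record
    { size        = size FX ℕ.+ size FY
    ; code        = Fin.join _ _ ∘ Sum.map (code FX) (code FY)
    ; decode      = Sum.map (decode FX) (decode FY) ∘ Fin.splitAt (size FX)
    ; decode-code = λ
        { (inj₁ x) → ≡.trans (cong (Sum.map _ _) (Fin.splitAt-↑ˡ (size FX) (code FX x) (size FY)))
                             (cong inj₁ (decode-code FX x))
        ; (inj₂ y) → ≡.trans (cong (Sum.map _ _) (Fin.splitAt-↑ʳ (size FX) (size FY) (code FY y)))
                             (cong inj₂ (decode-code FY y)) }
    }

  finite-Σ : {F : Fin n → Set} → (∀ i → Finite (F i)) → Finite (Σ[ i ∈ Fin n ] F i)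
  finite-Σ {n = zero} FF = record
    { size = 0 ; code = λ () ; decode = λ () ; decode-code = λ () }
  finite-Σ {n = suc n} {F} FF = record
    { size        = size F⊎
    ; code        = λ { (zero , y) → code F⊎ (inj₁ y) ; (suc i , y) → code F⊎ (inj₂ (i , y)) }
    ; decode      = λ i → join (decode F⊎ i)
    ; decode-code = λ { (zero , y)  → cong join (decode-code F⊎ (inj₁ y))
                      ; (suc i , y) → cong join (decode-code F⊎ (inj₂ (i , y))) }
    }
    where
    F⊎ = finite-⊎ (FF zero) (finite-Σ (FF ∘ suc))
    join : F zero ⊎ (Σ[ i ∈ Fin n ] F (suc i)) → Σ[ i ∈ Fin (suc n) ] F i
    join (inj₁ y)       = zero , y
    join (inj₂ (i , y)) = suc i , y

  arityᵉᵠ : Sortᵉᵠ → ℕ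
  arityᵉᵠ (home _) = 1
  arityᵉᵠ (quot E) = DefinableEquivalence.arity E

  -- An element of an imaginary sort is represented by a real tuple, so a
  -- variable of that sort becomes a tuple of variables.
  Real : {X : Set} → (X → Sortᵉᵠ) → Set
  Real {X} Γ = Σ[ x ∈ X ] Fin (arityᵉᵠ (Γ x))

  components : ∀ s → ∣ s ∣ᵉᵠ → Fin (arityᵉᵠ s) → Carrier
  components (home _) c _ = c
  components (quot E) c   = c

  element : ∀ s → (Fin (arityᵉᵠ s) → Carrier) → ∣ s ∣ᵉᵠ
  element (home _) w = w zero
  element (quot E) w = w

  elements : (Γ : X → Sortᵉᵠ) → (Real Γ → Carrier) → Valuationᵉᵠ Γ
  elements Γ v x = element (Γ x) λ i → v (x , i)

  element-components : ∀ s c → element s (components s c) ≡ c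
  element-components (home _) c = ≡.refl
  element-components (quot E) c = ≡.refl

  element-cong : ∀ s {v w} → (∀ i → v i ≈ w i) →
                 Setoid._≈_ (carrierᵉᵠ s) (element s v) (element s w)
  element-cong (home _) v≈w = v≈w zero
  element-cong (quot E) v≈w = DefinableEquivalence.≋⇒∼ E v≈w

  module _ {X : Set} {Γ : X → Sortᵉᵠ} where
    open Semantics structureᵉᵠ using () renaming (eval to evalᵉᵠ)

    components-element : ∀ s w i → components s (element s w) i ≡ w i
    components-element (home _) w zero = ≡.refl
    components-element (quot E) w i    = ≡.refl

    isTerm-eval : ∀ {s} (t : Term languageᵉᵠ Γ s) i →
      IsTerm {Real Γ} (λ v → components s (evalᵉᵠ t (elements Γ v)) i)
    isTerm-eval (var x) i = var (x , i) , λ v → reflexive (≡.sym (components-element (Γ x) _ i))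
    isTerm-eval (fun (old f) ts) i = fun f (λ j → term (isTerm-eval (ts j) zero)) ,
      λ v → Structure.⟦⟧ᶠ-cong structure f λ j → value (isTerm-eval (ts j) zero) v
    -- The projection to a quotient is the identity on representatives.
    isTerm-eval (fun (proj E) ts) i = isTerm-eval (ts i) zero

  definable-≈ᵉᵠ : ∀ s {f g : (X → Carrier) → ∣ s ∣ᵉᵠ} →
    (∀ i → IsTerm (λ v → components s (f v) i)) → (∀ i → IsTerm (λ v → components s (g v) i)) →
    Definable (λ v → Setoid._≈_ (carrierᵉᵠ s) (f v) (g v))
  definable-≈ᵉᵠ (home _) f-term g-term = definable-≈ (f-term zero) (g-term zero)
  definable-≈ᵉᵠ (quot E) f-term g-term =
    definable-⇔ (λ v → mk⇔ id id) (definable-∘ (definable-formula (DefinableEquivalence.formula E))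
      {f = λ v → [ _ , _ ]} λ { (inj₁ i) → f-term i ; (inj₂ i) → g-term i })

  -- The usual elimination of imaginary sorts: quantifiers over classes become quantifiers over
  -- representatives, and equality of classes becomes the formula of the equivalence relation.
  definableᵉᵠ : {Γ : X → Sortᵉᵠ} (φ : Formula languageᵉᵠ Γ) →
                Definable {Real Γ} (λ v → elements Γ v ⊨ᵉᵠ φ)
  definableᵉᵠ (_≐_ {s} t u) = definable-≈ᵉᵠ s (isTerm-eval t) (isTerm-eval u)
  definableᵉᵠ (rel R ts) = rel R (λ i → term (isTerm-eval (ts i) zero)) , λ v → mk⇔
    (⟦⟧ᴿ-resp R λ i → sym (value (isTerm-eval (ts i) zero) v))
    (⟦⟧ᴿ-resp R λ i → value (isTerm-eval (ts i) zero) v)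
  definableᵉᵠ (¬′ φ)   = definable-¬ (definableᵉᵠ φ)
  definableᵉᵠ (φ ∧′ ψ) = definable-× (definableᵉᵠ φ) (definableᵉᵠ ψ)
  definableᵉᵠ {X = X} {Γ = Γ} (∃′ s φ) = definable-⇔
    (λ v → mk⇔ (λ { (w , h) → element s w , resp φ (≋w v w) h })
               (λ { (c , h) → components s c , resp φ (≋c v c) h }))
    (definable-∃ⁿ {n = arityᵉᵠ s} (rename (definableᵉᵠ φ) ρ))
    where
    open Semantics structureᵉᵠ using () renaming (_▸_ to _▸ᵉᵠ_; ⊨-resp-≋ to resp)
    ρ : Real (maybe Γ s) → Real Γ ⊎ Fin (arityᵉᵠ s)
    ρ (nothing , i) = inj₂ i
    ρ (just x , i)  = inj₁ (x , i)
    ≋w : ∀ v w x → Setoid._≈_ (carrierᵉᵠ (maybe Γ s x))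
                     (elements (maybe Γ s) ([ v , w ] ∘ ρ) x) ((elements Γ v ▸ᵉᵠ element s w) x)
    ≋w v w nothing  = Setoid.refl (carrierᵉᵠ s)
    ≋w v w (just x) = Setoid.refl (carrierᵉᵠ (Γ x))
    ≋c : ∀ v c x → Setoid._≈_ (carrierᵉᵠ (maybe Γ s x))
                     ((elements Γ v ▸ᵉᵠ c) x) (elements (maybe Γ s) ([ v , components s c ] ∘ ρ) x)
    ≋c v c nothing  = Setoid.reflexive (carrierᵉᵠ s) (≡.sym (element-components s c))
    ≋c v c (just x) = Setoid.refl (carrierᵉᵠ (Γ x))

-- Uniformity by compactness

atoms : {A : Set a} → BooleanCombination A → List A
atoms (atom c) = c ∷ []
atoms (B ∩′ C) = atoms B ++ atoms C
atoms (∁′ B)   = atoms B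

⟦⟧ᴮ-cong : {A : Set a} {X : Set b} (B : BooleanCombination A) {D : A → Pred X p} {x y : X} →
           All (λ c → D c x ⇔ D c y) (atoms B) → ⟦ B ⟧ᴮ D x ⇔ ⟦ B ⟧ᴮ D y
⟦⟧ᴮ-cong (atom c) (e ∷ []) = e
⟦⟧ᴮ-cong (B ∩′ C) es with bs , cs ← All.++⁻ (atoms B) es = mk⇔
  (λ { (h , k) → to (⟦⟧ᴮ-cong B bs) h , to (⟦⟧ᴮ-cong C cs) k })
  (λ { (h , k) → from (⟦⟧ᴮ-cong B bs) h , from (⟦⟧ᴮ-cong C cs) k })
⟦⟧ᴮ-cong (∁′ B) es = mk⇔ (_∘ from (⟦⟧ᴮ-cong B es)) (_∘ to (⟦⟧ᴮ-cong B es))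

module Uniformity (em : ∀ {a} → ExcludedMiddle a) (G : ExpandedGroup ℓ)
                  (saturated : ModelTheory.Saturated G) (oneBased : ModelTheory.OneBased G)
                  (m : ℕ) where
  open Classical em
  open ExpandedGroup G using (Carrier; structure; language; power; _≈_; reflexive)
  open ModelTheory G
  open Definability em G
  open Imaginaries structure using (Sortᵉᵠ; home; carrierᵉᵠ; Valuationᵉᵠ; _⊨ᵉᵠ_; structureᵉᵠ; languageᵉᵠ)
  open Semantics structureᵉᵠ using () renaming (⊨-resp-≋ to ⊨ᵉᵠ-resp-≋)
  open Structure structureᵉᵠ using () renaming (_≋_ to _≋ᵉᵠ_)
  open Group (power m) using (_∙_; _⁻¹; ε) renaming (reflexive to ≈-reflexive)
  open Subgroups (power m) using (leftCoset; IsSubgroup; module IsSubgroup)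
  open Cosets em (power m) using (Agree)

  -- A uniformly definable family of subgroups together with a definable
  -- set of parameters that has only finitely many members in the family.
  record Scheme : Set (Level.suc ℓ) where
    field
      size       : ℕ
      Good       : Pred (Tuple size) ℓ
      Member     : Tuple m → Tuple size → Set ℓ
      good-def   : Definable Good
      member-def : Definable (λ v → Member (v ∘ inj₁) (v ∘ inj₂))
      count      : ℕ
      instances  : Fin count → AclᵉᵠSubgroup m
      complete   : ∀ z → Good z → ∃[ j ] ∀ y → subset (instances j) y ⇔ Member y z

  module _ (H : AclᵉᵠSubgroup m) where
    open IsAclᵉᵠ∅Definable (AclᵉᵠSubgroup.isDefinable H)
      renaming (arity to n; paramSorts to s; params to e; formula to θ; defines to H⇔θ)

    private
      finiteReal : Finite (Real s)
      finiteReal = finite-Σ λ j → finite-Fin (arityᵉᵠ (s j))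

      χ : ∀ j → Formula languageᵉᵠ {⊤} (const (s j))
      χ j = proj₁ (algebraic j)

      parameters : Tuple (size finiteReal) → Valuationᵉᵠ s
      parameters z = elements s (z ∘ code finiteReal)

      Member : Tuple m → Tuple (size finiteReal) → Set ℓ
      Member y z = [ y , parameters z ] ⊨ᵉᵠ θ

      Algebraic : Pred (Tuple (size finiteReal)) ℓ
      Algebraic z = ∀ j → const (parameters z j) ⊨ᵉᵠ χ j

      -- First-order conditions on z under which θ with these parameters defines a subgroup over
      -- algebraic imaginaries again. Compatibility with equality is automatic for a definable set.
      Good : Pred (Tuple (size finiteReal)) ℓ
      Good z = Algebraic z × Member ε z ×
        (∀ x y → Member x z → Member y z → Member (x ∙ y) z) ×
        (∀ x → Member x z → Member (x ⁻¹) z)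

      sorts : Fin m ⊎ Fin n → Sortᵉᵠ
      sorts = [ (λ _ → home tt) , s ]

      point : Tuple m → Valuationᵉᵠ s → Valuationᵉᵠ sorts
      point y e = [ y , e ]

      member-def : Definable (λ v → Member (v ∘ inj₁) (v ∘ inj₂))
      member-def = definable-⇔
        (λ v → mk⇔ (⊨ᵉᵠ-resp-≋ θ (same v)) (⊨ᵉᵠ-resp-≋ θ λ x → Setoid.sym (carrierᵉᵠ (sorts x)) (same v x)))
        (rename (definableᵉᵠ {Γ = sorts} θ) ρ)
        where
        ρ : Real sorts → Fin m ⊎ Fin (size finiteReal)
        ρ (inj₁ i , _) = inj₁ i
        ρ (inj₂ j , k) = inj₂ (code finiteReal (j , k))
        same : ∀ v x → Setoid._≈_ (carrierᵉᵠ (sorts x)) (elements sorts (v ∘ ρ) x)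
                         (point (v ∘ inj₁) (parameters (v ∘ inj₂)) x)
        same v (inj₁ i) = Setoid.refl (carrierᵉᵠ (sorts (inj₁ i)))
        same v (inj₂ j) = Setoid.refl (carrierᵉᵠ (s j))

      algebraic-def : Definable Algebraic
      algebraic-def = definable-∀fin λ j →
        rename (definableᵉᵠ (χ j)) (λ { (_ , k) → code finiteReal (j , k) })

      member-at : ∀ {X : Set} {f : (X → Carrier) → Tuple m} (ρ : Fin (size finiteReal) → X) →
        (∀ i → IsTerm (λ v → f v i)) → Definable (λ v → Member (f v) (v ∘ ρ))
      member-at {f = f} ρ f-term = definable-∘ member-def {f = λ v → [ f v , v ∘ ρ ]}
        λ { (inj₁ i) → f-term i ; (inj₂ j) → isTerm-var (ρ j) }

      good-def : Definable Good
      good-def = definable-× algebraic-def (definable-×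
        (member-at id λ _ → isTerm-ε) (definable-×
        (definable-∀ⁿ {P = λ u → ∀ y → Member (u ∘ inj₂) (u ∘ inj₁) → Member y (u ∘ inj₁) →
                         Member (u ∘ inj₂ ∙ y) (u ∘ inj₁)}
          (definable-∀ⁿ {P = λ u → Member (u ∘ inj₁ ∘ inj₂) (u ∘ inj₁ ∘ inj₁) →
                           Member (u ∘ inj₂) (u ∘ inj₁ ∘ inj₁) →
                           Member (u ∘ inj₁ ∘ inj₂ ∙ u ∘ inj₂) (u ∘ inj₁ ∘ inj₁)}
            (definable-→ (member-at (inj₁ ∘ inj₁) λ i → isTerm-var _)
            (definable-→ (member-at (inj₁ ∘ inj₁) λ i → isTerm-var _)
              (member-at (inj₁ ∘ inj₁) λ i → isTerm-∙ (isTerm-var _) (isTerm-var _))))))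
        (definable-∀ⁿ {P = λ u → Member (u ∘ inj₂) (u ∘ inj₁) → Member ((u ∘ inj₂) ⁻¹) (u ∘ inj₁)}
          (definable-→ (member-at inj₁ λ i → isTerm-var _)
            (member-at inj₁ λ i → isTerm-⁻¹ (isTerm-var _))))))

      toSubgroup : ∀ z → Good z → AclᵉᵠSubgroup m
      toSubgroup z (alg , ε∈ , ∙∈ , ⁻¹∈) = record
        { subset      = λ y → Member y z
        ; isSubgroup  = record
          { resp-≈    = λ x≈y → definable-resp member-def {[ _ , z ]} {[ _ , z ]}
                          λ { (inj₁ i) → x≈y i ; (inj₂ j) → reflexive ≡.refl }
          ; ε-closed  = ε∈
          ; ∙-closed  = ∙∈ _ _
          ; ⁻¹-closed = ⁻¹∈ _
          }
        ; isDefinable = record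
          { arity      = n
          ; paramSorts = s
          ; params     = parameters z
          ; algebraic  = λ j → χ j , alg j , proj₂ (proj₂ (algebraic j))
          ; formula    = θ
          ; defines    = λ y → mk⇔ id id
          }
        }

      -- Conjugates in the sense of field theory: the list contains all solutions of the algebraic
      -- formula of the j-th parameter.
      conjugates : ∀ j → List (Setoid.Carrier (carrierᵉᵠ (s j)))
      conjugates j = proj₁ (proj₂ (proj₂ (algebraic j)))

      bound : ∃[ b ] ∀ j → length (conjugates j) ℕ.≤ b
      bound = bounded (length ∘ conjugates)

      index : ∀ z → Good z → ∀ j → Any (Setoid._≈_ (carrierᵉᵠ (s j)) (parameters z j)) (conjugates j)
      index z (alg , _) j = proj₂ (proj₂ (proj₂ (algebraic j))) (parameters z j) (alg j)

      position : ∀ z → Good z → Fin n → Fin (proj₁ bound)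
      position z g j = Fin.inject≤ (Any.index (index z g j)) (proj₂ bound j)

      same-position : ∀ {z z′} g g′ → funToFin (position z g) ≡ funToFin (position z′ g′) →
                      ∀ j → Setoid._≈_ (carrierᵉᵠ (s j)) (parameters z j) (parameters z′ j)
      same-position {z} {z′} g g′ eq j =
        trans (Any.lookup-index (index z g j))
          (trans (reflexive′ (cong (lookup (conjugates j)) indices))
                 (sym (Any.lookup-index (index z′ g′ j))))
        where
        open Setoid (carrierᵉᵠ (s j)) using (trans; sym) renaming (reflexive to reflexive′)
        indices : Any.index (index z g j) ≡ Any.index (index z′ g′ j)
        indices = Fin.inject≤-injective _ _ _ _ (≡.trans
          (≡.sym (Fin.finToFun-funToFin (position z g) j))
          (≡.trans (cong (λ σ → finToFun σ j) eq) (Fin.finToFun-funToFin (position z′ g′) j)))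

      At : Fin (proj₁ bound ℕ.^ n) → Set ℓ
      At σ = ∃[ z ] Σ[ g ∈ Good z ] funToFin (position z g) ≡ σ

      instance-at : ∀ σ → Dec (At σ) → AclᵉᵠSubgroup m
      instance-at σ (yes (z , g , _)) = toSubgroup z g
      -- No good tuple has this position; H is a filler.
      instance-at σ (no _)            = H

      complete : ∀ z (g : Good z) (at : Dec (At (funToFin (position z g)))) y →
                 subset (instance-at _ at) y ⇔ Member y z
      complete z g (yes (z′ , g′ , eq)) y = mk⇔ (⊨ᵉᵠ-resp-≋ θ (same eq)) (⊨ᵉᵠ-resp-≋ θ (same′ eq))
        where
        same : funToFin (position z′ g′) ≡ funToFin (position z g) →
               ∀ x → Setoid._≈_ (carrierᵉᵠ (sorts x)) (point y (parameters z′) x) (point y (parameters z) x)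
        same eq (inj₁ i) = Setoid.refl (carrierᵉᵠ (sorts (inj₁ i)))
        same eq (inj₂ j) = same-position {z′} {z} g′ g eq j
        same′ : funToFin (position z′ g′) ≡ funToFin (position z g) →
               ∀ x → Setoid._≈_ (carrierᵉᵠ (sorts x)) (point y (parameters z) x) (point y (parameters z′) x)
        same′ eq x = Setoid.sym (carrierᵉᵠ (sorts x)) (same eq x)
      complete z g (no ∄) y = contradiction (z , g , ≡.refl) ∄

    -- Up to equality in its sort each parameter has boundedly many values. Their positions in the
    -- lists of solutions determine the subgroup, so one instance per vector of positions is enough.
    subgroup-scheme : Scheme
    subgroup-scheme = record
      { size       = size finiteReal
      ; Good       = Good
      ; Member     = Member
      ; good-def   = good-def
      ; member-def = member-def
      ; instances  = λ σ → instance-at σ em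
      ; complete   = λ z g → funToFin (position z g) , complete z g em
      }

    subgroup-scheme-complete : ∃[ z ] Scheme.Good subgroup-scheme z ×
                               (∀ y → subset H y ⇔ Scheme.Member subgroup-scheme y z)
    subgroup-scheme-complete = z₀ ,
      ((λ j → ⊨ᵉᵠ-resp-≋ (χ j) (λ _ → Setoid.sym (carrierᵉᵠ (s j)) (z₀≋e j))
                (proj₁ (proj₂ (algebraic j)))) ,
        to (H⇔ ε) ε-closed ,
        (λ x y x∈ y∈ → to (H⇔ (x ∙ y)) (∙-closed (from (H⇔ x) x∈) (from (H⇔ y) y∈))) ,
        (λ x x∈ → to (H⇔ (x ⁻¹)) (⁻¹-closed (from (H⇔ x) x∈)))) ,
      H⇔
      where
      open IsSubgroup (AclᵉᵠSubgroup.isSubgroup H)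
      z₀ : Tuple (size finiteReal)
      z₀ i = let j , k = decode finiteReal i in components (s j) (e j) k
      z₀≋e : ∀ j → Setoid._≈_ (carrierᵉᵠ (s j)) (parameters z₀ j) (e j)
      z₀≋e j = Setoid.trans (carrierᵉᵠ (s j))
        (element-cong (s j) λ k → reflexive (cong (λ { (j , k) → components (s j) (e j) k })
          (decode-code finiteReal (j , k))))
        (Setoid.reflexive (carrierᵉᵠ (s j)) (element-components (s j) (e j)))
      same : ∀ y x → Setoid._≈_ (carrierᵉᵠ (sorts x)) (point y (parameters z₀) x) (point y e x)
      same y (inj₁ i) = Setoid.refl (carrierᵉᵠ (sorts (inj₁ i)))
      same y (inj₂ j) = z₀≋e j
      H⇔ : ∀ y → subset H y ⇔ Member y z₀
      H⇔ y = mk⇔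
        (λ h → ⊨ᵉᵠ-resp-≋ θ (λ x → Setoid.sym (carrierᵉᵠ (sorts x)) (same y x)) (to (H⇔θ y) h))
        (λ h → from (H⇔θ y) (⊨ᵉᵠ-resp-≋ θ (same y) h))

  open Scheme

  Family : Set (Level.suc ℓ)
  Family = ∃[ r ] (Fin r → AclᵉᵠSubgroup m)

  infixr 5 _⊕_
  _⊕_ : Family → Family → Family
  (r , L) ⊕ (s , M) = r ℕ.+ s , [ L , M ] ∘ Fin.splitAt r

  -- For a suitable choice of one coset of each member of the family, E
  -- relates any two points lying in the same ones of these cosets.
  record Captures (F : Family) (E : Tuple m → Tuple m → Set p) : Set (ℓ ⊔ p) where
    constructor _,_
    field
      reps     : Fin (proj₁ F) → Tuple m
      captures : ∀ {x y} → Agree (subset ∘ proj₂ F) reps x y → E x y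

  captures-map : ∀ {F} {E : Tuple m → Tuple m → Set p} {E′ : Tuple m → Tuple m → Set q} →
                 (∀ {x y} → E x y → E′ x y) → Captures F E → Captures F E′
  captures-map E⇒E′ (c , h) = c , λ agree → E⇒E′ (h agree)

  captures-⊕ : ∀ F F′ {E : Tuple m → Tuple m → Set p} {E′ : Tuple m → Tuple m → Set q} →
               Captures F E → Captures F′ E′ → Captures (F ⊕ F′) (λ x y → E x y × E′ x y)
  captures-⊕ (r , L) (s , M) (c , h) (d , k) = [ c , d ] ∘ Fin.splitAt r , λ {x} {y} agree →
    h (λ j → subst (λ i → Same x y i) (Fin.splitAt-↑ˡ r j s) (agree (j Fin.↑ˡ s))) ,
    k (λ j → subst (λ i → Same x y i) (Fin.splitAt-↑ʳ r s j) (agree (r Fin.↑ʳ j)))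
    where
    Same : Tuple m → Tuple m → Fin r ⊎ Fin s → Set ℓ
    Same x y i = (x ∈ leftCoset ([ c , d ] i) (subset ([ L , M ] i))) ⇔
                 (y ∈ leftCoset ([ c , d ] i) (subset ([ L , M ] i)))

  captures-⊤ : ∀ F → Captures F (λ _ _ → ⊤ {ℓ})
  captures-⊤ F = (λ _ → ε) , _

  -- The first-order counterpart of `Captures`. Each scheme contributes quantifiers over good
  -- parameters z and a coset representative c, and E collects the agreements required so far.
  Determined : List Scheme → (Tuple m → Tuple m → Set ℓ) → Pred (Tuple m) ℓ → Set ℓ
  Determined []      E P = ∀ x y → E x y → P x → P y
  Determined (D ∷ C) E P = ∃[ z ] Good D z × ∃[ c ]
    Determined C (λ x y → E x y × (Member D (c ⁻¹ ∙ x) z ⇔ Member D (c ⁻¹ ∙ y) z)) P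

  definable-Determined : ∀ {X : Set} C
    {E : (X → Carrier) → Tuple m → Tuple m → Set ℓ} {P : (X → Carrier) → Pred (Tuple m) ℓ} →
    Definable {X ⊎ (Fin m ⊎ Fin m)} (λ v → E (v ∘ inj₁) (v ∘ inj₂ ∘ inj₁) (v ∘ inj₂ ∘ inj₂)) →
    Definable {X ⊎ Fin m} (λ v → P (v ∘ inj₁) (v ∘ inj₂)) →
    Definable (λ v → Determined C (E v) (P v))
  definable-Determined [] {E} {P} dE dP = definable-∀ⁿ
    {P = λ u → ∀ y → E (u ∘ inj₁) (u ∘ inj₂) y → P (u ∘ inj₁) (u ∘ inj₂) → P (u ∘ inj₁) y}
    (definable-∀ⁿ {P = λ u → E (u ∘ inj₁ ∘ inj₁) (u ∘ inj₁ ∘ inj₂) (u ∘ inj₂) →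
                             P (u ∘ inj₁ ∘ inj₁) (u ∘ inj₁ ∘ inj₂) → P (u ∘ inj₁ ∘ inj₁) (u ∘ inj₂)}
      (definable-→ (rename dE [ inj₁ ∘ inj₁ , [ inj₁ ∘ inj₂ , inj₂ ] ])
      (definable-→ (rename dP [ inj₁ ∘ inj₁ , inj₁ ∘ inj₂ ])
                   (rename dP [ inj₁ ∘ inj₁ , inj₂ ]))))
  definable-Determined {X} (D ∷ C) {E} {P} dE dP = definable-∃ⁿ
    {P = λ u → Good D (u ∘ inj₂) × ∃[ c ] Determined C (E′ [ u , c ]) (P (u ∘ inj₁))}
    (definable-× (rename (good-def D) inj₂)
      (definable-∃ⁿ {P = λ u → Determined C (E′ u) (P (u ∘ inj₁ ∘ inj₁))}
        (definable-Determined C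
          (definable-× (rename dE [ inj₁ ∘ inj₁ ∘ inj₁ , inj₂ ])
            (definable-iff (member-translate inj₁) (member-translate inj₂)))
          (rename dP [ inj₁ ∘ inj₁ ∘ inj₁ , inj₂ ]))))
    where
    E′ : ((X ⊎ Fin (size D)) ⊎ Fin m → Carrier) → Tuple m → Tuple m → Set ℓ
    E′ u x y = E (u ∘ inj₁ ∘ inj₁) x y ×
      (Member D ((u ∘ inj₂) ⁻¹ ∙ x) (u ∘ inj₁ ∘ inj₂) ⇔ Member D ((u ∘ inj₂) ⁻¹ ∙ y) (u ∘ inj₁ ∘ inj₂))
    member-translate : (ι : Fin m → Fin m ⊎ Fin m) →
      Definable {((X ⊎ Fin (size D)) ⊎ Fin m) ⊎ (Fin m ⊎ Fin m)}
        (λ w → Member D ((w ∘ inj₁ ∘ inj₂) ⁻¹ ∙ (w ∘ inj₂ ∘ ι)) (w ∘ inj₁ ∘ inj₁ ∘ inj₂))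
    member-translate ι = definable-∘ (member-def D)
      {f = λ w → [ (w ∘ inj₁ ∘ inj₂) ⁻¹ ∙ (w ∘ inj₂ ∘ ι) , w ∘ inj₁ ∘ inj₁ ∘ inj₂ ]}
      λ { (inj₁ i) → isTerm-∙ (isTerm-⁻¹ (isTerm-var _)) (isTerm-var _) ; (inj₂ j) → isTerm-var _ }

  instancesOf : List Scheme → Family
  instancesOf []      = 0 , λ ()
  instancesOf (D ∷ C) = (count D , instances D) ⊕ instancesOf C

  captures-Determined : ∀ C {E P} → Determined C E P →
    Captures (instancesOf C) (λ x y → E x y → x ∈ P → y ∈ P)
  captures-Determined [] det = (λ ()) , λ _ → det _ _
  captures-Determined (D ∷ C) (z , good , c , det) with j , H⇔ ← complete D z good =
    captures-map (λ { (same , h) e → h (e , same) })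
      (captures-⊕ (count D , instances D) (instancesOf C)
        -- The instance j depends on z, so the family contains all instances of the scheme, and c
        -- represents a coset of each of them.
        ((λ _ → c) , λ agree → mk⇔
          (to (H⇔ _) ∘ to (agree j) ∘ from (H⇔ _)) (to (H⇔ _) ∘ from (agree j) ∘ from (H⇔ _)))
        (captures-Determined C det))

  determined-by-cosets : (cs : List (Tuple m × AclᵉᵠSubgroup m)) → ∀ {E P} →
    (∀ {x y} → E x y → All (λ { (g , H) → x ∈ leftCoset g (subset H) ⇔ y ∈ leftCoset g (subset H) }) cs →
               x ∈ P → y ∈ P) →
    Determined (map (subgroup-scheme ∘ proj₂) cs) E P
  determined-by-cosets [] h x y e = h e []
  determined-by-cosets ((g , H) ∷ cs) h with z , good , H⇔ ← subgroup-scheme-complete H =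
    z , good , g , determined-by-cosets cs λ { (e , same) sames →
      h e (mk⇔ (from (H⇔ _) ∘ to same ∘ to (H⇔ _)) (from (H⇔ _) ∘ from same ∘ to (H⇔ _)) ∷ sames) }

  module _ {p : ℕ} (φ : L-Formula (Fin m ⊎ Fin p)) where

    private
      Fibre : Tuple p → Pred (Tuple m) ℓ
      Fibre a y = [ y , a ] ⊨ φ

      Φ : List Scheme → Pred (Tuple p) ℓ
      Φ C a = Determined C (λ _ _ → ⊤) (Fibre a)

      ¬Φ-def : ∀ C → Definable {Fin p ⊎ Fin 0} (λ v → ¬ Φ C (v ∘ inj₁))
      ¬Φ-def C = definable-¬ (rename
        (definable-Determined C {E = λ _ _ _ → ⊤} {P = λ a y → [ y , a ] ⊨ φ} definable-⊤
        (definable-⇔ (λ v → mk⇔ (⊨-resp φ λ { (inj₁ _) → refl′ ; (inj₂ _) → refl′ })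
                                (⊨-resp φ λ { (inj₁ _) → refl′ ; (inj₂ _) → refl′ }))
          (rename (definable-formula φ) [ inj₂ , inj₁ ]))) inj₁)
        where
        open Semantics structure using () renaming (⊨-resp-≋ to ⊨-resp)
        refl′ : ∀ {x : Carrier} → x ≈ x
        refl′ = reflexive ≡.refl

      ∅-tuple : Tuple 0
      ∅-tuple ()

      ψ : List Scheme → ParamFormula p
      ψ C = formula (¬Φ-def C) ⟨ ∅-tuple ⟩

      ψ⇔ : ∀ C a → a ∈ ⟦ ψ C ⟧ ⇔ (¬ Φ C a)
      ψ⇔ C a = mk⇔ (from (defines (¬Φ-def C) [ a , ∅-tuple ])) (to (defines (¬Φ-def C) [ a , ∅-tuple ]))

      -- The quantifier over the algebraic parameters makes this a type
      -- over ∅.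
      π : PartialType p
      π χ = resize ℓ (∃[ C ] χ ≡ ψ C)

      -- This is where one-basedness enters: the cosets in a boolean combination for the fibre of a
      -- provide the schemes.
      some-Φ : ∀ a → ∃[ C ] Φ C a
      some-Φ a with B , φ⇔B ← oneBased m (φ ⟨ a ⟩) =
        map (subgroup-scheme ∘ proj₂) (atoms B) , determined-by-cosets (atoms B) λ {x} {y} _ sames h →
          from (φ⇔B y) (to (⟦⟧ᴮ-cong B sames) (to (φ⇔B x) h))

      no-params : ∀ {χ} → ∃[ C ] χ ≡ ψ C → (j : Fin (ParamFormula.arity χ)) →
        Σ[ i ∈ ℕ ⊎ (ExpandedGroup.Fun G ⊎ ExpandedGroup.Rel G) ] ParamFormula.params χ j ≡ ExpandedGroup.ε G
      no-params (C , ≡.refl) ()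

      -- A realisation would contradict `some-Φ`. The formulas of π contain no parameters, so a
      -- constant sequence serves for saturation.
      π-inconsistent : ¬ Consistent π
      π-inconsistent con with a , real ← saturated (λ _ → ExpandedGroup.ε G) π
          (λ χ πχ → no-params (resize⁻ πχ)) con
        with C , ΦC ← some-Φ a =
        to (ψ⇔ C a) (real (ψ C) (resize⁺ (C , ≡.refl))) ΦC

      -- A tuple that fails the listed negations satisfies Φ C for one of the listed C. Which one
      -- depends on a, so the families are all joined, the others entering with arbitrary cosets.
      collect : ∀ {ψs} → All π ψs →
        Σ[ F ∈ Family ] (∀ a → ¬ All (λ ψ → a ∈ ⟦ ψ ⟧) ψs → Captures F (λ x y → x ∈ Fibre a → y ∈ Fibre a))
      collect [] = (0 , λ ()) , λ a ¬all → contradiction [] ¬all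
      collect {χ ∷ ψs} (πχ ∷ πψs) with C , eq ← resize⁻ πχ | F , h ← collect πψs =
        instancesOf C ⊕ F , captures
        where
        captures : ∀ a → ¬ All (λ ψ → a ∈ ⟦ ψ ⟧) (χ ∷ ψs) →
                   Captures (instancesOf C ⊕ F) (λ x y → x ∈ Fibre a → y ∈ Fibre a)
        captures a ¬all with em {P = Φ C a}
        ... | yes ΦC = captures-map (λ { (k , _) → k _ })
                (captures-⊕ (instancesOf C) F (captures-Determined C ΦC) (captures-⊤ F))
        ... | no ¬ΦC = captures-map proj₂ (captures-⊕ (instancesOf C) F (captures-⊤ (instancesOf C))
                (h a λ all → ¬all (subst (λ χ → a ∈ ⟦ χ ⟧) (≡.sym eq) (from (ψ⇔ C a) ¬ΦC) ∷ all)))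

    opaque
      -- An inconsistent finite part of π names finitely many lists of schemes, and every fibre is
      -- determined by one of them.
      uniform : Σ[ F ∈ Family ] (∀ a → Captures F (λ x y → [ x , a ] ⊨ φ → [ y , a ] ⊨ φ))
      uniform with ψs , h ← ¬∀⇒∃¬ π-inconsistent with πψs , h′ ← ¬∀⇒∃¬ h
        with F , captures ← collect πψs = F , λ a → captures a λ all → h′ (a , all)

-- Bounds by the breadth

funToFin-cong : ∀ {m n} {f g : Fin m → Fin n} → (∀ i → f i ≡ g i) → funToFin f ≡ funToFin g
funToFin-cong {zero}  f≗g = ≡.refl
funToFin-cong {suc m} f≗g = ≡.cong₂ Fin.combine (f≗g zero) (funToFin-cong (f≗g ∘ suc))

finToFun-injective : ∀ {m n} {σ τ : Fin (n ℕ.^ m)} →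
  (∀ i → finToFun {n} {m} σ i ≡ finToFun {n} {m} τ i) → σ ≡ τ
finToFun-injective {m} {n} {σ} {τ} eq = ≡.trans (≡.sym (Fin.funToFin-finToFin {m} {n} σ))
  (≡.trans (funToFin-cong eq) (Fin.funToFin-finToFin {m} {n} τ))

module Enumeration (em : ∀ {a} → ExcludedMiddle a) where
  open Classical em

  enumerate : {A : Set a} (P : Pred A p) → ∀ k →
    (Σ[ s ∈ (Fin k → A) ] Injective _≡_ _≡_ s × (∀ i → P (s i))) ⊎
    (∃[ xs ] length xs ℕ.< k × (∀ {x} → P x → x ∈ₗ xs))
  enumerate P zero = inj₁ ((λ ()) , (λ { {()} }) , λ ())
  enumerate P (suc k) with enumerate P k
  ... | inj₂ (xs , <k , cover) = inj₂ (xs , ℕ.m<n⇒m<1+n <k , cover)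
  ... | inj₁ (s , s-inj , Ps) with em {P = ∃[ x ] P x × ∀ i → s i ≢ x}
  ...   | yes (x , Px , new) = inj₁ (s′ , s′-inj , Ps′)
    where
    s′ : Fin (suc k) → _
    s′ zero    = x
    s′ (suc i) = s i
    s′-inj : Injective _≡_ _≡_ s′
    s′-inj {zero}  {zero}  eq = ≡.refl
    s′-inj {zero}  {suc j} eq = contradiction (≡.sym eq) (new j)
    s′-inj {suc i} {zero}  eq = contradiction eq (new i)
    s′-inj {suc i} {suc j} eq = cong suc (s-inj eq)
    Ps′ : ∀ i → P (s′ i)
    Ps′ zero    = Px
    Ps′ (suc i) = Ps i
  ...   | no none = inj₂ (tabulate s , ℕ.s≤s (ℕ.≤-reflexive (length-tabulate s)) , λ {x} Px →
    let i , eq = byContradiction {P = ∃[ i ] s i ≡ x} λ ¬hit → none (x , Px , λ i eq → ¬hit (i , eq))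
    in subst (_∈ₗ tabulate s) eq (∈-tabulate⁺ i))

  -- Greedy choice: the list `history` of earlier terms is not a cover, so the next term can be
  -- taken outside it.
  separated : {A : Set a} (P : Pred A p) (R : A → A → Set q) →
    (∀ gs → ¬ (∀ x → P x → Any (λ g → R g x) gs)) →
    Σ[ s ∈ (ℕ → A) ] (∀ n → P (s n)) × (∀ {i j} → i ℕ.< j → ¬ R (s i) (s j))
  separated {A = A} P R unbounded = s , proj₁ ∘ next-spec ∘ history , λ {i} {j} i<j Rij →
    proj₂ (next-spec (history j)) (earlier (ℕ.≤⇒≤′ i<j) Rij)
    where
    next-exists : ∀ gs → ∃[ x ] P x × ¬ Any (λ g → R g x) gs
    next-exists gs with x , h ← ¬∀⇒∃¬ (unbounded gs) =
      x , byContradiction (λ ¬Px → h λ Px → contradiction Px ¬Px) , λ any → h λ _ → any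
    next : List A → A
    next gs = proj₁ (next-exists gs)
    next-spec : ∀ gs → P (next gs) × ¬ Any (λ g → R g (next gs)) gs
    next-spec gs = proj₂ (next-exists gs)
    history : ℕ → List A
    history zero    = []
    history (suc n) = next (history n) ∷ history n
    s : ℕ → A
    s n = next (history n)
    earlier : ∀ {i j x} → i ℕ.<′ j → R (s i) x → Any (λ g → R g x) (history j)
    earlier ℕ.<′-base        Rix = here Rix
    earlier (ℕ.≤′-step i<j) Rix = there (earlier i<j Rix)

module Main (em : ∀ {a} → ExcludedMiddle a) (G : ExpandedGroup ℓ)
            (saturated : ModelTheory.Saturated G) (oneBased : ModelTheory.OneBased G)
            (m : ℕ) where
  open Classical em
  open Enumeration em
  open ExpandedGroup G using (Carrier; structure; language; power; _≈_; reflexive)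
  open ModelTheory G
  open Definability em G
  open Densities em
  open Semantics structure using () renaming (⊨-resp-≋ to ⊨-resp)
  open Group (power m) using (_∙_; _⁻¹; ε) renaming (_≈_ to _≋_)
  open Subgroups (power m) using (leftCoset; IsSubgroup; module IsSubgroup)
  open Cosets em (power m)
  open Uniformity em G saturated oneBased m
  open Independence em (power m) {A = AclᵉᵠSubgroup m} subset AclᵉᵠSubgroup.isSubgroup
    hiding (⋂)

  private
    isSubgroup : ∀ H → IsSubgroup (subset {m} H)
    isSubgroup = AclᵉᵠSubgroup.isSubgroup

  -- Parameters of G may be hidden in encode.
  record DefinableFamily (R : Tuple m → Tuple m → Set p) : Set (ℓ ⊔ p) where
    field
      {arity} : ℕ
      family  : L-Formula (Fin m ⊎ Fin arity)
      encode  : Tuple m → Tuple arity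
      spec    : ∀ g y → R g y ⇔ ([ y , encode g ] ⊨ family)

  definableFamily : ∀ {k} {R : Tuple m → Tuple m → Tuple k → Set p} →
    Definable {Fin m ⊎ (Fin m ⊎ Fin k)} (λ v → R (v ∘ inj₂ ∘ inj₁) (v ∘ inj₁) (v ∘ inj₂ ∘ inj₂)) →
    ∀ z → DefinableFamily (λ g y → R g y z)
  definableFamily {k = k} {R} dR z = record
    { family = formula (rename dR [ inj₁ , inj₂ ∘ code F ])
    ; encode = λ g → [ g , z ] ∘ decode F
    ; spec   = λ g y → mk⇔
        (λ h → to (defines (rename dR [ inj₁ , inj₂ ∘ code F ]) _)
          (definable-resp dR {[ y , [ g , z ] ]} (λ x → Setoid.sym (ExpandedGroup.setoid G) (same g y x)) h))
        (λ h → definable-resp dR {w = [ y , [ g , z ] ]} (same g y)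
          (from (defines (rename dR [ inj₁ , inj₂ ∘ code F ]) [ y , [ g , z ] ∘ decode F ]) h))
    }
    where
    F = finite-⊎ (finite-Fin m) (finite-Fin k)
    same : ∀ g y x → [ y , [ g , z ] ∘ decode F ] ([ inj₁ , inj₂ ∘ code F ] x) ≈ [ y , [ g , z ] ] x
    same g y (inj₁ i) = reflexive ≡.refl
    same g y (inj₂ x) = reflexive (cong [ g , z ] (decode-code F x))

  definableFamily-⇔ : {R : Tuple m → Tuple m → Set p} {S : Tuple m → Tuple m → Set q} →
    (∀ g y → R g y ⇔ S g y) → DefinableFamily R → DefinableFamily S
  definableFamily-⇔ R⇔S 𝓡 = record
    { family = family ; encode = encode
    ; spec   = λ g y → mk⇔ (to (spec g y) ∘ from (R⇔S g y)) (to (R⇔S g y) ∘ from (spec g y)) }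
    where open DefinableFamily 𝓡

  module _ (H : AclᵉᵠSubgroup m) where
    open Scheme (subgroup-scheme H) renaming (size to s)

    private
      z : Tuple s
      z = proj₁ (subgroup-scheme-complete H)
      H⇔ : ∀ y → subset H y ⇔ Member y z
      H⇔ = proj₂ (proj₂ (subgroup-scheme-complete H))

      member : ∀ {X : Set} {f : (X → Carrier) → Tuple m} (ρ : Fin s → X) →
        (∀ i → IsTerm (λ v → f v i)) → Definable (λ v → Member (f v) (v ∘ ρ))
      member {f = f} ρ f-term = definable-∘ member-def {f = λ v → [ f v , v ∘ ρ ]}
        λ { (inj₁ i) → f-term i ; (inj₂ j) → isTerm-var (ρ j) }

    opaque
      conjugates-family : DefinableFamily (λ g → conjugate g (subset H))
      conjugates-family = definableFamily-⇔ (λ g y → mk⇔ (from (H⇔ _)) (to (H⇔ _)))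
        (definableFamily {R = λ g y z → Member (g ⁻¹ ∙ (y ∙ g)) z}
          (member (inj₂ ∘ inj₂) λ i →
            isTerm-∙ (isTerm-⁻¹ (isTerm-var _)) (isTerm-∙ (isTerm-var _) (isTerm-var _))) z)

      doubleCosets-family : DefinableFamily (doubleCoset (subset H))
      doubleCosets-family = definableFamily-⇔
        (λ g y → mk⇔
          (λ { (h , h′ , h∈ , h′∈ , eq) → h , h′ , from (H⇔ h) h∈ , from (H⇔ h′) h′∈ , eq })
          (λ { (h , h′ , h∈ , h′∈ , eq) → h , h′ , to (H⇔ h) h∈ , to (H⇔ h′) h′∈ , eq }))
        (definableFamily {R = λ g y z → ∃[ h ] ∃[ h′ ] Member h z × Member h′ z × y ≋ h ∙ (g ∙ h′)}
          (definable-∃ⁿ {P = λ u → ∃[ h′ ] Member (u ∘ inj₂) (u ∘ inj₁ ∘ inj₂ ∘ inj₂) ×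
                           Member h′ (u ∘ inj₁ ∘ inj₂ ∘ inj₂) ×
                           u ∘ inj₁ ∘ inj₁ ≋ u ∘ inj₂ ∙ (u ∘ inj₁ ∘ inj₂ ∘ inj₁ ∙ h′)}
            (definable-∃ⁿ {P = λ u → Member (u ∘ inj₁ ∘ inj₂) (u ∘ inj₁ ∘ inj₁ ∘ inj₂ ∘ inj₂) ×
                           Member (u ∘ inj₂) (u ∘ inj₁ ∘ inj₁ ∘ inj₂ ∘ inj₂) ×
                           u ∘ inj₁ ∘ inj₁ ∘ inj₁ ≋ u ∘ inj₁ ∘ inj₂ ∙ (u ∘ inj₁ ∘ inj₁ ∘ inj₂ ∘ inj₁ ∙ u ∘ inj₂)}
              (definable-× (member (inj₁ ∘ inj₁ ∘ inj₂ ∘ inj₂) λ i → isTerm-var _)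
              (definable-× (member (inj₁ ∘ inj₁ ∘ inj₂ ∘ inj₂) λ i → isTerm-var _)
                (definable-∀fin λ i → definable-≈ (isTerm-var _)
                  (isTerm-∙ (isTerm-var _) (isTerm-∙ (isTerm-var _) (isTerm-var _)))))))) z)

    -- Only finitely many commensurability classes contain a conjugate of
    -- H, as these are all determined by cosets of the same subgroups.
    opaque
      conjugates-labelled : ∃[ k ] Σ[ lab ∈ (Tuple m → Fin k) ]
        (∀ g g′ → lab g ≡ lab g′ → conjugate g (subset H) ≲ conjugate g′ (subset H))
      conjugates-labelled = _ , (λ g → proj₁ (class g)) , λ g g′ → same-class (class g) (class g′)
        where
        open DefinableFamily conjugates-family
        L : Fin (proj₁ (proj₁ (uniform family))) → AclᵉᵠSubgroup m
        L = proj₂ (proj₁ (uniform family))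
        Class : Tuple m → Set ℓ
        Class g = ∃[ σ ] conjugate g (subset H) ≲ ⋂[ σ ] (subset ∘ L) ×
                         ⋂[ σ ] (subset ∘ L) ≲ conjugate g (subset H)
        class : ∀ g → Class g
        class g = let cs , captures = proj₂ (uniform family) (encode g) in
          determined-subgroup {Q = conjugate g (subset H)} (conjugate-isSubgroup g (isSubgroup H))
            {Ls = subset ∘ L} (isSubgroup ∘ L) cs
            λ {x} {y} agree h → from (spec g y) (captures {x} {y} agree (to (spec g x) h))
        same-class : ∀ {g g′} (C : Class g) (C′ : Class g′) → proj₁ C ≡ proj₁ C′ →
                     conjugate g (subset H) ≲ conjugate g′ (subset H)
        same-class {g} {g′} (σ , g≲σ , _) (_ , _ , σ≲g′) ≡.refl =
          ≲-trans {K = conjugate g′ (subset H)} {P = conjugate g (subset H)} {H = ⋂[ σ ] (subset ∘ L)}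
            (conjugate-isSubgroup g′ (isSubgroup H)) g≲σ σ≲g′

  -- Lower bounds from an independent family

  module LowerBound {d : ℕ} (H : Fin d → AclᵉᵠSubgroup m) (indep : Independent H) where

    private
      ⟨H_⟩ : Fin d → Pred (Tuple m) ℓ
      ⟨H i ⟩ = subset (H i)

      H≤G : ∀ i → IsSubgroup ⟨H i ⟩
      H≤G i = isSubgroup (H i)

      opaque
        -- If finitely many double cosets covered the intersection of the others, `doubleCosets-≲`
        -- would contradict independence.
        sequence : ∀ i → Σ[ s ∈ (ℕ → Tuple m) ] (∀ n → s n ∈ ⋂-others H i) ×
                   (∀ {k l} → k ℕ.< l → ¬ (s l ∈ doubleCoset ⟨H i ⟩ (s k)))
        sequence i = separated (⋂-others H i) (doubleCoset ⟨H i ⟩) λ gs cover →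
          let _ , lab , same = conjugates-labelled (H i) in
          indep i (doubleCosets-≲ (H≤G i) (⋂-isSubgroup λ j → ⋂-isSubgroup λ _ → H≤G j) lab same gs
            λ x → cover x)

      g : Fin d → ℕ → Tuple m
      g i = proj₁ (sequence i)

      g-separated : ∀ i {k l} → g i l ∈ doubleCoset ⟨H i ⟩ (g i k) → k ≡ l
      g-separated i {k} {l} h with ℕ.<-cmp k l
      ... | tri< k<l _ _ = contradiction h (proj₂ (proj₂ (sequence i)) k<l)
      ... | tri≈ _ k≡l _ = k≡l
      ... | tri> _ _ l<k = contradiction (doubleCoset-sym (H≤G i) h) (proj₂ (proj₂ (sequence i)) l<k)

    point : (Fin d → ℕ) → Tuple m
    point η = ∏ λ i → g i (η i)

    point-∈ : ∀ η i → point η ∈ doubleCoset ⟨H i ⟩ (g i (η i))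
    point-∈ η i = ∏-∈-doubleCoset (H≤G i) i λ j j≢i → proj₁ (proj₂ (sequence j)) (η j) i (j≢i ∘ ≡.sym)

    point-∈⁻ : ∀ η i k → point η ∈ doubleCoset ⟨H i ⟩ (g i k) → k ≡ η i
    point-∈⁻ η i k h = g-separated i (doubleCoset-join (H≤G i) h (point-∈ η i))

    open module 𝓗 i = DefinableFamily (doubleCosets-family (H i))

    pattern-of-depth : InpPattern (x=x m) (Fin d)
    pattern-of-depth = record
      { arity = λ i → arity i
      ; φ     = family
      -- Distinct double cosets of a subgroup are disjoint.
      ; k     = λ _ → 2
      ; array = λ i n → encode i (g i n)
      ; rows  = λ { i s s-inj (x , x∈) → contradiction
                  (s-inj (g-separated i (doubleCoset-join (H≤G i)
                    (from (spec i _ _) (x∈ zero)) (from (spec i _ _) (x∈ (suc zero))))))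
                  λ () }
      ; paths = λ η ψs ψs∈ → point η , All.map
          (λ { (inj₁ (i , ψ≡)) → subst (λ ψ → point η ∈ ⟦ ψ ⟧) (≡.sym ψ≡) (reflexive ≡.refl)
             ; (inj₂ (i , ψ≡)) → subst (λ ψ → point η ∈ ⟦ ψ ⟧) (≡.sym ψ≡)
                                   (to (spec i (g i (η i)) (point η)) (point-∈ η i)) }) ψs∈
      }

    private
      coordinates : Finite (Σ[ i ∈ Fin d ] Fin (arity i))
      coordinates = finite-Σ λ i → finite-Fin (arity i)

      -- A tuple x encodes one double coset for every i, and ψ(x; y) says
      -- that y lies in one of them.
      opaque
        union-def : Definable {Fin (size coordinates) ⊎ Fin m}
          (λ v → ∃[ i ] [ v ∘ inj₂ , (λ j → v (inj₁ (code coordinates (i , j)))) ] ⊨ family i)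
        union-def = definable-∃fin λ i → definable-∘ (definable-formula (family i))
          {f = λ v → [ v ∘ inj₂ , (λ j → v (inj₁ (code coordinates (i , j)))) ]}
          λ { (inj₁ _) → isTerm-var _ ; (inj₂ _) → isTerm-var _ }

    vc-formula : L-Formula (Fin (size coordinates) ⊎ Fin m)
    vc-formula = formula union-def

    private
      double-cosets : (Fin d → ℕ) → Tuple (size coordinates)
      double-cosets k l = let i , j = decode coordinates l in encode i (g i (k i)) j

      double-cosets-≈ : ∀ k i j → double-cosets k (code coordinates (i , j)) ≈ encode i (g i (k i)) j
      double-cosets-≈ k i j = reflexive
        (cong (λ { (i , j) → encode i (g i (k i)) j }) (decode-code coordinates (i , j)))

      ∈-vc-formula : ∀ k y → y ∈ (λ y → double-cosets k ∈ 𝒮 vc-formula y) ⇔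
                             (∃[ i ] y ∈ doubleCoset ⟨H i ⟩ (g i (k i)))
      ∈-vc-formula k y = mk⇔
        (λ h → let i , h′ = from (defines union-def [ double-cosets k , y ]) h in
          i , from (spec i _ _) (⊨-resp (family i)
            (λ { (inj₁ _) → reflexive ≡.refl ; (inj₂ j) → double-cosets-≈ k i j }) h′))
        (λ { (i , h) → to (defines union-def [ double-cosets k , y ]) (i , ⊨-resp (family i)
            (λ { (inj₁ _) → reflexive ≡.refl
               ; (inj₂ j) → Setoid.sym (ExpandedGroup.setoid G) (double-cosets-≈ k i j) })
            (to (spec i _ _) h)) })

      -- Index 0 is reserved for the idle coordinates. The points `point (η̂ η)` use positive
      -- indices only and miss all double cosets of index 0, so for them the tuple encoded by
      -- `at i k` stands for the single double coset of g i (k + 1).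
      at : Fin d → ℕ → Fin d → ℕ
      at i k j with j Fin.≟ i
      ... | yes _ = suc k
      ... | no  _ = 0

      at-same : ∀ i k → at i k i ≡ suc k
      at-same i k with i Fin.≟ i
      ... | yes _  = ≡.refl
      ... | no i≢i = contradiction ≡.refl i≢i

      at-suc : ∀ i k j {l} → at i k j ≡ suc l → j ≡ i × k ≡ l
      at-suc i k j eq with j Fin.≟ i
      at-suc i k j eq | yes j≡i = j≡i , ℕ.suc-injective eq

      double-cosets-injective : ∀ k l i → (∀ j → double-cosets k j ≈ double-cosets l j) → k i ≡ l i
      double-cosets-injective k l i eq = ≡.sym (g-separated i
        (from (spec i _ _) (⊨-resp (family i)
          (λ { (inj₁ _) → reflexive ≡.refl
             ; (inj₂ j) → trans (sym (double-cosets-≈ k i j))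
                 (trans (eq (code coordinates (i , j))) (double-cosets-≈ l i j)) })
          (to (spec i _ _) (doubleCoset-refl (H≤G i))))))
        where open ExpandedGroup G using (trans; sym)

    -- The points of G^m act as parameters y, and the d · n encoded tuples as objects. The trace of
    -- `point (η̂ η)` tells for every i which k equals the i-th digit of η, so all n ^ d traces
    -- differ.
    vc≥ : ∀ v → VC.IsVCDensity (Group.setoid (power (size coordinates))) (𝒮 vc-formula) v → fromℕᴿ d ≤ᴿ v
    vc≥ = ≤density (Group.setoid (power (size coordinates))) (𝒮 vc-formula) d λ n →
      A n , A-injective n , (λ η → point (η̂ η)) , λ {η} {η′} same → finToFun-injective {d} {n} λ i →
        Fin.toℕ-injective (missed η′ i (Fin.toℕ (finToFun {n} {d} η i))
          (to (same-at {n} {λ x → x ∈ 𝒮 vc-formula (point (η̂ η))} {λ x → x ∈ 𝒮 vc-formula (point (η̂ η′))}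
                same i (finToFun {n} {d} η i)) (hit η i)))
      where
      η̂ : ∀ {n} → Fin (n ℕ.^ d) → Fin d → ℕ
      η̂ {n} η i = suc (Fin.toℕ (finToFun {n} {d} η i))
      A : ∀ n → Fin (d ℕ.* n) → Tuple (size coordinates)
      A n l = let i , k = Fin.remQuot {d} n l in double-cosets (at i (Fin.toℕ k))
      A-injective : ∀ n {l l′} → (∀ j → A n l j ≈ A n l′ j) → l ≡ l′
      A-injective n {l} {l′} eq = ≡.trans (≡.sym (Fin.combine-remQuot {d} n l))
        (≡.trans (≡.cong₂ Fin.combine (proj₁ eqs) (Fin.toℕ-injective (≡.sym (proj₂ eqs))))
                 (Fin.combine-remQuot {d} n l′))
        where
        i  = proj₁ (Fin.remQuot {d} n l)
        i′ = proj₁ (Fin.remQuot {d} n l′)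
        k  = Fin.toℕ (proj₂ (Fin.remQuot {d} n l))
        k′ = Fin.toℕ (proj₂ (Fin.remQuot {d} n l′))
        eqs = at-suc i′ k′ i (≡.trans (≡.sym (double-cosets-injective (at i k) (at i′ k′) i eq)) (at-same i k))
      hit : ∀ {n} (η : Fin (n ℕ.^ d)) i →
        double-cosets (at i (Fin.toℕ (finToFun {n} {d} η i))) ∈ 𝒮 vc-formula (point (η̂ η))
      hit η i = from (∈-vc-formula (at i _) (point (η̂ η))) (i ,
        subst (λ k → point (η̂ η) ∈ doubleCoset ⟨H i ⟩ (g i k)) (≡.sym (at-same i _)) (point-∈ (η̂ η) i))
      missed : ∀ {n} (η : Fin (n ℕ.^ d)) i k → double-cosets (at i k) ∈ 𝒮 vc-formula (point (η̂ η)) →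
               k ≡ Fin.toℕ (finToFun {n} {d} η i)
      missed η i k h with j , h′ ← to (∈-vc-formula (at i k) (point (η̂ η))) h
        with ≡.refl , eq ← at-suc i k j (point-∈⁻ (η̂ η) j _ h′) = eq
      same-at : ∀ {n} {P Q : Pred (Tuple (size coordinates)) ℓ} → (∀ l → A n l ∈ P ⇔ A n l ∈ Q) →
        ∀ i (k : Fin n) → double-cosets (at i (Fin.toℕ k)) ∈ P ⇔ double-cosets (at i (Fin.toℕ k)) ∈ Q
      same-at {n} {P} {Q} same i k = subst
        (λ ik → double-cosets (at (proj₁ ik) (Fin.toℕ (proj₂ ik))) ∈ P ⇔
                double-cosets (at (proj₁ ik) (Fin.toℕ (proj₂ ik))) ∈ Q)
        (Fin.remQuot-combine {d} {n} i k) (same (Fin.combine i k))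

  -- Upper bounds in the absence of independent families

  -- One family for all rows together, so that a single labelling controls a whole column of a
  -- pattern.
  uniform-rows : ∀ {e} {arity : Fin e → ℕ} (φ : ∀ α → L-Formula (Fin m ⊎ Fin (arity α))) →
    Σ[ F ∈ Family ] (∀ (a : ∀ α → Tuple (arity α)) →
      Captures F (λ x y → ∀ α → [ x , a α ] ⊨ φ α → [ y , a α ] ⊨ φ α))
  uniform-rows {zero}  φ = (0 , λ ()) , λ a → (λ ()) , λ _ ()
  uniform-rows {suc e} {arity} φ = F ⊕ F′ , λ a →
    captures-map {E = λ x y → Transfer a zero x y × (∀ α → Transfer a (suc α) x y)}
      {E′ = λ x y → ∀ α → Transfer a α x y} (λ { h zero → proj₁ h ; h (suc α) → proj₂ h α })
      (captures-⊕ F F′ {E = Transfer a zero} {E′ = λ x y → ∀ α → Transfer a (suc α) x y}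
        (proj₂ (uniform (φ zero)) (a zero)) (proj₂ (uniform-rows (φ ∘ suc)) (a ∘ suc)))
    where
    F  = proj₁ (uniform (φ zero))
    F′ = proj₁ (uniform-rows (φ ∘ suc))
    Transfer : (∀ α → Tuple (arity α)) → ∀ α → Tuple m → Tuple m → Set ℓ
    Transfer a α x y = [ x , a α ] ⊨ φ α → [ y , a α ] ⊨ φ α

  module UpperBound {d : ℕ} (dependent : (H : Fin (suc d) → AclᵉᵠSubgroup m) → ¬ Independent H) where

    label-family : (F : Family) → ∃[ K ] ∀ n .{{_ : ℕ.NonZero n}} {E : Fin n → Tuple m → Tuple m → Set p} →
      (∀ i → Captures F (E i)) →
      Σ[ lab ∈ (Tuple m → Fin (K ℕ.* n ℕ.^ d)) ] (∀ {x y} → lab x ≡ lab y → ∀ i → E i x y)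
    label-family (r , L) = K , λ n captured →
      let lab , same = labelling n (Captures.reps ∘ captured)
      in lab , λ {x} {y} eq i → Captures.captures (captured i) {x} {y} (same {x} {y} eq i)
      where
      labels = label-cosets {d = d} {L = subset ∘ L} (isSubgroup ∘ L) (basis dependent L)
      K = proj₁ labels
      labelling = proj₂ labels

    -- The parameters of φ range over G^m, so φ is turned around: points of G^m are labelled by the
    -- cosets that determine its fibres over the n objects, and equal labels give equal traces.
    vc≤ : ∀ {p} (φ : L-Formula (Fin p ⊎ Fin m)) v →
          VC.IsVCDensity (Group.setoid (power p)) (𝒮 φ) v → v ≤ᴿ fromℕᴿ d
    vc≤ {p} φ = density≤ (Group.setoid (power p)) (𝒮 φ) d (proj₁ labels) λ n A →
      proj₂ labels n λ i → captures-map
        (λ h → ⊨φ _ (A i) ∘ h ∘ ⊨φ⁻¹ _ (A i)) (proj₂ uniformity (A i))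
      where
      swap-def : Definable (λ v → [ v ∘ inj₂ , v ∘ inj₁ ] ⊨ φ)
      swap-def = definable-∘ (definable-formula φ) {f = λ v → [ v ∘ inj₂ , v ∘ inj₁ ]}
        λ { (inj₁ _) → isTerm-var _ ; (inj₂ _) → isTerm-var _ }
      uniformity = uniform (formula swap-def)
      labels = label-family (proj₁ uniformity)
      ⊨φ : ∀ y a → [ y , a ] ⊨ formula swap-def → [ a , y ] ⊨ φ
      ⊨φ y a = from (defines swap-def [ y , a ])
      ⊨φ⁻¹ : ∀ y a → [ a , y ] ⊨ φ → [ y , a ] ⊨ formula swap-def
      ⊨φ⁻¹ y a = to (defines swap-def [ y , a ])

    -- A pattern of depth d + 1 gives points x η for η : Fin (d + 1) → Fin n.
    -- Those in one class of the labelling satisfy the same formulas of the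
    -- array, so each row leaves boundedly many possibilities for η.
    module _ {κ : Set} (pattern-κ : InpPattern (x=x m) κ)
             (row : Fin (suc d) → κ) (row-injective : Injective _≡_ _≡_ row) where
      open InpPattern pattern-κ

      private
        formulas : (η : Fin (suc d) → ℕ) → Fin (suc d) → ParamFormula m
        formulas η α = φ (row α) ⟨ array (row α) (η α) ⟩

        -- A path has to choose an entry in every row of the pattern; 0 is taken in the rows that
        -- were not selected.
        extend : (Fin (suc d) → ℕ) → κ → ℕ
        extend η β = orElse (λ n → ∃[ α ] row α ≡ β × η α ≡ n) 0

        extend-row : ∀ η α → extend η (row α) ≡ η α
        extend-row η α with α′ , eq , eq′ ← orElse-∈ {P = λ n → ∃[ α′ ] row α′ ≡ row α × η α′ ≡ n} {0}
                                            (η α , α , ≡.refl , ≡.refl) =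
          ≡.trans (≡.sym eq′) (cong η (row-injective eq))

        path : ∀ η → ∃[ x ] ∀ α → x ∈ ⟦ formulas η α ⟧
        path η with x , x∈ ← paths (extend η) (tabulate (formulas η)) (All.tabulate⁺ λ α →
                      inj₂ (row α , cong (λ n → φ (row α) ⟨ array (row α) n ⟩) (≡.sym (extend-row η α)))) =
          x , All.tabulate⁻ {f = formulas η} x∈

        uniformity = uniform-rows (φ ∘ row)
        labels = label-family {p = ℓ} (proj₁ uniformity)
        K = proj₁ labels
        bound = bounded (k ∘ row)
        w = proj₁ bound

        module _ (n : ℕ) .{{_ : ℕ.NonZero n}} where
          -- A column of the array, taken over all d + 1 rows, counts as one of n items. Hence there
          -- are K · n ^ d labels with K independent of n.
          labelling = proj₂ labels n λ i → proj₂ uniformity λ α → array (row α) (Fin.toℕ {n} i)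
          lab = proj₁ labelling
          η̂ : Fin (n ℕ.^ suc d) → Fin (suc d) → ℕ
          η̂ η α = Fin.toℕ (finToFun {n} {suc d} η α)
          x : Fin (n ℕ.^ suc d) → Tuple m
          x η = proj₁ (path (η̂ η))

          rep : Fin (K ℕ.* n ℕ.^ d) → Tuple m
          rep c = orElse (λ y → lab y ≡ c) ε

          Hits : Fin (K ℕ.* n ℕ.^ d) → Fin (suc d) → Pred ℕ ℓ
          Hits c α i = rep c ∈ ⟦ φ (row α) ⟨ array (row α) i ⟩ ⟧

          -- By inconsistency of the row, one point satisfies fewer than `k (row α)` of its
          -- formulas, a bound that does not involve n.
          few-hits : ∀ c α → ∃[ xs ] length xs ℕ.< k (row α) × (∀ {i} → Hits c α i → i ∈ₗ xs)
          few-hits c α with enumerate (Hits c α) (k (row α))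
          ... | inj₁ (s , s-inj , hits) = contradiction (rep c , hits) (rows (row α) s s-inj)
          ... | inj₂ few = few

          hit : ∀ {c} η → lab (x η) ≡ c → ∀ α → Hits c α (η̂ η α)
          hit {c} η eq α = proj₂ labelling
            (≡.trans eq (≡.sym (orElse-∈ {P = λ y → lab y ≡ c} {ε} (x η , eq))))
            (finToFun {n} {suc d} η α) α (proj₂ (path (η̂ η)) α)

          listed : ∀ {c} η → lab (x η) ≡ c → ∀ α → η̂ η α ∈ₗ proj₁ (few-hits c α)
          listed {c} η eq α = proj₂ (proj₂ (few-hits c α)) (hit η eq α)

          choice : ∀ {c} η → lab (x η) ≡ c → Fin (suc d) → Fin w
          choice {c} η eq α = Fin.inject≤ (Any.index (listed η eq α))
            (ℕ.≤-trans (ℕ.<⇒≤ (proj₁ (proj₂ (few-hits c α)))) (proj₂ bound α))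

          -- A path is recovered from its class c and, for each row, the position of its entry among
          -- the few hits of the representative of c.
          code-path : ∀ {c} η → lab (x η) ≡ c → Fin (K ℕ.* n ℕ.^ d ℕ.* w ℕ.^ suc d)
          code-path {c} η eq = Fin.combine c (funToFin (choice η eq))

          code-path-injective : ∀ {c c′} η η′ (eq : lab (x η) ≡ c) (eq′ : lab (x η′) ≡ c′) →
            code-path η eq ≡ code-path η′ eq′ → η ≡ η′
          code-path-injective {c} {c′} η η′ eq eq′ same
            with ≡.refl ← Fin.combine-injectiveˡ c (funToFin (choice η eq)) c′ (funToFin (choice η′ eq′)) same =
            finToFun-injective {suc d} {n} λ α → Fin.toℕ-injective
              (≡.trans (Any.lookup-index (listed η eq α))
              (≡.trans (cong (lookup (proj₁ (few-hits c α))) (indices α))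
                       (≡.sym (Any.lookup-index (listed η′ eq′ α)))))
            where
            indices : ∀ α → Any.index (listed η eq α) ≡ Any.index (listed η′ eq′ α)
            indices α = Fin.inject≤-injective _ _ _ _
              (≡.trans (≡.sym (Fin.finToFun-funToFin (choice η eq) α))
              (≡.trans (cong (λ σ → finToFun σ α) (Fin.combine-injectiveʳ c (funToFin (choice η eq)) c _ same))
                       (Fin.finToFun-funToFin (choice η′ eq′) α)))

          paths≤ : n ℕ.^ suc d ℕ.≤ K ℕ.* w ℕ.^ suc d ℕ.* n ℕ.^ d
          paths≤ = ℕ.≤-trans
            (Fin.injective⇒≤ {f = λ η → code-path η ≡.refl}
              (λ {η} {η′} → code-path-injective η η′ ≡.refl ≡.refl))
            (ℕ.≤-reflexive (≡.trans (ℕ.*-assoc K (n ℕ.^ d) (w ℕ.^ suc d))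
              (≡.trans (cong (K ℕ.*_) (ℕ.*-comm (n ℕ.^ d) (w ℕ.^ suc d)))
                       (≡.sym (ℕ.*-assoc K (w ℕ.^ suc d) (n ℕ.^ d))))))

      no-deep-pattern : ⊥
      no-deep-pattern = ℕ.<-irrefl ≡.refl (power-growth (K ℕ.* w ℕ.^ suc d) 1 {suc d} {d}
        λ n 1≤n → paths≤ n {{ℕ.>-nonZero 1≤n}})

    -- The depth κ is an arbitrary type: either d + 1 distinct rows can be picked from it, which is
    -- impossible, or a list of at most d elements exhausts it.
    dp≤ : DpAtMost (x=x m) (Fin d)
    dp≤ κ pattern-κ with enumerate {A = κ} (λ _ → ⊤ {Level.zero}) (suc d)
    ... | inj₁ (row , row-injective , _) = ⊥-elim (no-deep-pattern pattern-κ row row-injective)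
    ... | inj₂ (xs , ℕ.s≤s ≤d , cover) =
      mk↣ {to = λ β → Fin.inject≤ (Any.index (cover {β} _)) ≤d} λ {β} {γ} eq →
      ≡.trans (Any.lookup-index (cover {β} _))
        (≡.trans (cong (lookup xs) (Fin.inject≤-injective _ _ _ _ eq)) (≡.sym (Any.lookup-index (cover {γ} _))))

  -- The finite and the infinite case

  ≤ᴿ-trans : ∀ {x y z} → x ≤ᴿ y → y ≤ᴿ z → x ≤ᴿ z
  ≤ᴿ-trans x≤y y≤z q z<q = x≤y q (y≤z q z<q)

  fin-↣⇒≤ : ∀ {k l} → Fin k ↣ Fin l → k ℕ.≤ l
  fin-↣⇒≤ f = Fin.injective⇒≤ (Injection.injective f)

  dpRank-unique : ∀ {n d e} {π : PartialType n} → IsDpRank π (Fin d) → IsDpRank π (Fin e) → d ≡ e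
  dpRank-unique (d-max , d-least) (e-max , e-least) =
    ℕ.≤-antisym (fin-↣⇒≤ (d-least _ e-max)) (fin-↣⇒≤ (e-least _ d-max))

  Family-of-size : ℕ → Set (Level.suc ℓ)
  Family-of-size n = Σ[ H ∈ (Fin n → AclᵉᵠSubgroup m) ] Independent H

  density-of : ∀ {d} → Family-of-size d →
    ∀ w → (∀ v → (∃[ p ] Σ[ φ ∈ L-Formula (Fin p ⊎ Fin m) ]
                     VC.IsVCDensity (Group.setoid (power p)) (𝒮 φ) v) → v ≤ᴿ w) →
    fromℕᴿ d ≤ᴿ w
  density-of {d} (H , indep) w w≥ =
    let v , v-density = inf _ in
    ≤ᴿ-trans {fromℕᴿ d} {v} {w} (vc≥ v v-density) (w≥ v (_ , vc-formula , v-density))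
    where open LowerBound H indep

  finite-case : ∀ {d} → Family-of-size d → ¬ Family-of-size (suc d) →
    IsDpRank (x=x m) (Fin d) × IsVCT m (fromℕᴿ d) × IsCommensurabilityBreadth m d
  finite-case {d} F@(H , indep) none =
    (dp≤ , λ ν ν-max → ν-max (Fin d) (LowerBound.pattern-of-depth H indep)) ,
    ((λ { v (p , φ , v-density) → vc≤ φ v v-density }) , density-of F) ,
    (breadth≤ dependent , ≤breadth {x = H} indep)
    where
    dependent : (H : Fin (suc d) → AclᵉᵠSubgroup m) → ¬ Independent H
    dependent H indep = none (H , indep)
    open UpperBound dependent

  infinite-case : (∀ d → Family-of-size d) → DpInfinite (x=x m) × IsVCT m ∞ᴿ
  infinite-case families =
    (λ d (d-max , _) → let H , indep = families (suc d) in
      ℕ.<-irrefl ≡.refl (fin-↣⇒≤ (d-max _ (LowerBound.pattern-of-depth H indep)))) ,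
    (λ _ _ _ ()) ,
    -- A rational above w would lie below some integer d, against d ≤ w.
    λ w w≥ q w<q → let d , q≤d = ∃ℕ≥ q in
      ℚ.<-irrefl ≡.refl (ℚ.<-≤-trans (density-of (families d) w w≥ q w<q) q≤d)

  -- The empty family is independent, so the least size without an independent family is a successor
  -- d + 1; excluding this size is exactly the assumption of `remove-one`.
  dichotomy : (∀ d → Family-of-size d) ⊎ (∃[ d ] Family-of-size d × ¬ Family-of-size (suc d))
  dichotomy with em {P = ∀ d → Family-of-size d}
  ... | yes all = inj₁ all
  ... | no ¬all with least (λ d → ¬ Family-of-size d) (¬∀⇒∃¬ ¬all)
  ...   | zero  , none , _    = contradiction ((λ ()) , λ ()) none
  ...   | suc d , none , smallest = inj₂ (d ,
          byContradiction (λ none′ → ℕ.<-irrefl ≡.refl (smallest d none′)) , none)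

theorem3p7 : (∀ {a} → ExcludedMiddle a) →
    ∀ {ℓ} (G : ExpandedGroup ℓ) → let open ModelTheory G in
    Infinite → Saturated → OneBased →
    ∀ m → 1 ≤ m →
    ((DpInfinite (x=x m) × IsVCT m ∞ᴿ) ⊎
    (∃[ d ] IsDpRank (x=x m) (Fin d) × IsVCT m (fromℕᴿ d))) ×
    (∀ d v → IsDpRank (x=x m) (Fin d) → IsVCT m v → IsFinite v →
    (v ≈ᴿ fromℕᴿ d) × IsCommensurabilityBreadth m d)
theorem3p7 em G _ saturated oneBased m _ with Main.dichotomy em G saturated oneBased m
... | inj₁ families =
  let dp-infinite , vc-infinite = Main.infinite-case em G saturated oneBased m families in
  inj₁ (dp-infinite , vc-infinite) , λ d v d-rank _ _ → contradiction d-rank (dp-infinite d)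
... | inj₂ (d , family , none) =
  let d-rank , d-vc , d-breadth = Main.finite-case em G saturated oneBased m family none in
  inj₂ (d , d-rank , d-vc) , λ e v e-rank v-vc _ →
    -- Dp-rank and supremum are unique, so the arbitrary e and v agree with the d found above.
    case Main.dpRank-unique em G saturated oneBased m d-rank e-rank of λ
      { ≡.refl → (proj₂ v-vc (fromℕᴿ d) (proj₁ d-vc) , proj₂ d-vc v (proj₁ v-vc)) , d-breadth }
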